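{- Let $\ell\le m$ be positive integers and let $X=x_{\ell+1}x_{\ell+2}\cdots x_m$ be any permutation of the set $\{\ell+1,\ell+2,\dots,m\}$. Then the permutation pattern $1\,2\,3\cdots(\ell-1)\,\ell\,X$ (i.e. the permutation $1,2,\dots,\ell,x_{\ell+1},\dots,x_m$ of $[m]$) is strongly $\star$-Wilf-equivalent to the pattern $\ell\,(\ell-1)\cdots 2\,1\,X$.
   Context: A hole is a special symbol $\diamond$. For $0\le k\le n$, $S_n^k$ denotes the set of partial permutations of length $n$ with $k$ holes: sequences $\pi=\pi_1\cdots\pi_n$ in which each number of $[n-k]=\{1,\dots,n-k\}$ appears exactly once and the remaining $k$ entries are $\diamond$. For $H\subseteq[n]$ with $|H|=k$, $S_n^H$ is the set of $\pi\in S_n^k$ with $\pi_i=\diamond$ exactly for $i\in H$. The standardization of a sequence of distinct integers replaces its $i$-th smallest entry by $i$. If $i(1)<\dots<i(n-k)$ are the positions of the non-holes of $\pi\in S_n^k$, a permutation $\sigma$ of $[n]$ is an extension of $\pi$ if the standardization of $\sigma_{i(1)}\cdots\sigma_{i(n-k)}$ equals $\pi_{i(1)}\cdots\pi_{i(n-k)}$. A permutation contains a pattern $p$ of length $\ell$ if it has a subsequence of length $\ell$ whose standardization is $p$. A partial permutation $\pi$ avoids $p$ if every extension of $\pi$ avoids $p$. $s_n^H(p)$ is the number of $p$-avoiding elements of $S_n^H$. Two patterns $p,q$ are strongly $\star$-Wilf-equivalent if $s_n^H(p)=s_n^H(q)$ for all $n\ge 0$ and all $H\subseteq[n]$. -}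

module Defs where

open import Data.Bool using (Bool; true; false; _∧_; _∨_; not; if_then_else_)
open import Data.Nat using (ℕ; zero; suc; _+_; _∸_; _<ᵇ_; _≡ᵇ_)
open import Data.List using (List; []; _∷_; map; length; filterᵇ; catMaybes; upTo; reverse; _++_; concatMap)
open import Data.Bool.ListAction using (all; any)
open import Data.Maybe using (Maybe; just; nothing)
open import Data.Vec using (Vec; []; _∷_; toList)
open import Data.Fin.Subset using (Subset; ∣_∣)

_==L_ : List ℕ → List ℕ → Bool
[] ==L [] = true
(x ∷ xs) ==L (y ∷ ys) = (x ≡ᵇ y) ∧ (xs ==L ys)
_ ==L _ = false

oneTo : ℕ → List ℕ
oneTo n = map suc (upTo n)

occ : ℕ → List ℕ → ℕ
occ x xs = length (filterᵇ (x ≡ᵇ_) xs)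

isPermOf : ℕ → List ℕ → Bool
isPermOf m xs = (length xs ≡ᵇ m) ∧ all (λ i → occ i xs ≡ᵇ 1) (oneTo m)

std : List ℕ → List ℕ
std xs = map (λ x → suc (length (filterᵇ (_<ᵇ x) xs))) xs

subseqs : {A : Set} → List A → List (List A)
subseqs [] = [] ∷ []
subseqs (x ∷ xs) = let r = subseqs xs in map (x ∷_) r ++ r

contains : List ℕ → List ℕ → Bool
contains σ p = any (λ s → std s ==L p) (subseqs σ)

allVecs : {A : Set} → List A → (n : ℕ) → List (Vec A n)
allVecs xs zero = [] ∷ []
allVecs xs (suc n) = concatMap (λ x → map (x ∷_) (allVecs xs n)) xs

-- Partial permutations: Vec (Maybe ℕ) n, where `nothing` is the hole ◇.
-- Entries of σ at the non-hole positions of π.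
restrict : {n : ℕ} → Vec ℕ n → Vec (Maybe ℕ) n → List ℕ
restrict [] [] = []
restrict (s ∷ σ) (nothing ∷ π) = restrict σ π
restrict (s ∷ σ) (just _ ∷ π) = s ∷ restrict σ π

holesAt : {n : ℕ} → Subset n → Vec (Maybe ℕ) n → Bool
holesAt [] [] = true
holesAt (true ∷ H) (nothing ∷ π) = holesAt H π
holesAt (false ∷ H) (just _ ∷ π) = holesAt H π
holesAt _ _ = false

inS : {n : ℕ} → Subset n → Vec (Maybe ℕ) n → Bool
inS {n} H π = holesAt H π ∧ isPermOf (n ∸ ∣ H ∣) (catMaybes (toList π))

isExtension : {n : ℕ} → Vec ℕ n → Vec (Maybe ℕ) n → Bool
isExtension {n} σ π = isPermOf n (toList σ) ∧ (std (restrict σ π) ==L catMaybes (toList π))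

avoids : {n : ℕ} → List ℕ → Vec (Maybe ℕ) n → Bool
avoids {n} p π = all (λ σ → not (isExtension σ π) ∨ not (contains (toList σ) p)) (allVecs (oneTo n) n)

candidates : (n : ℕ) → List (Vec (Maybe ℕ) n)
candidates n = allVecs (nothing ∷ map just (oneTo n)) n

s : (n : ℕ) → Subset n → List ℕ → ℕ
s n H p = length (filterᵇ (λ π → inS H π ∧ avoids p π) (candidates n))

StronglyStarWilfEquiv : List ℕ → List ℕ → Set
StronglyStarWilfEquiv p q = (n : ℕ) (H : Subset n) → s n H p ≡ s n H q
  where open import Relation.Binary.PropositionalEquality using (_≡_)

interval : ℕ → ℕ → List ℕ
interval ℓ m = map (λ i → suc (ℓ + i)) (upTo (m ∸ ℓ))

{-# OPTIONS --safe #-}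
module Submission where

-- A vertex (c , r) of the diagram of a partial permutation is good if X occurs, holes being wild, in the
-- columns from c on and the values above r. A hole can be inserted anywhere into a monotone chain, so
-- 1⋯ℓX (resp. ℓ⋯1X) occurs iff some good (c , r) has an increasing (resp. decreasing) chain of length
-- ℓ minus the number of holes among the first c columns to its lower left. The good vertices bound a Ferrers
-- shape, on whose fillings we use Krattenthaler's involution: label the vertices with partitions by
-- Fomin's growth rules, transpose the labels on the boundary of the shape, and grow backwards. It
-- exchanges longest increasing and decreasing chains at each boundary vertex, and preserves the empty rows
-- and columns, hence holes; the good vertices stay the same since they only depend on cells outside the shape.

open import Defs
open import Data.Bool using (Bool; true; false; _∧_; _∨_; not; if_then_else_; T)
open import Data.Bool.ListAction using (all; any)
open import Data.Bool.Properties using (T?)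
open import Data.Nat
open import Data.Nat.Properties
open import Data.Nat.Solver using (module +-*-Solver)
open import Data.Product using (∃; ∃₂; _×_; _,_; proj₁; proj₂)
open import Data.Sum using (_⊎_; inj₁; inj₂)
open import Data.Empty using (⊥; ⊥-elim)
open import Data.Unit using (⊤; tt)
open import Data.Maybe using (Maybe; just; nothing)
open import Data.Fin.Subset using (Subset; ∣_∣)
open import Data.Vec using (Vec; []; _∷_; toList)
open import Data.Vec.Properties using (length-toList)
open import Data.List using (List; []; _∷_; _++_; map; length; concatMap; filterᵇ; upTo; downFrom; catMaybes; take; drop; reverse; zip; initLast; _∷ʳ′_)
open import Data.List.Properties using (map-∘; map-id; map-++; map-cong-local; length-++; length-map; length-upTo; length-reverse; length-take; ++-identityʳ; upTo-∷ʳ; reverse-upTo; reverse-map; take++drop≡id; take-all; ∷-injective; ∷-injectiveˡ; ∷-injectiveʳ)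
open import Data.List.Membership.Propositional using (_∈_; _∉_)
open import Data.List.Membership.Propositional.Properties
open import Data.List.Relation.Unary.Any using (here; there)
open import Data.List.Relation.Unary.All as All using (All; []; _∷_)
import Data.List.Relation.Unary.All.Properties as All
open import Data.List.Relation.Unary.AllPairs as AllPairs using (AllPairs; []; _∷_)
import Data.List.Relation.Unary.AllPairs.Properties as AllPairs
open import Data.List.Relation.Unary.Unique.Propositional using (Unique)
import Data.List.Relation.Unary.Unique.Propositional.Properties as Unique
open import Data.List.Relation.Binary.Pointwise using (Pointwise; []; _∷_)
open import Data.List.Relation.Binary.Sublist.Propositional as Sublist using (_⊆_; ⊆-trans; ⊆-refl; minimum)
open import Data.List.Relation.Binary.Sublist.Heterogeneous.Core as Heterogeneous using ([]; _∷_; _∷ʳ_)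
import Data.List.Relation.Binary.Sublist.Propositional.Properties as Sublist
open import Data.List.Relation.Binary.Permutation.Propositional using (_↭_; ↭-sym; ↭-trans; prep; ↭-refl; ↭⇒↭ₛ)
open import Data.List.Relation.Binary.Permutation.Propositional.Properties using (∈-resp-↭; ↭-length; shift; filter-↭; ↭-reverse)
import Data.List.Relation.Binary.Permutation.Setoid.Properties as Permutationₛ
open import Relation.Nullary using (¬_; yes; no)
open import Relation.Binary.Definitions using (tri<; tri≈; tri>)
open import Relation.Binary.PropositionalEquality
open import Function using (_∘_; case_of_; _on_)
open +-*-Solver using (solve; _:+_; _:=_)

-- The chain length asked for at a vertex depends on the holes to its left, so exchanging increasing
-- and decreasing chains of one fixed length would not suffice: all lengths have to be exchanged at
-- all boundary vertices at once. Hence the involution is built without reference to ℓ. Labels are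
-- plain functions. Row k of all labels together is the statistic `lis` of a single matrix, the k-th
-- layer, and each layer is Viennot's skeleton (the corners of the shadow lines) of the one before.
-- The growth rules thereby turn into identities between numbers, row by row, and both halves of
-- Schensted's theorem come from shadow lines: layer 0 measures increasing chains, and each passage
-- to the next layer shortens the longest decreasing chain by exactly one. Every edge of the diagram
-- also records whether it adds a box. Since the labels on the axes are empty, this bookkeeping
-- forces the new filling to have the row and column sums of the old one.

private variable
  A B : Set

-- Growth diagrams

Matrix : Set
Matrix = ℕ → ℕ → Bool

⟦_⟧ : Bool → ℕ
⟦ true ⟧ = 1
⟦ false ⟧ = 0

⟦⟧≤1 : ∀ b → ⟦ b ⟧ ≤ 1
⟦⟧≤1 true = ≤-refl
⟦⟧≤1 false = z≤n

<⇒<ᵇ≡ : ∀ {m n} → m < n → (m <ᵇ n) ≡ true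
<⇒<ᵇ≡ {m} {n} p with m <ᵇ n in eq
... | true = refl
... | false = ⊥-elim (subst T eq (<⇒<ᵇ p))

≮⇒<ᵇ≡ : ∀ {m n} → ¬ (m < n) → (m <ᵇ n) ≡ false
≮⇒<ᵇ≡ {m} {n} p with m <ᵇ n in eq
... | false = refl
... | true = ⊥-elim (p (<ᵇ⇒< m n (subst T (sym eq) tt)))

<ᵇ≡⇒< : ∀ {m n} → (m <ᵇ n) ≡ true → m < n
<ᵇ≡⇒< {m} {n} e = <ᵇ⇒< m n (subst T (sym e) tt)

<ᵇ≡⇒≮ : ∀ {m n} → (m <ᵇ n) ≡ false → ¬ (m < n)
<ᵇ≡⇒≮ e p with () ← trans (sym e) (<⇒<ᵇ≡ p)

∧-true : ∀ {a b} → a ∧ b ≡ true → a ≡ true × b ≡ true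
∧-true {true} {true} _ = refl , refl

∧-intro : ∀ {a b} → a ≡ true → b ≡ true → a ∧ b ≡ true
∧-intro refl refl = refl

-- A cross adds 1 to the larger neighbour rather than to the corner value. For partial permutations
-- this is still the longest increasing chain, because a cross forces both neighbours down to the
-- corner value (`cross-col`, `cross-row`). It makes the label "maximum plus cross" in every case,
-- which is what the balance equations use.
lis : Matrix → ℕ → ℕ → ℕ
lis X zero r = 0
lis X (suc c) zero = 0
lis X (suc c) (suc r) = (lis X (suc c) r ⊔ lis X c (suc r)) + ⟦ X c r ⟧

lis-zero : ∀ X c → lis X c 0 ≡ 0
lis-zero X zero = refl
lis-zero X (suc c) = refl

-- Viennot's skeleton: the cells that a shadow line (a level line of `lis`) enters both from the
-- left and from below. There Fomin's rule finds the same row enlarged on both sides and bumps a box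
-- into the next row.
next : Matrix → Matrix
next X c r = (lis X c r <ᵇ lis X (suc c) r) ∧ (lis X c r <ᵇ lis X c (suc r))

next-jump-c : ∀ X c r → next X c r ≡ true → lis X c r < lis X (suc c) r
next-jump-c X c r e = <ᵇ≡⇒< (proj₁ (∧-true {lis X c r <ᵇ lis X (suc c) r} e))

next-jump-r : ∀ X c r → next X c r ≡ true → lis X c r < lis X c (suc r)
next-jump-r X c r e = <ᵇ≡⇒< (proj₂ (∧-true {lis X c r <ᵇ lis X (suc c) r} e))

colsum : Matrix → ℕ → ℕ → ℕ
colsum X c zero = 0
colsum X c (suc r) = ⟦ X c r ⟧ + colsum X c r

rowsum : Matrix → ℕ → ℕ → ℕ
rowsum X zero r = 0
rowsum X (suc c) r = ⟦ X c r ⟧ + rowsum X c r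

record PartialPerm (X : Matrix) : Set where
  constructor partialPerm
  field
    col≤1 : ∀ c r → colsum X c r ≤ 1
    row≤1 : ∀ c r → rowsum X c r ≤ 1
open PartialPerm

lis-suc-r : ∀ X c r → lis X c r ≤ lis X c (suc r)
lis-suc-r X zero r = z≤n
lis-suc-r X (suc c) r = ≤-trans (m≤m⊔n (lis X (suc c) r) (lis X c (suc r))) (m≤m+n _ _)

lis-suc-c : ∀ X c r → lis X c r ≤ lis X (suc c) r
lis-suc-c X c zero rewrite lis-zero X c = z≤n
lis-suc-c X c (suc r) = ≤-trans (m≤n⊔m (lis X (suc c) r) (lis X c (suc r))) (m≤m+n _ _)

mono-by-suc : (f : ℕ → ℕ) → (∀ i → f i ≤ f (suc i)) → ∀ {i j} → i ≤ j → f i ≤ f j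
mono-by-suc f h {i} {j} i≤j = subst (λ t → f i ≤ f t) (m+[n∸m]≡n i≤j) (go (j ∸ i))
  where
  go : ∀ d → f i ≤ f (i + d)
  go zero = ≤-reflexive (cong f (sym (+-identityʳ i)))
  go (suc d) = ≤-trans (go d) (subst (λ t → f (i + d) ≤ f t) (sym (+-suc i d)) (h (i + d)))

lis-mono : ∀ X {c c′ r r′} → c ≤ c′ → r ≤ r′ → lis X c r ≤ lis X c′ r′
lis-mono X {c} {c′} {r} {r′} p q =
  ≤-trans (mono-by-suc (λ c → lis X c r) (λ c → lis-suc-c X c r) p)
          (mono-by-suc (lis X c′) (lis-suc-r X c′) q)

1-step : ∀ {ρ μ} → ρ ≤ μ → μ ≤ suc ρ → μ ≡ ρ ⊎ μ ≡ suc ρ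
1-step {ρ} {μ} p q with m≤n⇒m<n∨m≡n p
... | inj₁ ρ<μ = inj₂ (≤-antisym q ρ<μ)
... | inj₂ e = inj₁ (sym e)

n<ᵇn : ∀ n → (n <ᵇ n) ≡ false
n<ᵇn n = ≮⇒<ᵇ≡ (<-irrefl {n} refl)

n<ᵇ1+n : ∀ n → (n <ᵇ suc n) ≡ true
n<ᵇ1+n n = <⇒<ᵇ≡ (n<1+n n)

min-step : ∀ {ρ μ ν} → ρ ≤ μ → μ ≤ suc ρ → ρ ≤ ν → ν ≤ suc ρ →
  ρ + ⟦ (ρ <ᵇ μ) ∧ (ρ <ᵇ ν) ⟧ ≡ μ ⊓ ν
min-step {ρ} a b c d with 1-step a b | 1-step c d
... | inj₁ refl | inj₁ refl rewrite n<ᵇn ρ = trans (+-identityʳ ρ) (sym (⊓-idem ρ))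
... | inj₁ refl | inj₂ refl rewrite n<ᵇn ρ = trans (+-identityʳ ρ) (sym (m≤n⇒m⊓n≡m (n≤1+n ρ)))
... | inj₂ refl | inj₁ refl rewrite n<ᵇn ρ | n<ᵇ1+n ρ = trans (+-identityʳ ρ) (sym (m≥n⇒m⊓n≡n (n≤1+n ρ)))
... | inj₂ refl | inj₂ refl rewrite n<ᵇ1+n ρ = trans (+-comm ρ 1) (sym (⊓-idem (suc ρ)))

⊔+⊓ : ∀ m n → (m ⊔ n) + (m ⊓ n) ≡ m + n
⊔+⊓ m n with ≤-total m n
... | inj₁ p rewrite m≤n⇒m⊔n≡n p | m≤n⇒m⊓n≡m p = +-comm n m
... | inj₂ p rewrite m≥n⇒m⊔n≡m p | m≥n⇒m⊓n≡n p = refl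

-- λ + ρ + x′ = μ + ν + x for the four corner labels of a cell: summed along a column it says how the
-- crosses of a layer are split between jumps of its labels and crosses of the next layer.
cell-balance : ∀ ρ μ ν M m x x′ s s′ → M + m ≡ μ + ν → ρ + x′ ≡ m → μ + s′ ≡ ρ + s →
  (M + x) + (x′ + s′) ≡ ν + (x + s)
cell-balance ρ μ ν M m x x′ s s′ e₁ e₂ e₃ = +-cancelˡ-≡ (ρ + μ) _ _ (begin
    (ρ + μ) + ((M + x) + (x′ + s′))
  ≡⟨ solve 6 (λ ρ μ M x x′ s′ → (ρ :+ μ) :+ ((M :+ x) :+ (x′ :+ s′)) := ((M :+ (ρ :+ x′)) :+ x) :+ (μ :+ s′)) refl ρ μ M x x′ s′ ⟩
    ((M + (ρ + x′)) + x) + (μ + s′)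
  ≡⟨ cong₂ (λ a b → ((M + a) + x) + b) e₂ e₃ ⟩
    ((M + m) + x) + (ρ + s)
  ≡⟨ cong (λ a → (a + x) + (ρ + s)) e₁ ⟩
    ((μ + ν) + x) + (ρ + s)
  ≡⟨ solve 5 (λ ρ μ ν x s → ((μ :+ ν) :+ x) :+ (ρ :+ s) := (ρ :+ μ) :+ (ν :+ (x :+ s))) refl ρ μ ν x s ⟩
    (ρ + μ) + (ν + (x + s)) ∎)
  where open ≡-Reasoning

module Balance {X : Matrix} (pp : PartialPerm X) where

  step≤1 : ∀ {μ ρ s s′} → μ + s′ ≡ ρ + s → s ≤ 1 → μ ≤ suc ρ
  step≤1 {μ} {ρ} {s} {s′} e p = begin
    μ      ≤⟨ m≤m+n μ s′ ⟩
    μ + s′ ≡⟨ e ⟩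
    ρ + s  ≤⟨ +-monoʳ-≤ ρ p ⟩
    ρ + 1  ≡⟨ +-comm ρ 1 ⟩
    suc ρ  ∎
    where open ≤-Reasoning

  -- The two balances and `cell-min` form one induction over the cells: the balances at the lower
  -- left corner bound both steps by 1, `min-step` then gives `cell-min`, and this carries the
  -- balances across the cell.
  col-balance : ∀ c r → lis X (suc c) r + colsum (next X) c r ≡ lis X c r + colsum X c r
  row-balance : ∀ c r → lis X c (suc r) + rowsum (next X) c r ≡ lis X c r + rowsum X c r
  cell-min : ∀ c r → lis X c r + ⟦ next X c r ⟧ ≡ lis X (suc c) r ⊓ lis X c (suc r)

  cell-min c r = min-step (lis-suc-c X c r) (step≤1 (col-balance c r) (col≤1 pp c r))
                          (lis-suc-r X c r) (step≤1 (row-balance c r) (row≤1 pp c r))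

  col-balance c zero = cong (_+ 0) (sym (lis-zero X c))
  col-balance c (suc r) =
    cell-balance (lis X c r) (lis X (suc c) r) (lis X c (suc r)) _ _ ⟦ X c r ⟧ ⟦ next X c r ⟧ (colsum X c r) (colsum (next X) c r)
      (⊔+⊓ (lis X (suc c) r) (lis X c (suc r))) (cell-min c r) (col-balance c r)

  row-balance zero r = refl
  row-balance (suc c) r =
    cell-balance (lis X c r) (lis X c (suc r)) (lis X (suc c) r) _ _ ⟦ X c r ⟧ ⟦ next X c r ⟧ (rowsum X c r) (rowsum (next X) c r)
      (trans (⊔+⊓ (lis X (suc c) r) (lis X c (suc r))) (+-comm (lis X (suc c) r) (lis X c (suc r))))
                 (cell-min c r) (row-balance c r)

  col-step : ∀ c r → lis X (suc c) r ≤ suc (lis X c r)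
  col-step c r = step≤1 (col-balance c r) (col≤1 pp c r)

  shrinks : ∀ {μ ρ s s′} → ρ ≤ μ → μ + s′ ≡ ρ + s → s′ ≤ s
  shrinks {μ} {ρ} {s} {s′} p e = +-cancelˡ-≤ ρ _ _ (≤-trans (+-monoˡ-≤ s′ p) (≤-reflexive e))

  next-PartialPerm : PartialPerm (next X)
  next-PartialPerm = partialPerm
    (λ c r → ≤-trans (shrinks (lis-suc-c X c r) (col-balance c r)) (col≤1 pp c r))
    (λ c r → ≤-trans (shrinks (lis-suc-r X c r) (row-balance c r)) (row≤1 pp c r))

  flat : ∀ {μ ρ s s′} → μ + s′ ≡ ρ + s → 1 + s ≤ 1 → μ ≤ ρ
  flat {μ} {ρ} {zero} {s′} e p = ≤-trans (m≤m+n μ s′) (≤-reflexive (trans e (+-identityʳ ρ)))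
  flat {s = suc s} e (s≤s ())

  -- The column has at most one cross, so none lies below this one, and the column balance leaves no
  -- room for a jump.
  cross-col : ∀ c r → X c r ≡ true → lis X (suc c) r ≤ lis X c r
  cross-col c r e = flat (col-balance c r) (subst (λ b → ⟦ b ⟧ + colsum X c r ≤ 1) e (col≤1 pp c (suc r)))

  cross-row : ∀ c r → X c r ≡ true → lis X c (suc r) ≤ lis X c r
  cross-row c r e = flat (row-balance c r) (subst (λ b → ⟦ b ⟧ + rowsum X c r ≤ 1) e (row≤1 pp (suc c) r))

  lis-bound : ∀ c r → lis X c r ≤ c
  lis-bound zero r = z≤n
  lis-bound (suc c) r = ≤-trans (col-step c r) (s≤s (lis-bound c r))

open Balance

cross-jump : ∀ {X c r} → X c r ≡ true → suc (lis X c r) ≤ lis X (suc c) (suc r)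
cross-jump {X} {c} {r} e rewrite e =
  ≤-trans (s≤s (≤-trans (lis-suc-r X c r) (m≤n⊔m (lis X (suc c) r) _))) (≤-reflexive (+-comm 1 _))

-- This is what makes the labels partitions. At a cross of `next X` the left side rises by exactly
-- one over its corner value, and by definition of `next` the right side rises as well.
lis-next : ∀ {X} → PartialPerm X → ∀ c r → lis (next X) c r ≤ lis X c r
lis-next pp zero r = z≤n
lis-next pp (suc c) zero = z≤n
lis-next {X} pp (suc c) (suc r) with next X c r in eq
... | false = ≤-trans (≤-reflexive (+-identityʳ _))
                (≤-trans (⊔-mono-≤ (lis-next pp (suc c) r) (lis-next pp c (suc r))) (m≤m+n _ _))
... | true = begin
    (lis (next X) (suc c) r ⊔ lis (next X) c (suc r)) + 1
  ≤⟨ +-monoˡ-≤ 1 (⊔-lub (cross-col (next-PartialPerm pp) c r eq) (cross-row (next-PartialPerm pp) c r eq)) ⟩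
    lis (next X) c r + 1      ≡⟨ +-comm _ 1 ⟩
    suc (lis (next X) c r)    ≤⟨ s≤s (lis-next pp c r) ⟩
    suc (lis X c r)           ≤⟨ next-jump-c X c r eq ⟩
    lis X (suc c) r           ≤⟨ lis-suc-r X (suc c) r ⟩
    lis X (suc c) (suc r)     ∎
  where open ≤-Reasoning

-- Layers of a filling and its labels

layer : ℕ → Matrix → Matrix
layer zero X = X
layer (suc k) X = layer k (next X)

layer-next : ∀ k X → layer (suc k) X ≡ next (layer k X)
layer-next zero X = refl
layer-next (suc k) X = layer-next k (next X)

layer-PartialPerm : ∀ k {X} → PartialPerm X → PartialPerm (layer k X)
layer-PartialPerm zero pp = pp
layer-PartialPerm (suc k) pp = layer-PartialPerm k (next-PartialPerm pp)

-- Fomin's label at (c , r): its k-th row is the longest increasing chain of the k-th layer (a box bumped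
-- from row k is a cross of layer k + 1).
shape : Matrix → ℕ → ℕ → ℕ → ℕ
shape X c r k = lis (layer k X) c r

shape-antitone : ∀ {X} → PartialPerm X → ∀ c r k → shape X c r (suc k) ≤ shape X c r k
shape-antitone {X} pp c r k rewrite layer-next k X = lis-next (layer-PartialPerm k pp) c r

lis-empty : ∀ X k → (∀ c r → c < k → X c r ≡ false) → ∀ c r → c ≤ k → lis X c r ≡ 0
lis-empty X k h zero r p = refl
lis-empty X k h (suc c) zero p = refl
lis-empty X k h (suc c) (suc r) p
  rewrite lis-empty X k h (suc c) r p | lis-empty X k h c (suc r) (<⇒≤ p) | h c r p = refl

-- A cross of `next` needs a cross of the preceding matrix strictly to its left, so each layer
-- empties one more column. Hence labels at column c have at most c rows.
layer-empty : ∀ k X c r → c < k → layer k X c r ≡ false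
layer-empty (suc k) X c r (s≤s p) rewrite layer-next k X
  | lis-empty (layer k X) k (layer-empty k X) c (suc r) p with lis (layer k X) c r <ᵇ lis (layer k X) (suc c) r
... | true = refl
... | false = refl

shape-support : ∀ X c r k → c ≤ k → shape X c r k ≡ 0
shape-support X c r k p = lis-empty (layer k X) k (layer-empty k X) c r p

-- A discrete intermediate value argument: walk right along the bottom edge to its first jump, then
-- up that column until its left side jumps too. Monotonicity of `lis` keeps both strict
-- inequalities alive on the way.
next-in-box : ∀ X {a b a′ b′} → a ≤ a′ → b ≤ b′ → lis X a b < lis X a′ b → lis X a b < lis X a b′ →
  ∃₂ λ c r → a ≤ c × c < a′ × b ≤ r × r < b′ × next X c r ≡ true
next-in-box X {a} {b} {a′} {b′} a≤a′ b≤b′ p q =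
  go (a′ ∸ a) a (m+[n∸m]≡n a≤a′) p q
  where
  column : ∀ h a b → b + h ≡ b′ → lis X a b < lis X (suc a) b → lis X a b < lis X a b′ →
    ∃ λ r → b ≤ r × r < b′ × next X a r ≡ true
  column zero a b e p q = ⊥-elim (<-irrefl (cong (lis X a) (trans (sym (+-identityʳ b)) e)) q)
  column (suc h) a b e p q with lis X a b <? lis X a (suc b)
  ... | yes s = b , ≤-refl , ≤-trans (s≤s (m≤m+n b h)) (≤-reflexive (trans (sym (+-suc b h)) e)) ,
                ∧-intro (<⇒<ᵇ≡ p) (<⇒<ᵇ≡ s)
  ... | no s with column h a (suc b) (trans (sym (+-suc b h)) e)
                 (≤-<-trans (≮⇒≥ s) (<-≤-trans p (lis-suc-r X (suc a) b))) (≤-<-trans (≮⇒≥ s) q)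
  ...   | r , b<r , r<b′ , e′ = r , <⇒≤ b<r , r<b′ , e′
  go : ∀ w a → a + w ≡ a′ → lis X a b < lis X a′ b → lis X a b < lis X a b′ →
    ∃₂ λ c r → a ≤ c × c < a′ × b ≤ r × r < b′ × next X c r ≡ true
  go zero a e p q = ⊥-elim (<-irrefl (cong (λ t → lis X t b) (trans (sym (+-identityʳ a)) e)) p)
  go (suc w) a e p q with lis X a b <? lis X (suc a) b
  ... | yes s with column (b′ ∸ b) a b (m+[n∸m]≡n b≤b′) s q
  ...   | r , x , y , z = a , r , ≤-refl , ≤-trans (s≤s (m≤m+n a w)) (≤-reflexive (trans (sym (+-suc a w)) e)) , x , y , z
  go (suc w) a e p q | no s with go w (suc a) (trans (sym (+-suc a w)) e) (≤-<-trans (≮⇒≥ s) p)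
                              (≤-<-trans (≮⇒≥ s) (<-≤-trans q (lis-suc-c X a b′)))
  ...   | c , r , x , y = c , r , <⇒≤ x , y

jump-cross : ∀ X {c r} → lis X c (suc r) < lis X (suc c) (suc r) → lis X (suc c) r < lis X (suc c) (suc r) →
  X c r ≡ true
jump-cross X {c} {r} p q with X c r
... | true = refl
... | false = ⊥-elim (<-irrefl refl (≤-<-trans (≤-reflexive (+-identityʳ _)) (⊔-pres-<m q p)))

-- The walk goes backwards from the upper right corner: left along the top edge to a jump, then down
-- that column to a jump of its right side, where `jump-cross` applies.
cross-in-box : ∀ X {a b} a′ b′ → a ≤ a′ → b ≤ b′ → lis X a b′ < lis X a′ b′ → lis X a′ b < lis X a′ b′ →
  ∃₂ λ c r → a ≤ c × c < a′ × b ≤ r × r < b′ × X c r ≡ true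
cross-in-box X {a} {b} a′ b′ a≤a′ b≤b′ p q = go a′ a≤a′ p q
  where
  column : ∀ b′ a → b ≤ b′ → lis X a b′ < lis X (suc a) b′ → lis X (suc a) b < lis X (suc a) b′ →
    ∃ λ r → b ≤ r × r < b′ × X a r ≡ true
  column b′ a b≤ p q with m≤n⇒m<n∨m≡n b≤
  ... | inj₂ refl = ⊥-elim (<-irrefl refl q)
  column (suc b′) a b≤ p q | inj₁ (s≤s b≤b′) with lis X (suc a) b′ <? lis X (suc a) (suc b′)
  ... | yes s = b′ , b≤b′ , n<1+n b′ , jump-cross X p s
  ... | no s with column b′ a b≤b′ (<-≤-trans (≤-<-trans (lis-suc-r X a b′) p) (≮⇒≥ s)) (<-≤-trans q (≮⇒≥ s))
  ...   | r , x , y , z = r , x , m≤n⇒m≤1+n y , z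
  go : ∀ a′ → a ≤ a′ → lis X a b′ < lis X a′ b′ → lis X a′ b < lis X a′ b′ →
    ∃₂ λ c r → a ≤ c × c < a′ × b ≤ r × r < b′ × X c r ≡ true
  go a′ a≤ p q with m≤n⇒m<n∨m≡n a≤
  ... | inj₂ refl = ⊥-elim (<-irrefl refl p)
  go (suc a′) a≤ p q | inj₁ (s≤s a≤a′) with lis X a′ b′ <? lis X (suc a′) b′
  ... | yes s with column b′ a′ b≤b′ s q
  ...   | r , x = a′ , r , a≤a′ , n<1+n a′ , x
  go (suc a′) a≤ p q | inj₁ (s≤s a≤a′) | no s
    with go a′ a≤a′ (<-≤-trans p (≮⇒≥ s)) (<-≤-trans (≤-<-trans (lis-suc-c X a′ b) q) (≮⇒≥ s))
  ...   | c , r , x , y , z = c , r , x , m≤n⇒m≤1+n y , z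

-- Monotone chains: first row and first column of the labels

data Direction : Set where
  up down : Direction

flip-direction : Direction → Direction
flip-direction up = down
flip-direction down = up

-- A chain of d crosses in columns below c and rows in [lo, hi), listed from its rightmost cross.
Chain : Direction → Matrix → ℕ → ℕ → ℕ → ℕ → Set
Chain o X c lo hi zero = ⊤
Chain up X c lo hi (suc d) =
  ∃₂ λ c′ r′ → c′ < c × lo ≤ r′ × r′ < hi × X c′ r′ ≡ true × Chain up X c′ lo r′ d
Chain down X c lo hi (suc d) =
  ∃₂ λ c′ r′ → c′ < c × lo ≤ r′ × r′ < hi × X c′ r′ ≡ true × Chain down X c′ (suc r′) hi d

Chain-weaken : ∀ o {X c c′ lo lo′ hi hi′} d → c ≤ c′ → lo′ ≤ lo → hi ≤ hi′ → Chain o X c lo hi d → Chain o X c′ lo′ hi′ d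
Chain-weaken o zero p q s w = tt
Chain-weaken up (suc d) p q s (c , r , i , j , k , e , w) =
  c , r , ≤-trans i p , ≤-trans q j , ≤-trans k s , e , Chain-weaken up d ≤-refl q ≤-refl w
Chain-weaken down (suc d) p q s (c , r , i , j , k , e , w) =
  c , r , ≤-trans i p , ≤-trans q j , ≤-trans k s , e , Chain-weaken down d ≤-refl ≤-refl s w

Chain-shorten : ∀ o {X c lo hi d d′} → d′ ≤ d → Chain o X c lo hi d → Chain o X c lo hi d′
Chain-shorten o z≤n w = tt
Chain-shorten up (s≤s p) (c , r , i , j , k , e , w) = c , r , i , j , k , e , Chain-shorten up p w
Chain-shorten down (s≤s p) (c , r , i , j , k , e , w) = c , r , i , j , k , e , Chain-shorten down p w

up-chain⇒lis : ∀ {X} d {c r} → Chain up X c 0 r d → d ≤ lis X c r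
up-chain⇒lis zero w = z≤n
up-chain⇒lis {X} (suc d) (c , r , i , _ , k , e , w) =
  ≤-trans (s≤s (up-chain⇒lis d w)) (≤-trans (cross-jump {X} e) (lis-mono X i k))

lis⇒up-chain : ∀ {X} → PartialPerm X → ∀ d c r → d ≤ lis X c r → Chain up X c 0 r d
lis⇒up-chain pp zero c r p = tt
lis⇒up-chain {X} pp (suc d) (suc c) (suc r) p with X c r in eq
... | true = c , r , n<1+n c , z≤n , n<1+n r , eq , lis⇒up-chain pp d c r (s≤s⁻¹ (≤-trans p le))
  where
  le : (lis X (suc c) r ⊔ lis X c (suc r)) + 1 ≤ suc (lis X c r)
  le = ≤-trans (+-monoˡ-≤ 1 (⊔-lub (cross-col pp c r eq) (cross-row pp c r eq))) (≤-reflexive (+-comm _ 1))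
... | false with ⊔-sel (lis X (suc c) r) (lis X c (suc r))
...   | inj₁ e = Chain-weaken up (suc d) ≤-refl z≤n (n≤1+n r)
        (lis⇒up-chain pp (suc d) (suc c) r (≤-trans p (≤-reflexive (trans (+-identityʳ _) e))))
...   | inj₂ e = Chain-weaken up (suc d) (n≤1+n c) z≤n ≤-refl
        (lis⇒up-chain pp (suc d) c (suc r) (≤-trans p (≤-reflexive (trans (+-identityʳ _) e))))

-- Two consecutive crosses of a decreasing chain enclose a skeleton cell: in the box right of the
-- upper one and above the lower one, the lower cross makes `lis` jump along the bottom edge and the
-- upper cross along the left edge.
crosses⇒next-chain : ∀ {X} → PartialPerm X → ∀ d {c r R} → X c r ≡ true → Chain down X c (suc r) R d →
  Chain down (next X) (suc c) (suc r) R d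
crosses⇒next-chain pp zero e w = tt
crosses⇒next-chain {X} pp (suc d) {c} {r} e (c′ , r′ , c′<c , r<r′ , r′<R , e′ , w)
  with next-in-box X {suc c′} {suc r} {suc c} {suc r′} (m≤n⇒m≤1+n c′<c) (m≤n⇒m≤1+n r<r′)
         (begin-strict
           lis X (suc c′) (suc r) ≤⟨ lis-mono X c′<c ≤-refl ⟩
           lis X c (suc r)        ≤⟨ cross-row pp c r e ⟩
           lis X c r              <⟨ cross-jump {X} e ⟩
           lis X (suc c) (suc r)  ∎)
         (begin-strict
           lis X (suc c′) (suc r)  ≤⟨ lis-mono X ≤-refl r<r′ ⟩
           lis X (suc c′) r′       ≤⟨ cross-col pp c′ r′ e′ ⟩
           lis X c′ r′             <⟨ cross-jump {X} e′ ⟩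
           lis X (suc c′) (suc r′) ∎)
  where open ≤-Reasoning
... | q , s , c′<q , q<c , r<s , s<r′ , f =
  q , s , q<c , r<s , ≤-trans s<r′ r′<R , f ,
  Chain-weaken down d c′<q s<r′ ≤-refl (crosses⇒next-chain pp d e′ w)

-- Conversely, crosses of X separate consecutive skeleton cells, since `lis` jumps along the top and
-- the right edge of the box between two of them. One more cross lies beyond each end of the
-- skeleton chain: the left one is found here, the right one in `shape⇒down-chain`.
next-chain⇒crosses : ∀ {X} d {c r R} → next X c r ≡ true → r < R → Chain down (next X) c (suc r) R d →
  Chain down X c r R (suc d)
next-chain⇒crosses {X} zero {c} {r} e r<R w
  -- The box is the single row r: the extra cross lies to the left of the leftmost skeleton cell, in
  -- its row.
  with cross-in-box X {0} {r} c (suc r) z≤n (n≤1+n r) (≤-<-trans z≤n (next-jump-r X c r e)) (next-jump-r X c r e)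
... | a , b , _ , a<c , r≤b , b<r , f = a , b , a<c , r≤b , ≤-trans b<r r<R , f , tt
next-chain⇒crosses {X} (suc d) {c} {r} {R} e r<R (c′ , r′ , c′<c , r<r′ , r′<R , e′ , w)
  with cross-in-box X {c′} {r} c r′ (<⇒≤ c′<c) (<⇒≤ r<r′)
         (<-≤-trans (next-jump-c X c′ r′ e′) (lis-mono X c′<c ≤-refl))
         (<-≤-trans (next-jump-r X c r e) (lis-mono X {c} ≤-refl r<r′))
... | a , b , c′≤a , a<c , r≤b , b<r′ , f =
  a , b , a<c , r≤b , <-trans b<r′ r′<R , f ,
  Chain-weaken down (suc d) c′≤a b<r′ ≤-refl (next-chain⇒crosses d e′ r′<R w)

-- Together with `shape⇒down-chain`: the number of nonempty rows of the label is the length of the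
-- longest decreasing chain, as every layer costs exactly one cross.
down-chain⇒shape : ∀ {X} → PartialPerm X → ∀ d {c r} → Chain down X c 0 r (suc d) → 0 < shape X c r d
down-chain⇒shape {X} pp zero (c , r , i , _ , k , e , _) =
  ≤-trans (s≤s z≤n) (≤-trans (cross-jump {X} e) (lis-mono X i k))
down-chain⇒shape pp (suc d) (c , r , i , _ , k , e , w) =
  down-chain⇒shape (next-PartialPerm pp) d (Chain-weaken down (suc d) i z≤n ≤-refl (crosses⇒next-chain pp (suc d) e w))

shape⇒down-chain : ∀ {X} → ∀ d {c r} → 0 < shape X c r d → Chain down X c 0 r (suc d)
shape⇒down-chain {X} zero {c} {r} p
  with cross-in-box X {0} {0} c r z≤n z≤n p (≤-<-trans (≤-reflexive (lis-zero X c)) p)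
... | a , b , _ , a<c , _ , b<r , e = a , b , a<c , z≤n , b<r , e , tt
shape⇒down-chain {X} (suc d) {c} {R} p with shape⇒down-chain {next X} d p
... | q , s , q<c , _ , s<R , e , w
  -- The box is the single column q: the last cross lies below the rightmost skeleton cell.
  with cross-in-box X {q} {0} (suc q) s (n≤1+n q) z≤n (next-jump-c X q s e)
         (≤-<-trans z≤n (next-jump-c X q s e))
... | a , b , q≤a , a<q , _ , b<s , f =
  a , b , ≤-trans a<q q<c , z≤n , <-trans b<s s<R , f ,
  Chain-weaken down (suc d) q≤a b<s ≤-refl (next-chain⇒crosses d e s<R w)

-- Edges of a growth diagram, conjugation and the backward rule

-- g is f with at most one box added; a k tells whether the box lies in row k or beyond.
record Tail (n : ℕ) (f g a : ℕ → ℕ) : Set where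
  field
    jump  : ∀ k → g k + a (suc k) ≡ f k + a k
    grows : ∀ k → f k ≤ g k
    start : a 0 ≤ 1
    end   : a n ≡ 0
open Tail

-- The index t is 1 if a box is added and 0 if f and g agree. For labels of a filling it counts the
-- crosses below a horizontal edge or to the left of a vertical one.
Edge : ℕ → (f g : ℕ → ℕ) → ℕ → Set
Edge n f g t = ∃ λ a → Tail n f g a × a 0 ≡ t

module _ {n : ℕ} {f g a : ℕ → ℕ} (T : Tail n f g a) where

  Tail-decreasing : ∀ k → a (suc k) ≤ a k
  Tail-decreasing k = +-cancelˡ-≤ (f k) _ _ (≤-trans (+-monoˡ-≤ _ (grows T k)) (≤-reflexive (jump T k)))

  Tail≤1 : ∀ k → a k ≤ 1
  Tail≤1 zero = start T
  Tail≤1 (suc k) = ≤-trans (Tail-decreasing k) (Tail≤1 k)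

  Tail-step : ∀ k → g k ≤ suc (f k)
  Tail-step k = begin
    g k             ≤⟨ m≤m+n (g k) _ ⟩
    g k + a (suc k) ≡⟨ jump T k ⟩
    f k + a k       ≤⟨ +-monoʳ-≤ (f k) (Tail≤1 k) ⟩
    f k + 1         ≡⟨ +-comm (f k) 1 ⟩
    suc (f k)       ∎
    where open ≤-Reasoning

  Tail-positive : ∀ k → f k < g k → 0 < a k
  Tail-positive k p = +-cancelˡ-< (f k) _ _ (begin-strict
    f k + 0         ≡⟨ +-identityʳ (f k) ⟩
    f k             <⟨ p ⟩
    g k             ≤⟨ m≤m+n (g k) _ ⟩
    g k + a (suc k) ≡⟨ jump T k ⟩
    f k + a k       ∎)
    where open ≤-Reasoning

  Tail-flat : ∀ k → 0 < a (suc k) → g k ≡ f k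
  Tail-flat k p = +-cancelʳ-≡ (a (suc k)) _ _ (trans (jump T k) (cong (f k +_) (≤-antisym (≤-trans (Tail≤1 k) p) (Tail-decreasing k))))

record Box (n : ℕ) (f g : ℕ → ℕ) : Set where
  constructor box
  field
    row   : ℕ
    row<n : row < n
    adds  : g row ≡ suc (f row)
    else  : ∀ k → k ≢ row → g k ≡ f k

Tail-zero : ∀ {n f g a} → Tail n f g a → a 0 ≡ 0 → ∀ k → a k ≡ 0
Tail-zero T e zero = e
Tail-zero T e (suc k) = n≤0⇒n≡0 (≤-trans (Tail-decreasing T k) (≤-reflexive (Tail-zero T e k)))

Tail-same : ∀ {n f g a} → Tail n f g a → a 0 ≡ 0 → ∀ k → g k ≡ f k
Tail-same {f = f} {g} {a} T e k = begin
  g k             ≡⟨ +-identityʳ (g k) ⟨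
  g k + 0         ≡⟨ cong (g k +_) (Tail-zero T e (suc k)) ⟨
  g k + a (suc k) ≡⟨ jump T k ⟩
  f k + a k       ≡⟨ cong (f k +_) (Tail-zero T e k) ⟩
  f k + 0         ≡⟨ +-identityʳ (f k) ⟩
  f k             ∎
  where open ≡-Reasoning

Tail-box : ∀ {n f g a} → Tail n f g a → a 0 ≡ 1 → Box n f g
Tail-box {zero} T e with () ← trans (sym e) (end T)
Tail-box {suc n} {f} {g} {a} T e with a 1 in e₁
... | zero = box 0 (s≤s z≤n)
      (trans (sym (+-identityʳ _)) (trans (subst₂ (λ s t → g 0 + s ≡ f 0 + t) e₁ e (jump T 0)) (+-comm (f 0) 1)))
      λ { zero ne → ⊥-elim (ne refl) ; (suc k) _ → Tail-same T′ e₁ k }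
  where
  T′ : Tail n (f ∘ suc) (g ∘ suc) (a ∘ suc)
  T′ = record { jump = jump T ∘ suc ; grows = grows T ∘ suc ; start = Tail≤1 T 1 ; end = end T }
... | suc m with Tail-box {n} {f ∘ suc} {g ∘ suc} {a ∘ suc}
                   (record { jump = jump T ∘ suc ; grows = grows T ∘ suc ; start = Tail≤1 T 1 ; end = end T })
                   (≤-antisym (Tail≤1 T 1) (subst (1 ≤_) (sym e₁) (s≤s z≤n)))
...   | box i i<n x y = box (suc i) (s≤s i<n) x
        λ { zero _ → Tail-flat T 0 (subst (0 <_) (sym e₁) (s≤s z≤n)) ; (suc k) ne → y k (ne ∘ cong suc) }

-- Conjugate partitions

count : ℕ → (ℕ → Bool) → ℕ
count zero P = 0
count (suc n) P = ⟦ P n ⟧ + count n P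

count-cong-below : ∀ n {P Q} → (∀ k → k < n → P k ≡ Q k) → count n P ≡ count n Q
count-cong-below zero h = refl
count-cong-below (suc n) h =
  cong₂ (λ b m → ⟦ b ⟧ + m) (h n ≤-refl) (count-cong-below n (λ k p → h k (m≤n⇒m≤1+n p)))

count-cong : ∀ n {P Q} → (∀ k → P k ≡ Q k) → count n P ≡ count n Q
count-cong n h = count-cong-below n (λ k _ → h k)

count-mono : ∀ n {P Q} → (∀ k → P k ≡ true → Q k ≡ true) → count n P ≤ count n Q
count-mono zero h = z≤n
count-mono (suc n) {P} {Q} h with P n in eq
... | true rewrite h n eq = s≤s (count-mono n h)
... | false = ≤-trans (count-mono n h) (m≤n+m _ ⟦ Q n ⟧)

count≤ : ∀ n P → count n P ≤ n
count≤ zero P = z≤n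
count≤ (suc n) P = +-mono-≤ (⟦⟧≤1 (P n)) (count≤ n P)

count-change : ∀ n {P Q} i → i < n → (∀ k → k ≢ i → P k ≡ Q k) → count n P + ⟦ Q i ⟧ ≡ count n Q + ⟦ P i ⟧
count-change (suc n) {P} {Q} i p h with m≤n⇒m<n∨m≡n (s≤s⁻¹ p)
... | inj₁ i<n rewrite h n (λ e → <-irrefl (sym e) i<n) =
  trans (+-assoc ⟦ Q n ⟧ _ _) (trans (cong (⟦ Q n ⟧ +_) (count-change n i i<n h)) (sym (+-assoc ⟦ Q n ⟧ _ _)))
... | inj₂ refl rewrite count-cong-below n {P} {Q} (λ k q → h k (λ e → <-irrefl e q)) =
  solve 3 (λ a b c → (a :+ b) :+ c := (c :+ b) :+ a) refl ⟦ P n ⟧ (count n Q) ⟦ Q n ⟧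

count-prefix : ∀ n {P} → (∀ k → P (suc k) ≡ true → P k ≡ true) → ∀ k → k < n → (k <ᵇ count n P) ≡ P k
count-prefix (suc n) {P} h k p with P n in eq
... | true = trans (<⇒<ᵇ≡ (subst (k <_) (cong suc (sym (full n (λ j q → earlier n j eq (<⇒≤ q))))) p)) (sym (earlier n k eq (s≤s⁻¹ p)))
  where
  full : ∀ m → (∀ j → j < m → P j ≡ true) → count m P ≡ m
  full zero g = refl
  full (suc m) g rewrite g m ≤-refl = cong suc (full m (λ j q → g j (m≤n⇒m≤1+n q)))
  earlier : ∀ m j → P m ≡ true → j ≤ m → P j ≡ true
  earlier m j e q with m≤n⇒m<n∨m≡n q
  ... | inj₂ refl = e
  earlier (suc m) j e q | inj₁ (s≤s j≤m) = earlier m j (h m e) j≤m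
... | false with m≤n⇒m<n∨m≡n (s≤s⁻¹ p)
...   | inj₁ k<n = count-prefix n h k k<n
...   | inj₂ refl = trans (≮⇒<ᵇ≡ (≤⇒≯ (count≤ n P))) (sym eq)

count-below : ∀ n m → m ≤ n → count n (_<ᵇ m) ≡ m
count-below zero zero p = refl
count-below (suc n) m p with n <ᵇ m in eq
... | true = ≤-antisym (≤-trans (s≤s (count≤ n _)) (<ᵇ≡⇒< eq)) (≤-trans p (s≤s (≤-reflexive (sym full))))
  where
  full : count n (_<ᵇ m) ≡ n
  full = go n (<⇒≤ (<ᵇ≡⇒< eq))
    where
    go : ∀ t → t ≤ m → count t (_<ᵇ m) ≡ t
    go zero q = refl
    go (suc t) q rewrite <⇒<ᵇ≡ q = cong suc (go t (<⇒≤ q))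
... | false = count-below n m (≮⇒≥ (<ᵇ≡⇒≮ eq))

conjugate : ℕ → (ℕ → ℕ) → ℕ → ℕ
conjugate n f j = count n (λ k → j <ᵇ f k)

conjugate-cong : ∀ n {f g} → (∀ k → f k ≡ g k) → ∀ j → conjugate n f j ≡ conjugate n g j
conjugate-cong n h j = count-cong n (λ k → cong (j <ᵇ_) (h k))

conjugate-antitone : ∀ n f j → conjugate n f (suc j) ≤ conjugate n f j
conjugate-antitone n f j = count-mono n (λ k e → <⇒<ᵇ≡ (<⇒≤ (<ᵇ≡⇒< {suc j} {f k} e)))

conjugate-zero : ∀ n {f} → (∀ k → f k ≡ 0) → ∀ j → conjugate n f j ≡ 0
conjugate-zero zero h j = refl
conjugate-zero (suc n) h j rewrite h n = conjugate-zero n h j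

antitone : (f : ℕ → ℕ) → (∀ k → f (suc k) ≤ f k) → ∀ {i j} → i ≤ j → f j ≤ f i
antitone f h {i} {zero} z≤n = ≤-refl
antitone f h {i} {suc j} p with m≤n⇒m<n∨m≡n p
... | inj₂ refl = ≤-refl
... | inj₁ (s≤s q) = ≤-trans (h j) (antitone f h q)

-- The rows longer than j form an initial segment, and the conjugate gives its length. From row n on
-- both sides are false, since f has at most n rows.
conjugate-dual : ∀ n f → (∀ k → f (suc k) ≤ f k) → f n ≡ 0 → ∀ j k → (k <ᵇ conjugate n f j) ≡ (j <ᵇ f k)
conjugate-dual n f h z j k with k <? n
... | yes p = count-prefix n (λ i e → <⇒<ᵇ≡ (<-≤-trans (<ᵇ≡⇒< e) (h i))) k p
... | no p = trans (≮⇒<ᵇ≡ (≤⇒≯ (≤-trans (count≤ n _) (≮⇒≥ p))))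
                   (sym (≮⇒<ᵇ≡ (λ q → <⇒≢ (<-≤-trans (≤-<-trans z≤n q) (antitone f h (≮⇒≥ p))) (sym z))))

conjugate-involutive : ∀ n f → (∀ k → f (suc k) ≤ f k) → f n ≡ 0 → (∀ k → f k ≤ n) →
  ∀ j → conjugate n (conjugate n f) j ≡ f j
conjugate-involutive n f h z b j =
  trans (count-cong n (λ k → conjugate-dual n f h z k j)) (count-below n (f j) (b j))

conjugate-edge : ∀ {n f g t} → Edge n f g t → (∀ k → g k ≤ n) → Edge n (conjugate n f) (conjugate n g) t
conjugate-edge {n} {f} {g} (a , T , refl) b with 1-step z≤n (start T)
... | inj₁ e = (λ _ → 0) , record
  { jump = λ k → cong (_+ 0) (same k) ; grows = λ k → ≤-reflexive (sym (same k)) ; start = z≤n ; end = refl } , sym e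
  where
  same = conjugate-cong n (Tail-same T e)
... | inj₂ e with Tail-box T e
-- The box added in row i lies in column f i, so in the conjugate it lies in row j or beyond exactly
-- when j < g i.
...   | box i i<n x y = (λ j → ⟦ j <ᵇ g i ⟧) , record
  { jump = λ j → trans (cong (λ t → conjugate n g j + ⟦ suc j <ᵇ t ⟧) x)
                       (count-change n i i<n (λ k ne → cong (j <ᵇ_) (y k ne)))
  ; grows = λ j → count-mono n (λ k p → <⇒<ᵇ≡ (<-≤-trans (<ᵇ≡⇒< p) (grows T k)))
  ; start = ⟦⟧≤1 (0 <ᵇ g i)
  ; end = cong ⟦_⟧ (≮⇒<ᵇ≡ (≤⇒≯ (b i))) } ,
  trans (cong (λ t → ⟦ 0 <ᵇ t ⟧) x) (sym e)

-- Edges between the labels of a filling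

colsum-empty : ∀ X c → (∀ r → X c r ≡ false) → ∀ r → colsum X c r ≡ 0
colsum-empty X c h zero = refl
colsum-empty X c h (suc r) rewrite h r = colsum-empty X c h r

rowsum-empty : ∀ X r c → (∀ c′ → c′ < c → X c′ r ≡ false) → rowsum X c r ≡ 0
rowsum-empty X r zero h = refl
rowsum-empty X r (suc c) h rewrite h c ≤-refl = rowsum-empty X r c (λ c′ q → h c′ (m≤n⇒m≤1+n q))

-- A box bumped as far as row k is a cross of layer k in this column. So the column sums of the
-- layers are the tail, and the law `jump` is the column balance.
shape-col-edge : ∀ {X} → PartialPerm X → ∀ n c r → c < n → Edge n (shape X c r) (shape X (suc c) r) (colsum X c r)
shape-col-edge {X} pp n c r c<n = (λ k → colsum (layer k X) c r) , record
  { jump = λ k → subst (λ Y → lis (layer k X) (suc c) r + colsum Y c r ≡ lis (layer k X) c r + colsum (layer k X) c r)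
             (sym (layer-next k X)) (col-balance (layer-PartialPerm k pp) c r)
  ; grows = λ k → lis-suc-c (layer k X) c r
  ; start = col≤1 pp c r
  ; end = colsum-empty (layer n X) c (λ r → layer-empty n X c r c<n) r } , refl

shape-row-edge : ∀ {X} → PartialPerm X → ∀ n c r → c ≤ n → Edge n (shape X c r) (shape X c (suc r)) (rowsum X c r)
shape-row-edge {X} pp n c r c≤n = (λ k → rowsum (layer k X) c r) , record
  { jump = λ k → subst (λ Y → lis (layer k X) c (suc r) + rowsum Y c r ≡ lis (layer k X) c r + rowsum (layer k X) c r)
             (sym (layer-next k X)) (row-balance (layer-PartialPerm k pp) c r)
  ; grows = λ k → lis-suc-r (layer k X) c r
  ; start = row≤1 pp c r
  ; end = rowsum-empty (layer n X) r c (λ c′ q → layer-empty n X c′ r (<-≤-trans q c≤n)) } , refl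

-- Fomin's rule read backwards. A box of λ′ in row k that neither neighbour has comes from a cross
-- of the cell if k = 0; otherwise it was bumped out of row k - 1, and `back` removes the box of
-- that row which both neighbours share.
peak : (μ ν λ′ : ℕ → ℕ) → ℕ → Bool
peak μ ν λ′ k = (μ k ⊔ ν k) <ᵇ λ′ k

back : (μ ν λ′ : ℕ → ℕ) → ℕ → ℕ
back μ ν λ′ k = (μ k ⊓ ν k) ∸ ⟦ peak μ ν λ′ (suc k) ⟧

cell-balance⁻¹ : ∀ ρ μ ν M m L A A′ a a′ y y′ → M + y ≡ L → M + m ≡ μ + ν → ρ + y′ ≡ m →
  A + y ≡ a → A′ + y′ ≡ a′ → L + a′ ≡ ν + a → μ + A′ ≡ ρ + A
cell-balance⁻¹ ρ μ ν M _ _ A A′ _ _ y y′ refl e₁ refl refl refl e₂ = +-cancelˡ-≡ (ν + y) _ _ (begin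
    (ν + y) + (μ + A′)
  ≡⟨ solve 4 (λ ν y μ A′ → (ν :+ y) :+ (μ :+ A′) := (μ :+ ν) :+ (y :+ A′)) refl ν y μ A′ ⟩
    (μ + ν) + (y + A′)
  ≡⟨ cong (_+ (y + A′)) e₁ ⟨
    (M + (ρ + y′)) + (y + A′)
  ≡⟨ solve 5 (λ M ρ y′ y A′ → (M :+ (ρ :+ y′)) :+ (y :+ A′) := ρ :+ ((M :+ y) :+ (A′ :+ y′))) refl M ρ y′ y A′ ⟩
    ρ + ((M + y) + (A′ + y′))
  ≡⟨ cong (ρ +_) e₂ ⟩
    ρ + (ν + (A + y))
  ≡⟨ solve 4 (λ ρ ν A y → ρ :+ (ν :+ (A :+ y)) := (ν :+ y) :+ (ρ :+ A)) refl ρ ν A y ⟩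
    (ν + y) + (ρ + A) ∎)
  where open ≡-Reasoning

module Backward {n : ℕ} {μ ν λ′ : ℕ → ℕ} (λ-antitone : ∀ k → λ′ (suc k) ≤ λ′ k)
  {s t : ℕ} (top : Edge n ν λ′ s) (right : Edge n μ λ′ t) where

  private
    a = proj₁ top
    b = proj₁ right
    Tᵃ = proj₁ (proj₂ top)
    Tᵇ = proj₁ (proj₂ right)
    y = peak μ ν λ′
    ρ = back μ ν λ′

  λ-max : ∀ k → (μ k ⊔ ν k) + ⟦ y k ⟧ ≡ λ′ k
  λ-max k with y k in eq
  ... | true = trans (+-comm _ 1) (≤-antisym (<ᵇ≡⇒< eq) (≤-trans (Tail-step Tᵃ k) (s≤s (m≤n⊔m (μ k) (ν k)))))
  ... | false = trans (+-identityʳ _) (≤-antisym (⊔-lub (grows Tᵇ k) (grows Tᵃ k)) (≮⇒≥ (<ᵇ≡⇒≮ eq)))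

  y≤a : ∀ k → ⟦ y k ⟧ ≤ a k
  y≤a k with y k in eq
  ... | true = Tail-positive Tᵃ k (≤-<-trans (m≤n⊔m (μ k) (ν k)) (<ᵇ≡⇒< eq))
  ... | false = z≤n

  y≤b : ∀ k → ⟦ y k ⟧ ≤ b k
  y≤b k with y k in eq
  ... | true = Tail-positive Tᵇ k (≤-<-trans (m≤m⊔n (μ k) (ν k)) (<ᵇ≡⇒< eq))
  ... | false = z≤n

  -- At a peak in row k + 1 both edges add their box in that row or beyond, so both leave row k as
  -- it is.
  peak⇒min : ∀ k → y (suc k) ≡ true → μ k ⊓ ν k ≡ λ′ k
  peak⇒min k e = trans (cong₂ _⊓_ (sym (Tail-flat Tᵇ k (subst (λ z → ⟦ z ⟧ ≤ b (suc k)) e (y≤b (suc k)))))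
                                  (sym (Tail-flat Tᵃ k (subst (λ z → ⟦ z ⟧ ≤ a (suc k)) e (y≤a (suc k))))))
                       (⊓-idem (λ′ k))

  ρ-min : ∀ k → ρ k + ⟦ y (suc k) ⟧ ≡ μ k ⊓ ν k
  ρ-min k = m∸n+n≡m (go (y (suc k)) refl)
    where
    go : ∀ z → y (suc k) ≡ z → ⟦ z ⟧ ≤ μ k ⊓ ν k
    -- λ′ is a partition with a box in row k + 1, so row k is nonempty and the truncated subtraction
    -- in `back` is exact.
    go true e = subst (1 ≤_) (sym (peak⇒min k e)) (≤-trans (≤-<-trans z≤n (<ᵇ≡⇒< e)) (λ-antitone k))
    go false e = z≤n

  -- Passing the cell from top to bottom takes the peaks out of the tail. In row 0 the peak is the
  -- cross of the new filling, so s′ is s without the cross of this cell.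
  bottom-edge : ∃ λ s′ → Edge n ρ μ s′ × s′ + ⟦ y 0 ⟧ ≡ s
  bottom-edge = a 0 ∸ ⟦ y 0 ⟧ , ((λ k → a k ∸ ⟦ y k ⟧) , record
    { jump = λ k → cell-balance⁻¹ (ρ k) (μ k) (ν k) (μ k ⊔ ν k) _ (λ′ k) _ _ (a k) _ ⟦ y k ⟧ ⟦ y (suc k) ⟧
               (λ-max k) (⊔+⊓ (μ k) (ν k)) (ρ-min k) (m∸n+n≡m (y≤a k)) (m∸n+n≡m (y≤a (suc k))) (jump Tᵃ k)
    ; grows = λ k → ≤-trans (m∸n≤m (μ k ⊓ ν k) ⟦ y (suc k) ⟧) (m⊓n≤m (μ k) (ν k))
    ; start = ≤-trans (m∸n≤m (a 0) ⟦ y 0 ⟧) (start Tᵃ)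
    ; end = n≤0⇒n≡0 (≤-trans (m∸n≤m (a n) ⟦ y n ⟧) (≤-reflexive (end Tᵃ))) } , refl) ,
    trans (m∸n+n≡m (y≤a 0)) (proj₂ (proj₂ top))

  left-edge : ∃ λ t′ → Edge n ρ ν t′ × t′ + ⟦ y 0 ⟧ ≡ t
  left-edge = b 0 ∸ ⟦ y 0 ⟧ , ((λ k → b k ∸ ⟦ y k ⟧) , record
    { jump = λ k → cell-balance⁻¹ (ρ k) (ν k) (μ k) (μ k ⊔ ν k) _ (λ′ k) _ _ (b k) _ ⟦ y k ⟧ ⟦ y (suc k) ⟧
               (λ-max k) (trans (⊔+⊓ (μ k) (ν k)) (+-comm (μ k) (ν k))) (ρ-min k) (m∸n+n≡m (y≤b k)) (m∸n+n≡m (y≤b (suc k))) (jump Tᵇ k)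
    ; grows = λ k → ≤-trans (m∸n≤m (μ k ⊓ ν k) ⟦ y (suc k) ⟧) (m⊓n≤n (μ k) (ν k))
    ; start = ≤-trans (m∸n≤m (b 0) ⟦ y 0 ⟧) (start Tᵇ)
    ; end = n≤0⇒n≡0 (≤-trans (m∸n≤m (b n) ⟦ y n ⟧) (≤-reflexive (end Tᵇ))) } , refl) ,
    trans (m∸n+n≡m (y≤b 0)) (proj₂ (proj₂ right))

  back-antitone : (∀ k → μ (suc k) ≤ μ k) → (∀ k → ν (suc k) ≤ ν k) → ∀ k → ρ (suc k) ≤ ρ k
  back-antitone μ↓ ν↓ k with y (suc k) in eq
  ... | false = ≤-trans (m∸n≤m (μ (suc k) ⊓ ν (suc k)) ⟦ y (suc (suc k)) ⟧) (⊓-mono-≤ (μ↓ k) (ν↓ k))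
  ... | true rewrite peak⇒min k eq = ≤-trans (m∸n≤m (μ (suc k) ⊓ ν (suc k)) ⟦ y (suc (suc k)) ⟧)
     (∸-monoˡ-≤ 1 (≤-trans (s≤s (≤-trans (m⊓n≤m (μ (suc k)) _) (m≤m⊔n (μ (suc k)) (ν (suc k))))) (≤-trans (<ᵇ≡⇒< eq) (λ-antitone k))))

  -- The right side is the definition of `next` read on row k of the labels. This is how the peaks
  -- in row k + 1 turn out to be the crosses of layer k + 1 of the new filling.
  peak-suc : ∀ k → y (suc k) ≡ (ρ k <ᵇ μ k) ∧ (ρ k <ᵇ ν k)
  peak-suc k with y (suc k) | ρ-min k
  ... | true | e = sym (∧-intro (<⇒<ᵇ≡ (≤-trans le (m⊓n≤m (μ k) (ν k)))) (<⇒<ᵇ≡ (≤-trans le (m⊓n≤n (μ k) (ν k)))))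
    where
    le : suc (μ k ⊓ ν k ∸ 1) ≤ μ k ⊓ ν k
    le = ≤-reflexive (trans (+-comm 1 _) e)
  ... | false | _ with ⊓-sel (μ k) (ν k)
  ...   | inj₁ e rewrite e | n<ᵇn (μ k) = refl
  ...   | inj₂ e rewrite e | n<ᵇn (ν k) with ν k <ᵇ μ k
  ...     | true = refl
  ...     | false = refl

-- The involution on the fillings of a Ferrers shape

record Region (n N : ℕ) (G : ℕ → ℕ → Bool) : Set where
  field
    bound-c : ∀ c r → G c r ≡ true → c ≤ n
    bound-r : ∀ c r → G c r ≡ true → r ≤ N
    left    : ∀ c r → G (suc c) r ≡ true → G c r ≡ true
    below   : ∀ c r → G c (suc r) ≡ true → G c r ≡ true

  not-right : ∀ c r → G c r ≡ false → G (suc c) r ≡ false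
  not-right c r e with G (suc c) r in eq
  ... | false = refl
  ... | true = trans (sym (left c r eq)) e

  not-above : ∀ c r → G c r ≡ false → G c (suc r) ≡ false
  not-above c r e with G c (suc r) in eq
  ... | false = refl
  ... | true = trans (sym (below c r eq)) e

  not-above* : ∀ {c r r′} → r ≤ r′ → G c r ≡ false → G c r′ ≡ false
  not-above* {c} {r} {r′} p e with m≤n⇒m<n∨m≡n p
  ... | inj₂ refl = e
  not-above* {c} {r} {suc r′} p e | inj₁ (s≤s q) = not-above c r′ (not-above* q e)

  not-right* : ∀ {c c′ r} → c ≤ c′ → G c r ≡ false → G c′ r ≡ false
  not-right* {c} {c′} {r} p e with m≤n⇒m<n∨m≡n p
  ... | inj₂ refl = e
  not-right* {c} {suc c′} {r} p e | inj₁ (s≤s q) = not-right c′ r (not-right* q e)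

  -- Induction in the direction of backward growth, from the boundary vertices (those with no cell
  -- of the shape at their upper right) towards the axes. The distances of c to n and of r to N
  -- decrease lexicographically.
  region-induction : ∀ {ℓ} (P : ℕ → ℕ → Set ℓ) →
    (∀ c r → G c r ≡ true → G (suc c) (suc r) ≡ false → P c r) →
    (∀ c r → G (suc c) (suc r) ≡ true → P (suc c) r → P c (suc r) → P (suc c) (suc r) → P c r) →
    ∀ c r → G c r ≡ true → P c r
  region-induction P base step c r = go (n ∸ c) c r ≤-refl
    where
    go : ∀ k c r → n ∸ c ≤ k → G c r ≡ true → P c r
    inner : ∀ k j c r → n ∸ c ≤ k → N ∸ r ≤ j → G c r ≡ true → P c r
    go k c r p g = inner k (N ∸ r) c r p ≤-refl g
    inner k j c r p q g with G (suc c) (suc r) in eq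
    ... | false = base c r g eq
    inner zero j c r p q g | true = ⊥-elim (<⇒≱ (bound-c _ _ eq) (m∸n≡0⇒m≤n (n≤0⇒n≡0 p)))
    inner (suc k) zero c r p q g | true = ⊥-elim (<⇒≱ (bound-r _ _ eq) (m∸n≡0⇒m≤n (n≤0⇒n≡0 q)))
    inner (suc k) (suc j) c r p q g | true =
      step c r eq (go k (suc c) r p′ (below _ _ eq)) (inner (suc k) j c (suc r) p q′ (left _ _ eq)) (go k (suc c) (suc r) p′ eq)
      where
      p′ : n ∸ suc c ≤ k
      p′ = s≤s⁻¹ (subst (_≤ suc k) (+-∸-assoc 1 (bound-c _ _ eq)) p)
      q′ : N ∸ suc r ≤ j
      q′ = s≤s⁻¹ (subst (_≤ suc j) (+-∸-assoc 1 (bound-r _ _ eq)) q)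

∸≡suc : ∀ n c u → n ∸ c ≡ suc u → n ∸ u ≡ suc c
∸≡suc n zero u refl = trans (+-∸-assoc 1 {u} ≤-refl) (cong suc (n∸n≡0 u))
∸≡suc (suc n) (suc c) u x =
  trans (+-∸-assoc 1 (≤-trans (n≤1+n u) (≤-trans (≤-reflexive (sym x)) (m∸n≤m n c)))) (cong suc (∸≡suc n c u x))

module _ (n N : ℕ) (G : ℕ → ℕ → Bool) (B : ℕ → ℕ → ℕ → ℕ) where

  -- Backward growth calls itself at larger columns and rows. The arguments are therefore the
  -- distances to n and N, which makes the recursion structural.
  labels-from : ℕ → ℕ → ℕ → ℕ
  labels-from zero v = B n (N ∸ v)
  labels-from (suc u) zero = B (n ∸ suc u) N
  labels-from (suc u) (suc v) =
    if G (n ∸ u) (N ∸ v)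
    then back (labels-from u (suc v)) (labels-from (suc u) v) (labels-from u v)
    else B (n ∸ suc u) (N ∸ suc v)

  labels : ℕ → ℕ → ℕ → ℕ
  labels c r = labels-from (n ∸ c) (N ∸ r)

  labels-outer : ∀ c r → c ≤ n → r ≤ N → G (suc c) (suc r) ≡ false → labels c r ≡ B c r
  labels-outer c r p q e = trans (go (n ∸ c) (N ∸ r) refl refl) (cong₂ B (m∸[m∸n]≡n p) (m∸[m∸n]≡n q))
    where
    go : ∀ u v → n ∸ c ≡ u → N ∸ r ≡ v → labels-from u v ≡ B (n ∸ u) (N ∸ v)
    go zero v _ _ = refl
    go (suc u) zero _ _ = refl
    go (suc u) (suc v) x y rewrite ∸≡suc n c u x | ∸≡suc N r v y | e = refl

  labels-inner : ∀ c r → c < n → r < N → G (suc c) (suc r) ≡ true →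
    labels c r ≡ back (labels (suc c) r) (labels c (suc r)) (labels (suc c) (suc r))
  labels-inner c r p q e with n ∸ c | +-∸-assoc 1 p | N ∸ r | +-∸-assoc 1 q
  ... | _ | refl | _ | refl rewrite m∸[m∸n]≡n p | m∸[m∸n]≡n q | e = refl

module _ (n N : ℕ) (G : ℕ → ℕ → Bool) (X : Matrix) where

  conjugate-labels : ℕ → ℕ → ℕ → ℕ
  conjugate-labels = labels n N G (λ c r → conjugate n (shape X c r))

  transpose : Matrix
  transpose c r =
    if G (suc c) (suc r)
    then peak (conjugate-labels (suc c) r) (conjugate-labels c (suc r)) (conjugate-labels (suc c) (suc r)) 0
    else X c r

colsum-agree : ∀ {X Y c r} → (∀ r′ → r ≤ r′ → Y c r′ ≡ X c r′) → ∀ {M} → r ≤ M →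
  colsum X c r + colsum Y c M ≡ colsum X c M + colsum Y c r
colsum-agree {X} {Y} {c} {r} h {M} p with m≤n⇒m<n∨m≡n p
... | inj₂ refl = refl
colsum-agree {X} {Y} {c} {r} h {suc M} p | inj₁ (s≤s q) rewrite h M q = begin
    colsum X c r + (⟦ X c M ⟧ + colsum Y c M)
  ≡⟨ solve 3 (λ a b d → a :+ (b :+ d) := b :+ (a :+ d)) refl (colsum X c r) ⟦ X c M ⟧ (colsum Y c M) ⟩
    ⟦ X c M ⟧ + (colsum X c r + colsum Y c M)
  ≡⟨ cong (⟦ X c M ⟧ +_) (colsum-agree h q) ⟩
    ⟦ X c M ⟧ + (colsum X c M + colsum Y c r)
  ≡⟨ +-assoc ⟦ X c M ⟧ _ _ ⟨
    (⟦ X c M ⟧ + colsum X c M) + colsum Y c r ∎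
  where open ≡-Reasoning

rowsum-colsum : ∀ X c r → rowsum X c r ≡ colsum (λ r c → X c r) r c
rowsum-colsum X zero r = refl
rowsum-colsum X (suc c) r = cong (⟦ X c r ⟧ +_) (rowsum-colsum X c r)

rowsum-agree : ∀ {X Y c r} → (∀ c′ → c ≤ c′ → Y c′ r ≡ X c′ r) → ∀ {M} → c ≤ M →
  rowsum X c r + rowsum Y M r ≡ rowsum X M r + rowsum Y c r
rowsum-agree {X} {Y} {c} {r} h {M} p
  rewrite rowsum-colsum X c r | rowsum-colsum Y M r | rowsum-colsum X M r | rowsum-colsum Y c r =
  colsum-agree {λ r c → X c r} {λ r c → Y c r} h p

Edge-zero : ∀ {n f g t} → Edge n f g t → (∀ k → f k ≡ 0) → (∀ k → g k ≡ 0) → t ≡ 0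
Edge-zero {n} {f} {g} (a , T , refl) hf hg = trans (sym (const n)) (end T)
  where
  const : ∀ k → a k ≡ a 0
  const zero = refl
  const (suc k) = trans (subst₂ (λ x y → x + a (suc k) ≡ y + a k) (hg k) (hf k) (jump T k)) (const k)

cancel-cross : ∀ {s′ y s u v w} → s′ + y ≡ s → s + u ≡ v + (y + w) → s′ + u ≡ v + w
cancel-cross {s′} {y} {_} {u} {v} {w} refl e = +-cancelˡ-≡ y _ _ (begin
  y + (s′ + u)   ≡⟨ solve 3 (λ y s u → y :+ (s :+ u) := (s :+ y) :+ u) refl y s′ u ⟩
  (s′ + y) + u   ≡⟨ e ⟩
  v + (y + w)    ≡⟨ solve 3 (λ y v w → v :+ (y :+ w) := y :+ (v :+ w)) refl y v w ⟩
  y + (v + w)    ∎)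
  where open ≡-Reasoning

-- Y is only required to equal the transposed filling pointwise, so that the module also applies to
-- the matrix of the switched word.
module Transpose {n N : ℕ} {G : ℕ → ℕ → Bool} (R : Region n N G) {X : Matrix} (pp : PartialPerm X)
  {Y : Matrix} (Y≗ : ∀ c r → Y c r ≡ transpose n N G X c r) where
  open Region R

  private
    L : ℕ → ℕ → ℕ → ℕ
    L = conjugate-labels n N G X

  Y-outside : ∀ c r → G (suc c) (suc r) ≡ false → Y c r ≡ X c r
  Y-outside c r e = trans (Y≗ c r) (cong (λ b → if b then peak (L (suc c) r) (L c (suc r)) (L (suc c) (suc r)) 0 else X c r) e)

  Y-inside : ∀ c r → G (suc c) (suc r) ≡ true → Y c r ≡ peak (L (suc c) r) (L c (suc r)) (L (suc c) (suc r)) 0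
  Y-inside c r e = trans (Y≗ c r) (cong (λ b → if b then peak (L (suc c) r) (L c (suc r)) (L (suc c) (suc r)) 0 else X c r) e)

  L-outer : ∀ c r → G c r ≡ true → G (suc c) (suc r) ≡ false → L c r ≡ conjugate n (shape X c r)
  L-outer c r g e = labels-outer n N G _ c r (bound-c _ _ g) (bound-r _ _ g) e

  L-inner : ∀ c r → G (suc c) (suc r) ≡ true → L c r ≡ back (L (suc c) r) (L c (suc r)) (L (suc c) (suc r))
  L-inner c r e = labels-inner n N G _ c r (bound-c _ _ e) (bound-r _ _ e) e

  shape≤ : ∀ c r k → c ≤ n → shape X c r k ≤ n
  shape≤ c r k p = ≤-trans (lis-bound (layer-PartialPerm k pp) c r) p

  -- Free of subtraction, `L-col` says that t is `colsum Y c r` up to the difference of the total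
  -- column sums of X and Y. It holds on the boundary, where t is `colsum X c r` and the two
  -- fillings agree higher up, and each cell passed on the way down is removed from both sides. At r
  -- = 0 the labels are empty, so t = 0 and the totals agree. `L-row` does the same for rows.
  record Invariant (c r : ℕ) : Set where
    field
      L-antitone : ∀ k → L c r (suc k) ≤ L c r k
      L-col : G (suc c) r ≡ true → ∃ λ t → Edge n (L c r) (L (suc c) r) t ×
        (∀ M → N ≤ M → t + colsum Y c M ≡ colsum X c M + colsum Y c r)
      L-row : G c (suc r) ≡ true → ∃ λ t → Edge n (L c r) (L c (suc r)) t ×
        (∀ M → n ≤ M → t + rowsum Y M r ≡ rowsum X M r + rowsum Y c r)
  open Invariant

  invariant : ∀ c r → G c r ≡ true → Invariant c r
  invariant = region-induction Invariant base step
    where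
    base : ∀ c r → G c r ≡ true → G (suc c) (suc r) ≡ false → Invariant c r
    base c r g e = record
      { L-antitone = λ k → subst (λ f → f (suc k) ≤ f k) (sym (L-outer c r g e)) (conjugate-antitone n (shape X c r) k)
      ; L-col = λ g′ → colsum X c r ,
          subst₂ (λ f f′ → Edge n f f′ (colsum X c r)) (sym (L-outer c r g e)) (sym (L-outer (suc c) r g′ (not-right _ _ e)))
            (conjugate-edge (shape-col-edge pp n c r (bound-c _ _ g′)) (λ k → shape≤ (suc c) r k (bound-c _ _ g′))) ,
          λ M N≤M → colsum-agree {X} {Y} {c} {r} (λ r′ p → Y-outside c r′ (not-above* (s≤s p) e)) (≤-trans (bound-r _ _ g) N≤M)
      ; L-row = λ g′ → rowsum X c r ,
          subst₂ (λ f f′ → Edge n f f′ (rowsum X c r)) (sym (L-outer c r g e)) (sym (L-outer c (suc r) g′ (not-above _ _ e)))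
            (conjugate-edge (shape-row-edge pp n c r (bound-c _ _ g)) (λ k → shape≤ c (suc r) k (bound-c _ _ g))) ,
          λ M n≤M → rowsum-agree {X} {Y} {c} {r} (λ c′ p → Y-outside c′ r (not-right* (s≤s p) e)) (≤-trans (bound-c _ _ g) n≤M) }
    step : ∀ c r → G (suc c) (suc r) ≡ true → Invariant (suc c) r → Invariant c (suc r) → Invariant (suc c) (suc r) → Invariant c r
    step c r e I J K with L-col J e | L-row I e
    ... | s , top , S | t , right , T = record
      { L-antitone = λ k → subst (λ f → f (suc k) ≤ f k) (sym (L-inner c r e)) (back-antitone (L-antitone I) (L-antitone J) k)
      ; L-col = λ _ → let s′ , E , q = bottom-edge in s′ ,
          subst (λ f → Edge n f (L (suc c) r) s′) (sym (L-inner c r e)) E ,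
          λ M p → cancel-cross {s′} {⟦ Y c r ⟧} {v = colsum X c M} (trans (cong (λ b → s′ + ⟦ b ⟧) (Y-inside c r e)) q) (S M p)
      ; L-row = λ _ → let t′ , E , q = left-edge in t′ ,
          subst (λ f → Edge n f (L c (suc r)) t′) (sym (L-inner c r e)) E ,
          λ M p → cancel-cross {t′} {⟦ Y c r ⟧} {v = rowsum X M r} (trans (cong (λ b → t′ + ⟦ b ⟧) (Y-inside c r e)) q) (T M p) }
      where open Backward {n} {L (suc c) r} {L c (suc r)} {L (suc c) (suc r)} (L-antitone K) top right

  back≤μ : ∀ μ ν λ′ k → back μ ν λ′ k ≤ μ k
  back≤μ μ ν λ′ k = ≤-trans (m∸n≤m (μ k ⊓ ν k) ⟦ peak μ ν λ′ (suc k) ⟧) (m⊓n≤m (μ k) (ν k))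

  back≤ν : ∀ μ ν λ′ k → back μ ν λ′ k ≤ ν k
  back≤ν μ ν λ′ k = ≤-trans (m∸n≤m (μ k ⊓ ν k) ⟦ peak μ ν λ′ (suc k) ⟧) (m⊓n≤n (μ k) (ν k))

  -- Empty labels on the axes are not built into backward growth. They hold at the boundary vertex
  -- on the axis, and `back` never exceeds its neighbour on the axis.
  L-left : ∀ c r → G c r ≡ true → c ≡ 0 → ∀ k → L c r k ≡ 0
  L-left = region-induction (λ c r → c ≡ 0 → ∀ k → L c r k ≡ 0)
    (λ { c r g e refl k → trans (cong (λ f → f k) (L-outer 0 r g e)) (conjugate-zero n (λ i → refl) k) })
    (λ c r e _ J _ z k → n≤0⇒n≡0 (≤-trans (≤-reflexive (cong (λ f → f k) (L-inner c r e)))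
       (≤-trans (back≤ν (L (suc c) r) (L c (suc r)) (L (suc c) (suc r)) k) (≤-reflexive (J z k)))))

  L-bottom : ∀ c r → G c r ≡ true → r ≡ 0 → ∀ k → L c r k ≡ 0
  L-bottom = region-induction (λ c r → r ≡ 0 → ∀ k → L c r k ≡ 0)
    (λ { c r g e refl k → trans (cong (λ f → f k) (L-outer c 0 g e)) (conjugate-zero n (λ i → lis-zero (layer i X) c) k) })
    (λ c r e I _ _ z k → n≤0⇒n≡0 (≤-trans (≤-reflexive (cong (λ f → f k) (L-inner c r e)))
       (≤-trans (back≤μ (L (suc c) r) (L c (suc r)) (L (suc c) (suc r)) k) (≤-reflexive (I z k)))))

  colsum-Y : ∀ c M → N ≤ M → colsum Y c M ≡ colsum X c M
  colsum-Y c M N≤M with G (suc c) 0 in eq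
  ... | true with L-col (invariant c 0 (left c 0 eq)) eq
  ...   | t , E , S rewrite Edge-zero E (L-bottom c 0 (left c 0 eq) refl) (L-bottom (suc c) 0 eq refl) =
    trans (S M N≤M) (+-identityʳ _)
  colsum-Y c M N≤M | false = trans (colsum-agree {X} {Y} {c} {0} (λ r _ → Y-outside c r (not-above* {_} {0} z≤n eq)) {M} z≤n) (+-identityʳ _)

  rowsum-Y : ∀ r M → n ≤ M → rowsum Y M r ≡ rowsum X M r
  rowsum-Y r M n≤M with G 0 (suc r) in eq
  ... | true with L-row (invariant 0 r (below 0 r eq)) eq
  ...   | t , E , S rewrite Edge-zero E (L-left 0 r (below 0 r eq) refl) (L-left 0 (suc r) eq refl) =
    trans (S M n≤M) (+-identityʳ _)
  rowsum-Y r M n≤M | false = trans (rowsum-agree {X} {Y} {0} {r} (λ c _ → Y-outside c r (not-right* {0} z≤n eq)) {M} z≤n) (+-identityʳ _)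

  Y-PartialPerm : PartialPerm Y
  Y-PartialPerm = partialPerm
    (λ c r → ≤-trans (mono-by-suc (colsum Y c) (λ i → m≤n+m _ ⟦ Y c i ⟧) (m≤m⊔n r N))
               (≤-trans (≤-reflexive (colsum-Y c (r ⊔ N) (m≤n⊔m r N))) (col≤1 pp c (r ⊔ N))))
    (λ c r → ≤-trans (mono-by-suc (λ c → rowsum Y c r) (λ i → m≤n+m _ ⟦ Y i r ⟧) (m≤m⊔n c n))
               (≤-trans (≤-reflexive (rowsum-Y r (c ⊔ n) (m≤n⊔m c n))) (row≤1 pp (c ⊔ n) r)))

  -- Forward growth undoes backward growth: `λ-max` is the forward rule in row k once the peaks in
  -- row k are known to be the crosses of layer k, which is the definition of Y for k = 0 and
  -- `peak-suc` afterwards.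
  shape-Y : ∀ c r → G c r ≡ true → ∀ k → shape Y c r k ≡ L c r k
  shape-Y zero r g k = sym (L-left 0 r g refl k)
  shape-Y (suc c) zero g k = sym (L-bottom (suc c) 0 g refl k)
  shape-Y (suc c) (suc r) g k with L-col (invariant c (suc r) (left _ _ g)) g | L-row (invariant (suc c) r (below _ _ g)) g
  ... | s , top , _ | t , right , _ =
    trans (cong₂ _+_ (cong₂ _⊔_ (shape-Y (suc c) r (below _ _ g) k) (shape-Y c (suc r) (left _ _ g) k)) (cong ⟦_⟧ (cross k))) (λ-max k)
    where
    open Backward {n} {L (suc c) r} {L c (suc r)} {L (suc c) (suc r)} (L-antitone (invariant _ _ g)) top right
    cross : ∀ k → layer k Y c r ≡ peak (L (suc c) r) (L c (suc r)) (L (suc c) (suc r)) k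
    cross zero = Y-inside c r g
    cross (suc k) = begin
        layer (suc k) Y c r
      ≡⟨ cong (λ Z → Z c r) (layer-next k Y) ⟩
        (shape Y c r k <ᵇ shape Y (suc c) r k) ∧ (shape Y c r k <ᵇ shape Y c (suc r) k)
      ≡⟨ cong₂ _∧_ (cong₂ _<ᵇ_ (shape-Y c r (left _ _ (below _ _ g)) k) (shape-Y (suc c) r (below _ _ g) k))
                   (cong₂ _<ᵇ_ (shape-Y c r (left _ _ (below _ _ g)) k) (shape-Y c (suc r) (left _ _ g) k)) ⟩
        (L c r k <ᵇ L (suc c) r k) ∧ (L c r k <ᵇ L c (suc r) k)
      ≡⟨ cong (λ f → (f k <ᵇ L (suc c) r k) ∧ (f k <ᵇ L c (suc r) k)) (L-inner c r g) ⟩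
        _
      ≡⟨ peak-suc k ⟨
        peak (L (suc c) r) (L c (suc r)) (L (suc c) (suc r)) (suc k) ∎
      where open ≡-Reasoning

  shape-Y-outer : ∀ c r → G c r ≡ true → G (suc c) (suc r) ≡ false → ∀ k → shape Y c r k ≡ conjugate n (shape X c r) k
  shape-Y-outer c r g e k = trans (shape-Y c r g k) (cong (λ f → f k) (L-outer c r g e))

  shape-dual : ∀ c r → c ≤ n → ∀ j k → (k <ᵇ conjugate n (shape X c r) j) ≡ (j <ᵇ shape X c r k)
  shape-dual c r p = conjugate-dual n (shape X c r) (shape-antitone pp c r) (shape-support X c r n p)

  -- At a boundary vertex the two labels are conjugate, and conjugation exchanges the first row
  -- (longest increasing chain) with the number of rows (longest decreasing chain).
  transpose-chain : ∀ o d c r → G c r ≡ true → G (suc c) (suc r) ≡ false →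
    Chain o Y c 0 r d → Chain (flip-direction o) X c 0 r d
  transpose-chain o zero c r g e w = tt
  transpose-chain up (suc d) c r g e w = shape⇒down-chain d (<ᵇ≡⇒<
    (trans (sym (shape-dual c r (bound-c _ _ g) 0 d))
           (<⇒<ᵇ≡ (≤-trans (up-chain⇒lis (suc d) w) (≤-reflexive (shape-Y-outer c r g e 0))))))
  transpose-chain down (suc d) c r g e w = lis⇒up-chain pp (suc d) c r (<ᵇ≡⇒<
    (trans (sym (shape-dual c r (bound-c _ _ g) d 0))
           (<⇒<ᵇ≡ (≤-trans (down-chain⇒shape Y-PartialPerm d w) (≤-reflexive (shape-Y-outer c r g e d))))))

  -- Conjugating twice restores the labels of X on the boundary, and the backward rule inverts the
  -- forward rule at every cell, so all labels of X come back and the peaks in row 0 are its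
  -- crosses. G′ is separate from G because it will be recomputed from the new word.
  transpose-involutive : ∀ {G′} → (∀ c r → G′ c r ≡ G c r) → ∀ c r → transpose n N G′ Y c r ≡ X c r
  transpose-involutive {G′} G≗ c r with G′ (suc c) (suc r) in eq
  ... | false = Y-outside c r (trans (sym (G≗ _ _)) eq)
  ... | true = trans (cong₂ _<ᵇ_ (cong₂ _⊔_ (L′-shape (suc c) r (below _ _ g) 0) (L′-shape c (suc r) (left _ _ g) 0)) (L′-shape (suc c) (suc r) g 0))
                     (shape-peak c r 0)
    where
    g : G (suc c) (suc r) ≡ true
    g = trans (sym (G≗ _ _)) eq
    L′ : ℕ → ℕ → ℕ → ℕ
    L′ = conjugate-labels n N G′ Y
    shape-peak : ∀ c r k → peak (shape X (suc c) r) (shape X c (suc r)) (shape X (suc c) (suc r)) k ≡ layer k X c r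
    shape-peak c r k with layer k X c r
    ... | true = trans (cong (m <ᵇ_) (+-comm m 1)) (n<ᵇ1+n m)
      where m = lis (layer k X) (suc c) r ⊔ lis (layer k X) c (suc r)
    ... | false = trans (cong (m <ᵇ_) (+-identityʳ m)) (n<ᵇn m)
      where m = lis (layer k X) (suc c) r ⊔ lis (layer k X) c (suc r)
    L′-shape : ∀ c r → G c r ≡ true → ∀ k → L′ c r k ≡ shape X c r k
    L′-shape = region-induction (λ c r → ∀ k → L′ c r k ≡ shape X c r k)
      (λ c r g e k → begin
          L′ c r k
        ≡⟨ cong (λ f → f k) (labels-outer n N G′ _ c r (bound-c _ _ g) (bound-r _ _ g) (trans (G≗ _ _) e)) ⟩
          conjugate n (shape Y c r) k
        ≡⟨ conjugate-cong n (shape-Y-outer c r g e) k ⟩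
          conjugate n (conjugate n (shape X c r)) k
        ≡⟨ conjugate-involutive n (shape X c r) (shape-antitone pp c r) (shape-support X c r n (bound-c _ _ g))
             (λ i → shape≤ c r i (bound-c _ _ g)) k ⟩
          shape X c r k ∎)
      (λ c r e I J K k → begin
          L′ c r k
        ≡⟨ cong (λ f → f k) (labels-inner n N G′ _ c r (bound-c _ _ e) (bound-r _ _ e) (trans (G≗ _ _) e)) ⟩
          (L′ (suc c) r k ⊓ L′ c (suc r) k) ∸ ⟦ (L′ (suc c) r (suc k) ⊔ L′ c (suc r) (suc k)) <ᵇ L′ (suc c) (suc r) (suc k) ⟧
        ≡⟨ cong₂ _∸_ (cong₂ _⊓_ (I k) (J k)) (cong ⟦_⟧ (cong₂ _<ᵇ_ (cong₂ _⊔_ (I (suc k)) (J (suc k))) (K (suc k)))) ⟩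
          (shape X (suc c) r k ⊓ shape X c (suc r) k) ∸ ⟦ peak (shape X (suc c) r) (shape X c (suc r)) (shape X (suc c) (suc r)) (suc k) ⟧
        ≡⟨ cong (λ b → (shape X (suc c) r k ⊓ shape X c (suc r) k) ∸ ⟦ b ⟧) (shape-peak c r (suc k)) ⟩
          (shape X (suc c) r k ⊓ shape X c (suc r) k) ∸ ⟦ layer (suc k) X c r ⟧
        ≡⟨ cong₂ (λ m Z → m ∸ ⟦ Z c r ⟧) (sym (cell-min (layer-PartialPerm k pp) c r)) (layer-next k X) ⟩
          (shape X c r k + ⟦ next (layer k X) c r ⟧) ∸ ⟦ next (layer k X) c r ⟧
        ≡⟨ m+n∸n≡m (shape X c r k) ⟦ next (layer k X) c r ⟧ ⟩
          shape X c r k ∎)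
      where open ≡-Reasoning

-- Standardizations and permutations as lists

≡ᵇ-refl : ∀ n → (n ≡ᵇ n) ≡ true
≡ᵇ-refl zero = refl
≡ᵇ-refl (suc n) = ≡ᵇ-refl n

≡ᵇ≡⇒≡ : ∀ {m n} → (m ≡ᵇ n) ≡ true → m ≡ n
≡ᵇ≡⇒≡ {m} {n} e = ≡ᵇ⇒≡ m n (subst T (sym e) tt)

≢⇒≡ᵇ≡ : ∀ {m n} → m ≢ n → (m ≡ᵇ n) ≡ false
≢⇒≡ᵇ≡ {m} {n} ne with m ≡ᵇ n in eq
... | true = ⊥-elim (ne (≡ᵇ≡⇒≡ eq))
... | false = refl

==L-sound : ∀ xs ys → (xs ==L ys) ≡ true → xs ≡ ys
==L-sound [] [] e = refl
==L-sound (x ∷ xs) (y ∷ ys) e with ∧-true {x ≡ᵇ y} e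
... | p , q = cong₂ _∷_ (≡ᵇ≡⇒≡ p) (==L-sound xs ys q)

==L-refl : ∀ xs → (xs ==L xs) ≡ true
==L-refl [] = refl
==L-refl (x ∷ xs) = ∧-intro (≡ᵇ-refl x) (==L-refl xs)

all-sound : ∀ (p : A → Bool) xs → all p xs ≡ true → ∀ {x} → x ∈ xs → p x ≡ true
all-sound p (x ∷ xs) e (here refl) = proj₁ (∧-true {p x} e)
all-sound p (x ∷ xs) e (there i) = all-sound p xs (proj₂ (∧-true {p x} e)) i

all-complete : ∀ (p : A → Bool) xs → (∀ {x} → x ∈ xs → p x ≡ true) → all p xs ≡ true
all-complete p [] h = refl
all-complete p (x ∷ xs) h = ∧-intro (h (here refl)) (all-complete p xs (h ∘ there))

any-sound : ∀ (p : A → Bool) xs → any p xs ≡ true → ∃ λ x → x ∈ xs × p x ≡ true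
any-sound p (x ∷ xs) e with p x in eq
... | true = x , here refl , eq
... | false = let y , i , f = any-sound p xs e in y , there i , f

any-complete : ∀ (p : A → Bool) xs {x} → x ∈ xs → p x ≡ true → any p xs ≡ true
any-complete p (x ∷ xs) (here refl) e rewrite e = refl
any-complete p (x ∷ xs) (there i) e with p x
... | true = refl
... | false = any-complete p xs i e

subseqs-sound : ∀ {xs ys : List A} → ys ∈ subseqs xs → ys ⊆ xs
subseqs-sound {xs = []} (here refl) = []
subseqs-sound {xs = x ∷ xs} i with ∈-++⁻ (map (x ∷_) (subseqs xs)) i
... | inj₂ j = x ∷ʳ subseqs-sound j
... | inj₁ j with ∈-map⁻ (x ∷_) j
...   | zs , k , refl = refl ∷ subseqs-sound k

subseqs-complete : ∀ {xs ys : List A} → ys ⊆ xs → ys ∈ subseqs xs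
subseqs-complete [] = here refl
subseqs-complete {xs = x ∷ xs} (x ∷ʳ p) = ∈-++⁺ʳ (map (x ∷_) (subseqs xs)) (subseqs-complete p)
subseqs-complete {xs = x ∷ xs} (refl ∷ p) = ∈-++⁺ˡ (∈-map⁺ (x ∷_) (subseqs-complete p))

filterᵇ-∷ : ∀ (p : A → Bool) x xs → length (filterᵇ p (x ∷ xs)) ≡ ⟦ p x ⟧ + length (filterᵇ p xs)
filterᵇ-∷ p x xs with p x
... | true = refl
... | false = refl

filterᵇ-↭ : ∀ (p : A → Bool) {xs ys} → xs ↭ ys → length (filterᵇ p xs) ≡ length (filterᵇ p ys)
filterᵇ-↭ p q = ↭-length (filter-↭ _ q)

AllPairs-⊆ : ∀ {R : A → A → Set} {xs ys} → xs ⊆ ys → AllPairs R ys → AllPairs R xs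
AllPairs-⊆ [] u = u
AllPairs-⊆ (y ∷ʳ p) (_ ∷ u) = AllPairs-⊆ p u
AllPairs-⊆ (refl ∷ p) (h ∷ u) = Sublist.All-resp-⊆ p h ∷ AllPairs-⊆ p u

just∈⇒∈-catMaybes : ∀ {xs : List (Maybe A)} {v} → just v ∈ xs → v ∈ catMaybes xs
just∈⇒∈-catMaybes (here refl) = here refl
just∈⇒∈-catMaybes {xs = just v ∷ xs} (there i) = there (just∈⇒∈-catMaybes i)
just∈⇒∈-catMaybes {xs = nothing ∷ xs} (there i) = just∈⇒∈-catMaybes {xs = xs} i

∈-split : ∀ {x : A} {ys} → x ∈ ys → ∃ λ zs → ys ↭ x ∷ zs
∈-split i with ∈-∃++ i
... | as , bs , refl = as ++ bs , shift _ as bs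

Unique-injects : ∀ {xs ys : List A} → Unique xs → (∀ {x} → x ∈ xs → x ∈ ys) → ∃ λ zs → ys ↭ xs ++ zs
Unique-injects {xs = []} {ys} u h = ys , ↭-refl
Unique-injects {xs = x ∷ xs} {ys} (x∉ ∷ u) h with ∈-split (h (here refl))
... | ys′ , p with Unique-injects {xs = xs} {ys′} u (λ {z} i → shrink z i (∈-resp-↭ p (h (there i))))
  where
  shrink : ∀ z → z ∈ xs → z ∈ x ∷ ys′ → z ∈ ys′
  shrink z i (here refl) = ⊥-elim (All.lookup x∉ i refl)
  shrink z i (there j) = j
...   | zs , q = zs , ↭-trans p (prep x q)

Unique-length : ∀ {xs ys : List A} → Unique xs → (∀ {x} → x ∈ xs → x ∈ ys) → length xs ≤ length ys
Unique-length {xs = xs} u h with Unique-injects u h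
... | zs , p = ≤-trans (≤-trans (m≤m+n _ _) (≤-reflexive (sym (length-++ xs)))) (≤-reflexive (sym (↭-length p)))

Unique-↭ : ∀ {xs ys : List A} → Unique xs → (∀ {x} → x ∈ xs → x ∈ ys) → length ys ≡ length xs → ys ↭ xs
Unique-↭ {xs = xs} {ys} u h e with Unique-injects u h
... | [] , p = subst (ys ↭_) (++-identityʳ xs) p
... | z ∷ zs , p = ⊥-elim (<⇒≢ (m<m+n (length xs) {length (z ∷ zs)} (s≤s z≤n)) (trans (sym e) (trans (↭-length p) (length-++ xs))))

Unique-resp-↭ : ∀ {xs ys : List A} → xs ↭ ys → Unique xs → Unique ys
Unique-resp-↭ p = Permutationₛ.Unique-resp-↭ (setoid _) (↭⇒↭ₛ p)

∈-oneTo⁻ : ∀ {m x} → x ∈ oneTo m → 1 ≤ x × x ≤ m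
∈-oneTo⁻ i with ∈-map⁻ suc i
... | y , j , refl = s≤s z≤n , ∈-upTo⁻ j

∈-oneTo⁺ : ∀ {m x} → 1 ≤ x → x ≤ m → x ∈ oneTo m
∈-oneTo⁺ {x = suc x} p q = ∈-map⁺ suc (∈-upTo⁺ q)

oneTo-Unique : ∀ m → Unique (oneTo m)
oneTo-Unique m = Unique.map⁺ suc-injective (Unique.upTo⁺ m)

length-oneTo : ∀ m → length (oneTo m) ≡ m
length-oneTo m = trans (length-map suc (upTo m)) (length-upTo m)

occ-∉ : ∀ x xs → x ∉ xs → occ x xs ≡ 0
occ-∉ x [] h = refl
occ-∉ x (y ∷ xs) h rewrite filterᵇ-∷ (x ≡ᵇ_) y xs | ≢⇒≡ᵇ≡ {x} {y} (λ e → h (here e)) = occ-∉ x xs (h ∘ there)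

occ-∈ : ∀ x xs → Unique xs → x ∈ xs → occ x xs ≡ 1
occ-∈ x (y ∷ xs) (h ∷ u) (here refl) rewrite filterᵇ-∷ (x ≡ᵇ_) x xs | ≡ᵇ-refl x =
  cong suc (occ-∉ x xs (λ i → All.lookup h i refl))
occ-∈ x (y ∷ xs) (h ∷ u) (there i)
  rewrite filterᵇ-∷ (x ≡ᵇ_) y xs | ≢⇒≡ᵇ≡ {x} {y} (λ e → All.lookup h i (sym e)) = occ-∈ x xs u i

occ-Unique≤1 : ∀ x xs → Unique xs → occ x xs ≤ 1
occ-Unique≤1 x [] u = z≤n
occ-Unique≤1 x (y ∷ xs) (h ∷ u) rewrite filterᵇ-∷ (x ≡ᵇ_) y xs with x ≡ᵇ y in eq
... | false = occ-Unique≤1 x xs u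
... | true rewrite ≡ᵇ≡⇒≡ {x} {y} eq = ≤-reflexive (cong suc (occ-∉ y xs (λ i → All.lookup h i refl)))

occ⇒∈ : ∀ x xs → occ x xs ≡ 1 → x ∈ xs
occ⇒∈ x (y ∷ xs) e with x ≡ᵇ y in eq
... | true = here (≡ᵇ≡⇒≡ eq)
... | false = there (occ⇒∈ x xs e)

isPermOf-sound : ∀ m xs → isPermOf m xs ≡ true → xs ↭ oneTo m
isPermOf-sound m xs e with ∧-true {length xs ≡ᵇ m} e
... | p , q = Unique-↭ (oneTo-Unique m) (λ {x} i → occ⇒∈ x xs (≡ᵇ≡⇒≡ (all-sound _ (oneTo m) q i)))
                       (trans (≡ᵇ≡⇒≡ p) (sym (length-oneTo m)))

isPermOf-complete : ∀ m xs → xs ↭ oneTo m → isPermOf m xs ≡ true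
isPermOf-complete m xs p = ∧-intro
  (subst (λ l → (l ≡ᵇ m) ≡ true) (sym (trans (↭-length p) (length-oneTo m))) (≡ᵇ-refl m))
  (all-complete _ (oneTo m) λ {x} i →
    subst (λ o → (o ≡ᵇ 1) ≡ true) (sym (trans (filterᵇ-↭ (x ≡ᵇ_) p) (occ-∈ x (oneTo m) (oneTo-Unique m) i))) refl)

-- Ranks and standardization

rank : List ℕ → ℕ → ℕ
rank xs x = length (filterᵇ (_<ᵇ x) xs)

rank-∷ : ∀ y xs x → rank (y ∷ xs) x ≡ ⟦ y <ᵇ x ⟧ + rank xs x
rank-∷ y xs x = filterᵇ-∷ (_<ᵇ x) y xs

⟦⟧-mono : ∀ {a b} → (a ≡ true → b ≡ true) → ⟦ a ⟧ ≤ ⟦ b ⟧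
⟦⟧-mono {false} h = z≤n
⟦⟧-mono {true} h rewrite h refl = ≤-refl

rank-mono : ∀ xs {x y} → x ≤ y → rank xs x ≤ rank xs y
rank-mono [] p = z≤n
rank-mono (z ∷ xs) {x} {y} p rewrite rank-∷ z xs x | rank-∷ z xs y =
  +-mono-≤ (⟦⟧-mono (λ e → <⇒<ᵇ≡ (<-≤-trans (<ᵇ≡⇒< e) p))) (rank-mono xs p)

rank-strict : ∀ xs {x y} → x ∈ xs → x < y → rank xs x < rank xs y
rank-strict (z ∷ xs) {x} {y} (here refl) p rewrite rank-∷ z xs x | rank-∷ z xs y | n<ᵇn x | <⇒<ᵇ≡ p = s≤s (rank-mono xs (<⇒≤ p))
rank-strict (z ∷ xs) {x} {y} (there i) p rewrite rank-∷ z xs x | rank-∷ z xs y =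
  +-mono-≤-< (⟦⟧-mono (λ e → <⇒<ᵇ≡ (<-trans (<ᵇ≡⇒< e) p))) (rank-strict xs i p)

<ᵇ-cong : ∀ {a b c d} → (a < b → c < d) → (b ≤ a → d ≤ c) → (c <ᵇ d) ≡ (a <ᵇ b)
<ᵇ-cong {a} {b} h k with a <? b
... | yes p = trans (<⇒<ᵇ≡ (h p)) (sym (<⇒<ᵇ≡ p))
... | no p = trans (≮⇒<ᵇ≡ (≤⇒≯ (k (≮⇒≥ p)))) (sym (≮⇒<ᵇ≡ p))

rank-<ᵇ : ∀ xs {x} y → x ∈ xs → (rank xs x <ᵇ rank xs y) ≡ (x <ᵇ y)
rank-<ᵇ xs {x} y i = <ᵇ-cong {x} {y} (rank-strict xs i) (rank-mono xs)

std-cong : ∀ (f g : A → ℕ) zs → (∀ {z z′} → z ∈ zs → z′ ∈ zs → (f z <ᵇ f z′) ≡ (g z <ᵇ g z′)) →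
  std (map f zs) ≡ std (map g zs)
std-cong f g zs h = begin
  map (λ x → suc (rank (map f zs) x)) (map f zs)  ≡⟨ map-∘ zs ⟨
  map (λ z → suc (rank (map f zs) (f z))) zs      ≡⟨ map-cong-local (All.tabulate λ {z} i → cong suc (ranks zs (λ j → h j i))) ⟩
  map (λ z → suc (rank (map g zs) (g z))) zs      ≡⟨ map-∘ zs ⟩
  map (λ x → suc (rank (map g zs) x)) (map g zs)  ∎
  where
  open ≡-Reasoning
  ranks : ∀ ws {z} → (∀ {w} → w ∈ ws → (f w <ᵇ f z) ≡ (g w <ᵇ g z)) → rank (map f ws) (f z) ≡ rank (map g ws) (g z)
  ranks [] h = refl
  ranks (w ∷ ws) {z} h rewrite rank-∷ (f w) (map f ws) (f z) | rank-∷ (g w) (map g ws) (g z) =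
    cong₂ (λ b n → ⟦ b ⟧ + n) (h (here refl)) (ranks ws (h ∘ there))

rank-upTo : ∀ m x → x < m → rank (oneTo m) (suc x) ≡ x
rank-upTo m x p = trans (lem m x) (m≥n⇒m⊓n≡n (<⇒≤ p))
  where
  lem : ∀ m x → rank (oneTo m) (suc x) ≡ m ⊓ x
  lem m x = go m
    where
    rank-++ : ∀ xs ys z → rank (xs ++ ys) z ≡ rank xs z + rank ys z
    rank-++ [] ys z = refl
    rank-++ (w ∷ xs) ys z rewrite rank-∷ w (xs ++ ys) z | rank-∷ w xs z | rank-++ xs ys z = sym (+-assoc ⟦ w <ᵇ z ⟧ _ _)
    snoc : ∀ m → oneTo (suc m) ≡ oneTo m ++ (suc m ∷ [])
    snoc m = trans (cong (map suc) (sym (upTo-∷ʳ m))) (map-++ suc (upTo m) (m ∷ []))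
    step : ∀ m → m ⊓ x + (⟦ m <ᵇ x ⟧ + 0) ≡ suc m ⊓ x
    step m with m <? x
    ... | yes q rewrite <⇒<ᵇ≡ q | m≤n⇒m⊓n≡m (<⇒≤ q) | m≤n⇒m⊓n≡m q = +-comm m 1
    ... | no q rewrite ≮⇒<ᵇ≡ q | m≥n⇒m⊓n≡n (≮⇒≥ q) | m≥n⇒m⊓n≡n (m≤n⇒m≤1+n (≮⇒≥ q)) = +-identityʳ x
    go : ∀ m → rank (oneTo m) (suc x) ≡ m ⊓ x
    go zero = refl
    go (suc m) = trans (cong (λ l → rank l (suc x)) (snoc m)) (trans (rank-++ (oneTo m) (suc m ∷ []) (suc x))
      (trans (cong₂ _+_ (go m) (rank-∷ (suc m) [] (suc x))) (step m)))

std-permutation : ∀ m xs → xs ↭ oneTo m → std xs ≡ xs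
std-permutation m xs p = trans (map-cong-local (All.tabulate λ {x} i → fixed (∈-resp-↭ p i))) (map-id xs)
  where
  fixed : ∀ {x} → x ∈ oneTo m → suc (rank xs x) ≡ x
  fixed {x} i with ∈-oneTo⁻ {m} i
  fixed {suc x} i | _ , q = cong suc (trans (filterᵇ-↭ (_<ᵇ suc x) p) (rank-upTo m x q))

rank≤ : ∀ xs x → rank xs x ≤ length xs
rank≤ [] x = z≤n
rank≤ (y ∷ xs) x rewrite rank-∷ y xs x = +-mono-≤ (⟦⟧≤1 (y <ᵇ x)) (rank≤ xs x)

rank< : ∀ xs {x} → x ∈ xs → rank xs x < length xs
rank< (y ∷ xs) {x} (here refl) rewrite rank-∷ y xs x | n<ᵇn x = s≤s (rank≤ xs x)
rank< (y ∷ xs) {x} (there i) rewrite rank-∷ y xs x = +-mono-≤-< (⟦⟧≤1 (y <ᵇ x)) (rank< xs i)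

Unique-map-local : ∀ (f : A → B) xs → (∀ {x y} → x ∈ xs → y ∈ xs → f x ≡ f y → x ≡ y) → Unique xs → Unique (map f xs)
Unique-map-local f [] h u = []
Unique-map-local f (x ∷ xs) h (x∉ ∷ u) =
  All.map⁺ (All.tabulate λ {y} i e → All.lookup x∉ i (h (here refl) (there i) e)) ∷ Unique-map-local f xs (λ i j → h (there i) (there j)) u

std-Unique : ∀ xs → Unique xs → std xs ↭ oneTo (length xs)
std-Unique xs u = ↭-sym (Unique-↭ (Unique-map-local _ xs inj u) bounded (trans (length-oneTo _) (sym (length-map _ xs))))
  where
  inj : ∀ {x y} → x ∈ xs → y ∈ xs → suc (rank xs x) ≡ suc (rank xs y) → x ≡ y
  inj {x} {y} i j e with <-cmp x y
  ... | tri< p _ _ = ⊥-elim (<⇒≢ (rank-strict xs i p) (suc-injective e))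
  ... | tri≈ _ p _ = p
  ... | tri> _ _ p = ⊥-elim (<⇒≢ (rank-strict xs j p) (suc-injective (sym e)))
  bounded : ∀ {x} → x ∈ std xs → x ∈ oneTo (length xs)
  bounded i with ∈-map⁻ _ i
  ... | y , j , refl = ∈-oneTo⁺ (s≤s z≤n) (rank< xs j)

allVecs-complete : ∀ (xs : List A) n (v : Vec A n) → (∀ {x} → x ∈ toList v → x ∈ xs) → v ∈ allVecs xs n
allVecs-complete xs zero [] h = here refl
allVecs-complete xs (suc n) (x ∷ v) h =
  ∈-concat⁺′ (∈-map⁺ (x ∷_) (allVecs-complete xs n v (h ∘ there))) (∈-map⁺ _ (h (here refl)))

allVecs-Unique : ∀ (xs : List A) n → Unique xs → Unique (allVecs xs n)
allVecs-Unique xs zero u = [] ∷ []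
allVecs-Unique xs (suc n) u = go xs u
  where
  rest = allVecs-Unique xs n u
  go : ∀ ys → Unique ys → Unique (concatMap (λ x → map (x ∷_) (allVecs xs n)) ys)
  go [] _ = []
  go (y ∷ ys) (y∉ ∷ v) = Unique.++⁺ (Unique.map⁺ (λ { refl → refl }) rest) (go ys v) disjoint
    where
    disjoint : ∀ {w} → w ∈ map (y ∷_) (allVecs xs n) × w ∈ concatMap (λ x → map (x ∷_) (allVecs xs n)) ys → ⊥
    disjoint (i , j) with ∈-map⁻ (y ∷_) i | ∈-concat⁻′ (map (λ x → map (x ∷_) (allVecs xs n)) ys) j
    ... | a , _ , refl | _ , k , l with ∈-map⁻ (λ x → map (x ∷_) (allVecs xs n)) l
    ...   | y′ , y′∈ , refl with ∈-map⁻ (y′ ∷_) k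
    ...     | b , _ , refl = All.lookup y∉ y′∈ refl

-- Occurrences with wild holes are occurrences in extensions

Agree : Maybe ℕ × ℕ → Maybe ℕ × ℕ → Set
Agree (just u , a) (just v , b) = (u <ᵇ v) ≡ (a <ᵇ b)
Agree _ _ = ⊤

AllAgree : List (Maybe ℕ × ℕ) → Set
AllAgree zs = ∀ {z z′} → z ∈ zs → z′ ∈ zs → Agree z z′

-- A hole may play any entry of the pattern.
record Occurrence (p : List ℕ) (xs : List (Maybe ℕ)) : Set where
  constructor occurrence
  field
    cells   : List (Maybe ℕ × ℕ)
    embeds  : map proj₁ cells ⊆ xs
    pattern-is : map proj₂ cells ≡ p
    agree   : AllAgree cells

pairs : ∀ {n} → Vec ℕ n → Vec (Maybe ℕ) n → List (ℕ × Maybe ℕ)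
pairs [] [] = []
pairs (s ∷ σ) (x ∷ π) = (s , x) ∷ pairs σ π

pairs-proj₁ : ∀ {n} (σ : Vec ℕ n) π → map proj₁ (pairs σ π) ≡ toList σ
pairs-proj₁ [] [] = refl
pairs-proj₁ (s ∷ σ) (x ∷ π) = cong (s ∷_) (pairs-proj₁ σ π)

pairs-proj₂ : ∀ {n} (σ : Vec ℕ n) π → map proj₂ (pairs σ π) ≡ toList π
pairs-proj₂ [] [] = refl
pairs-proj₂ (s ∷ σ) (x ∷ π) = cong (x ∷_) (pairs-proj₂ σ π)

solid : List (ℕ × Maybe ℕ) → List (ℕ × ℕ)
solid [] = []
solid ((s , just v) ∷ ws) = (s , v) ∷ solid ws
solid ((s , nothing) ∷ ws) = solid ws

solid-proj₁ : ∀ {n} (σ : Vec ℕ n) π → map proj₁ (solid (pairs σ π)) ≡ restrict σ π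
solid-proj₁ [] [] = refl
solid-proj₁ (s ∷ σ) (just x ∷ π) = cong (s ∷_) (solid-proj₁ σ π)
solid-proj₁ (s ∷ σ) (nothing ∷ π) = solid-proj₁ σ π

solid-proj₂ : ∀ ws → map proj₂ (solid ws) ≡ catMaybes (map proj₂ ws)
solid-proj₂ [] = refl
solid-proj₂ ((s , just v) ∷ ws) = cong (v ∷_) (solid-proj₂ ws)
solid-proj₂ ((s , nothing) ∷ ws) = solid-proj₂ ws

∈-solid⁺ : ∀ {s v} ws → (s , just v) ∈ ws → (s , v) ∈ solid ws
∈-solid⁺ (_ ∷ ws) (here refl) = here refl
∈-solid⁺ ((s , just v) ∷ ws) (there i) = there (∈-solid⁺ ws i)
∈-solid⁺ ((s , nothing) ∷ ws) (there i) = ∈-solid⁺ ws i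

∈-solid⁻ : ∀ {s v} ws → (s , v) ∈ solid ws → (s , just v) ∈ ws
∈-solid⁻ ((s , just v) ∷ ws) (here refl) = here refl
∈-solid⁻ ((s , just v) ∷ ws) (there i) = there (∈-solid⁻ ws i)
∈-solid⁻ ((s , nothing) ∷ ws) i = there (∈-solid⁻ ws i)

⊆-map⁻ : ∀ (f : A → B) ws {ys} → ys ⊆ map f ws → ∃ λ vs → vs ⊆ ws × map f vs ≡ ys
⊆-map⁻ f [] [] = [] , [] , refl
⊆-map⁻ f (w ∷ ws) (_ ∷ʳ p) = let vs , q , e = ⊆-map⁻ f ws p in vs , w ∷ʳ q , e
⊆-map⁻ f (w ∷ ws) (refl ∷ p) = let vs , q , e = ⊆-map⁻ f ws p in w ∷ vs , refl ∷ q , cong (f w ∷_) e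

map-determines : ∀ (f : A → ℕ) (g : A → ℕ) (h : ℕ → ℕ) ws → map h (map f ws) ≡ map g ws → ∀ {w} → w ∈ ws → h (f w) ≡ g w
map-determines f g h (w ∷ ws) e (here refl) = ∷-injectiveˡ e
map-determines f g h (w ∷ ws) e (there i) = map-determines f g h ws (∷-injectiveʳ e) i

Sublist-∈ : ∀ {xs ys : List A} → xs ⊆ ys → ∀ {x} → x ∈ xs → x ∈ ys
Sublist-∈ p i = Sublist.lookup p i

-- Each position of the occurrence is paired with the rank of its σ-entry inside the occurrence. At
-- two non-holes these ranks compare like the entries of π, since standardizing preserves
-- comparisons; holes carry no condition.
extension⇒occurrence : ∀ {n} p (σ : Vec ℕ n) (π : Vec (Maybe ℕ) n) →
  isExtension σ π ≡ true → contains (toList σ) p ≡ true → Occurrence p (toList π)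
extension⇒occurrence {n} p σ π e c
  with any-sound _ (subseqs (toList σ)) c | ==L-sound (std (restrict σ π)) _ (proj₂ (∧-true {isPermOf n (toList σ)} e))
... | s , s∈ , f | std≡
  with ⊆-map⁻ proj₁ (pairs σ π) (subst (s ⊆_) (sym (pairs-proj₁ σ π)) (subseqs-sound s∈))
...   | vs , q , refl = occurrence
        (map cell vs)
        (subst₂ _⊆_ (map-∘ vs) (pairs-proj₂ σ π) (Sublist.map⁺ proj₂ q))
        (trans (sym (map-∘ vs)) (trans (map-∘ vs) (==L-sound (std s) p f)))
        λ i j → good i j
  where
  cell : ℕ × Maybe ℕ → Maybe ℕ × ℕ
  cell (t , x) = x , suc (rank (map proj₁ vs) t)
  S = solid (pairs σ π)
  value : ∀ {w} → w ∈ S → suc (rank (map proj₁ S) (proj₁ w)) ≡ proj₂ w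
  value = map-determines proj₁ proj₂ (λ x → suc (rank (map proj₁ S) x)) S
    (begin
      std (map proj₁ S)                  ≡⟨ cong std (solid-proj₁ σ π) ⟩
      std (restrict σ π)                 ≡⟨ std≡ ⟩
      catMaybes (toList π)               ≡⟨ cong catMaybes (pairs-proj₂ σ π) ⟨
      catMaybes (map proj₂ (pairs σ π))  ≡⟨ solid-proj₂ (pairs σ π) ⟨
      map proj₂ S                        ∎)
    where open ≡-Reasoning
  order : ∀ {t u t′ u′} → (t , u) ∈ S → (t′ , u′) ∈ S → (u <ᵇ u′) ≡ (t <ᵇ t′)
  order {t} {u} {t′} {u′} i j =
    trans (cong₂ _<ᵇ_ (sym (value i)) (sym (value j))) (rank-<ᵇ (map proj₁ S) t′ (∈-map⁺ proj₁ i))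
  good : ∀ {z z′} → z ∈ map cell vs → z′ ∈ map cell vs → Agree z z′
  good i j with ∈-map⁻ cell i | ∈-map⁻ cell j
  ... | (t , nothing) , _ , refl | (t′ , _) , _ , refl = tt
  ... | (t , just u) , _ , refl | (t′ , nothing) , _ , refl = tt
  ... | (t , just u) , k , refl | (t′ , just u′) , l , refl =
    trans (order (∈-solid⁺ _ (Sublist-∈ q k)) (∈-solid⁺ _ (Sublist-∈ q l)))
          (sym (rank-<ᵇ (map proj₁ vs) t′ (∈-map⁺ proj₁ k)))

-- Completing an occurrence to an extension: the hole playing a is placed just above the largest entry
-- playing a smaller letter, the holes outside the occurrence play fresh letters above all others.
Embedding : List (Maybe ℕ × ℕ) → List (Maybe ℕ) → Set
Embedding = Heterogeneous.Sublist (λ z x → proj₁ z ≡ x)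

embedding : ∀ zs {xs} → map proj₁ zs ⊆ xs → Embedding zs xs
embedding [] [] = []
embedding [] (x ∷ʳ p) = x ∷ʳ embedding [] p
embedding (z ∷ zs) (x ∷ʳ p) = x ∷ʳ embedding (z ∷ zs) p
embedding (z ∷ zs) (e ∷ p) = e ∷ embedding zs p

-- A position outside the occurrence gets M plus the number of positions after it, so the fresh
-- marks are pairwise distinct.
annotate : ∀ M (zs : List (Maybe ℕ × ℕ)) {xs : List (Maybe ℕ)} → Embedding zs xs → List (Maybe ℕ × ℕ)
annotate M _ [] = []
annotate M zs (_∷ʳ_ {ys = ys} x p) = (x , M + length ys) ∷ annotate M zs p
annotate M (z ∷ zs) (e ∷ p) = z ∷ annotate M zs p

annotate-proj₁ : ∀ M (zs : List (Maybe ℕ × ℕ)) {xs} (p : Embedding zs xs) → map proj₁ (annotate M zs p) ≡ xs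
annotate-proj₁ M [] [] = refl
annotate-proj₁ M zs (x ∷ʳ p) = cong (x ∷_) (annotate-proj₁ M zs p)
annotate-proj₁ M (z ∷ zs) (refl ∷ p) = cong (proj₁ z ∷_) (annotate-proj₁ M zs p)

annotate-⊆ : ∀ M (zs : List (Maybe ℕ × ℕ)) {xs} (p : Embedding zs xs) → zs ⊆ annotate M zs p
annotate-⊆ M [] [] = []
annotate-⊆ M zs (x ∷ʳ p) = _ ∷ʳ annotate-⊆ M zs p
annotate-⊆ M (z ∷ zs) (refl ∷ p) = refl ∷ annotate-⊆ M zs p

annotate-marks : ∀ M (zs : List (Maybe ℕ × ℕ)) {xs} (p : Embedding zs xs) → Unique (map proj₂ zs) →
  (∀ {z} → z ∈ zs → proj₂ z < M) → Unique (map proj₂ (annotate M zs p))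
annotate-bound : ∀ M (zs : List (Maybe ℕ × ℕ)) {xs} (p : Embedding zs xs) → (∀ {z} → z ∈ zs → proj₂ z < M) →
  ∀ {e} → e ∈ annotate M zs p → proj₂ e < M + length xs

annotate-bound M zs (x ∷ʳ p) h (here refl) = +-monoʳ-< M ≤-refl
annotate-bound M zs (x ∷ʳ p) h (there i) = <-≤-trans (annotate-bound M zs p h i) (+-monoʳ-≤ M (n≤1+n _))
annotate-bound M (z ∷ zs) (e ∷ p) h (here refl) = <-≤-trans (h (here refl)) (m≤m+n M _)
annotate-bound M (z ∷ zs) (e ∷ p) h (there i) = <-≤-trans (annotate-bound M zs p (h ∘ there) i) (+-monoʳ-≤ M (n≤1+n _))

annotate-fresh : ∀ M (zs : List (Maybe ℕ × ℕ)) {xs} (p : Embedding zs xs) a → a < M → (∀ {z} → z ∈ zs → a ≢ proj₂ z) →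
  ∀ {e} → e ∈ annotate M zs p → a ≢ proj₂ e
annotate-fresh M zs (_∷ʳ_ {ys = ys} x p) a a<M h (here refl) eq = <⇒≢ (<-≤-trans a<M (m≤m+n M (length ys))) eq
annotate-fresh M zs (x ∷ʳ p) a a<M h (there i) = annotate-fresh M zs p a a<M h i
annotate-fresh M (z ∷ zs) (e ∷ p) a a<M h (here refl) = h (here refl)
annotate-fresh M (z ∷ zs) (e ∷ p) a a<M h (there i) = annotate-fresh M zs p a a<M (h ∘ there) i

annotate-marks M [] [] u h = []
annotate-marks M zs (x ∷ʳ p) u h =
  All.map⁺ (All.tabulate λ i e → <⇒≢ (annotate-bound M zs p h i) (sym e)) ∷ annotate-marks M zs p u h
annotate-marks M (z ∷ zs) (e ∷ p) (z∉ ∷ u) h =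
  All.map⁺ (All.tabulate (annotate-fresh M zs p (proj₂ z) (h (here refl)) (λ i → All.lookup z∉ (∈-map⁺ proj₂ i)))) ∷
  annotate-marks M zs p u (h ∘ there)

annotate-positive : ∀ M (zs : List (Maybe ℕ × ℕ)) {xs} (p : Embedding zs xs) → 0 < M → (∀ {z} → z ∈ zs → 0 < proj₂ z) →
  ∀ {e} → e ∈ annotate M zs p → 0 < proj₂ e
annotate-positive M zs (x ∷ʳ p) m h (here refl) = ≤-trans m (m≤m+n M _)
annotate-positive M zs (x ∷ʳ p) m h (there i) = annotate-positive M zs p m h i
annotate-positive M (z ∷ zs) (e ∷ p) m h (here refl) = h (here refl)
annotate-positive M (z ∷ zs) (e ∷ p) m h (there i) = annotate-positive M zs p m (h ∘ there) i

base : List (Maybe ℕ × ℕ) → ℕ → ℕ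
base [] a = 0
base ((nothing , b) ∷ zs) a = base zs a
base ((just v , b) ∷ zs) a = (if b <ᵇ a then v else 0) ⊔ base zs a

base-upper : ∀ zs {v b a} → (just v , b) ∈ zs → b < a → v ≤ base zs a
base-upper ((nothing , b) ∷ zs) (there i) p = base-upper zs i p
base-upper ((just v , b) ∷ zs) (here refl) p rewrite <⇒<ᵇ≡ p = m≤m⊔n v _
base-upper ((just v , b) ∷ zs) (there i) p = ≤-trans (base-upper zs i p) (m≤n⊔m _ _)

base-least : ∀ zs a u → (∀ {v b} → (just v , b) ∈ zs → b < a → v ≤ u) → base zs a ≤ u
base-least [] a u h = z≤n
base-least ((nothing , b) ∷ zs) a u h = base-least zs a u (h ∘ there)
base-least ((just v , b) ∷ zs) a u h with b <ᵇ a in eq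
... | true = ⊔-lub (h (here refl) (<ᵇ≡⇒< eq)) (base-least zs a u (h ∘ there))
... | false = base-least zs a u (h ∘ there)

base-mono : ∀ zs {a a′} → a ≤ a′ → base zs a ≤ base zs a′
base-mono zs {a} {a′} p = base-least zs a (base zs a′) (λ i q → base-upper zs i (<-≤-trans q p))

module _ {K : ℕ} where

  code-< : ∀ {b b′ o o′} → b < b′ → o < K → b * K + o < b′ * K + o′
  code-< {b} {b′} {o} {o′} p q = begin-strict
    b * K + o    <⟨ +-monoʳ-< (b * K) q ⟩
    b * K + K    ≡⟨ +-comm (b * K) K ⟩
    suc b * K    ≤⟨ *-monoˡ-≤ K p ⟩
    b′ * K       ≤⟨ m≤m+n _ o′ ⟩
    b′ * K + o′  ∎
    where open ≤-Reasoning

  code-injective : ∀ {b b′ o o′} → o < K → o′ < K → b * K + o ≡ b′ * K + o′ → b ≡ b′ × o ≡ o′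
  code-injective {b} {b′} {o} {o′} p q e with <-cmp b b′
  ... | tri< r _ _ = ⊥-elim (<⇒≢ (code-< r p) e)
  ... | tri> _ _ r = ⊥-elim (<⇒≢ (code-< r q) (sym e))
  ... | tri≈ _ refl _ = refl , +-cancelˡ-≡ (b * K) o o′ e

Unique-catMaybes : ∀ (es : List (Maybe ℕ × ℕ)) → Unique (catMaybes (map proj₁ es)) →
  AllPairs (λ e e′ → ∀ {v} → proj₁ e ≡ just v → proj₁ e′ ≡ just v → ⊥) es
Unique-catMaybes [] u = []
Unique-catMaybes ((nothing , a) ∷ es) u = All.tabulate (λ _ ()) ∷ Unique-catMaybes es u
Unique-catMaybes ((just v , a) ∷ es) (v∉ ∷ u) =
  All.tabulate (λ { i refl f → All.lookup v∉ (just∈⇒∈-catMaybes (subst (_∈ map proj₁ es) f (∈-map⁺ proj₁ i))) refl }) ∷ Unique-catMaybes es u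

Vec-of : ∀ n (xs : List A) → length xs ≡ n → ∃ λ (v : Vec A n) → toList v ≡ xs
Vec-of _ [] refl = [] , refl
Vec-of _ (x ∷ xs) refl = let v , e = Vec-of _ xs refl in x ∷ v , cong (x ∷_) e

pairs-map : ∀ {n} (σ : Vec ℕ n) (π : Vec (Maybe ℕ) n) (f : A → ℕ) g ws → toList σ ≡ map f ws → toList π ≡ map g ws →
  pairs σ π ≡ map (λ w → f w , g w) ws
pairs-map [] [] f g [] e e′ = refl
pairs-map (s ∷ σ) (x ∷ π) f g (w ∷ ws) e e′ with ∷-injective e | ∷-injective e′
... | refl , r | refl , r′ = cong (_ ∷_) (pairs-map σ π f g ws r r′)

module _ {n m N : ℕ} {p : List ℕ} (π : Vec (Maybe ℕ) n) (p↭ : p ↭ oneTo m) (π↭ : catMaybes (toList π) ↭ oneTo N)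
  (O : Occurrence p (toList π)) where
  open Occurrence O renaming (cells to zs)

  private
    xs = toList π
    -- M exceeds all letters of the pattern, and the fresh marks stay below M + n, so K exceeds
    -- every mark.
    M = suc m
    K = M + n
    emb = embedding zs embeds
    es = annotate M zs emb

    len-xs : length xs ≡ n
    len-xs = length-toList π

    letter-range : ∀ {z} → z ∈ zs → 1 ≤ proj₂ z × proj₂ z ≤ m
    letter-range i = ∈-oneTo⁻ (∈-resp-↭ p↭ (subst (_ ∈_) pattern-is (∈-map⁺ proj₂ i)))

    letters-Unique : Unique (map proj₂ zs)
    letters-Unique = subst Unique (sym pattern-is) (Unique-resp-↭ (↭-sym p↭) (oneTo-Unique m))

    letter-injective : ∀ {z z′} → z ∈ zs → z′ ∈ zs → proj₂ z ≡ proj₂ z′ → z ≡ z′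
    letter-injective i j e with ∈-AllPairs₂ (AllPairs.map⁻ letters-Unique) i j
    ... | inj₁ q = q
    ... | inj₂ (inj₁ q) = ⊥-elim (q e)
    ... | inj₂ (inj₂ q) = ⊥-elim (q (sym e))

    -- Two digits in base K. The high digit is the entry at or just above which the position is
    -- placed; the low digit is 0 for the entry itself and the positive mark for a hole, which
    -- orders the holes sharing a gap.
    value : Maybe ℕ × ℕ → ℕ
    value (just v , a) = v * K + 0
    value (nothing , a) = base zs a * K + a

    mark<K : ∀ {e} → e ∈ es → proj₂ e < K
    mark<K i = subst (λ l → _ < M + l) len-xs (annotate-bound M zs emb (λ j → s≤s (proj₂ (letter-range j))) i)

    mark>0 : ∀ {e} → e ∈ es → 0 < proj₂ e
    mark>0 = annotate-positive M zs emb (s≤s z≤n) (λ j → proj₁ (letter-range j))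

    0<K : 0 < K
    0<K = s≤s z≤n

    f : List ℕ
    f = map value es

    f-Unique : Unique f
    f-Unique = AllPairs.map⁺ (go es mark<K mark>0 (AllPairs.map⁻ (annotate-marks M zs emb letters-Unique (λ j → s≤s (proj₂ (letter-range j)))))
      (Unique-catMaybes es (subst (λ l → Unique (catMaybes l)) (sym (annotate-proj₁ M zs emb)) (Unique-resp-↭ (↭-sym π↭) (oneTo-Unique N)))))
      where
      differ : ∀ e e′ → proj₂ e < K → proj₂ e′ < K → 0 < proj₂ e → 0 < proj₂ e′ → proj₂ e ≢ proj₂ e′ →
        (∀ {v} → proj₁ e ≡ just v → proj₁ e′ ≡ just v → ⊥) → value e ≢ value e′
      differ (just v , a) (just v′ , a′) k k′ l l′ ne h eq = h refl (cong just (sym (proj₁ (code-injective 0<K 0<K eq))))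
      differ (just v , a) (nothing , a′) k k′ l l′ ne h eq = <⇒≢ l′ (proj₂ (code-injective {b = v} {base zs a′} 0<K k′ eq))
      differ (nothing , a) (just v′ , a′) k k′ l l′ ne h eq = <⇒≢ l (sym (proj₂ (code-injective {b = base zs a} {v′} k 0<K eq)))
      differ (nothing , a) (nothing , a′) k k′ l l′ ne h eq = ne (proj₂ (code-injective {b = base zs a} {base zs a′} k k′ eq))
      go : ∀ es → (∀ {e} → e ∈ es → proj₂ e < K) → (∀ {e} → e ∈ es → 0 < proj₂ e) → AllPairs (_≢_ on proj₂) es →
        AllPairs (λ e e′ → ∀ {v} → proj₁ e ≡ just v → proj₁ e′ ≡ just v → ⊥) es → AllPairs (_≢_ on value) es
      go [] _ _ _ _ = []
      go (e ∷ es) k l (a ∷ as) (b ∷ bs) =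
        All.tabulate (λ i → differ e _ (k (here refl)) (k (there i)) (l (here refl)) (l (there i)) (All.lookup a i) (All.lookup b i)) ∷
        go es (k ∘ there) (l ∘ there) as bs

    v>0 : ∀ {v a} → (just v , a) ∈ zs → 0 < v
    v>0 i = proj₁ (∈-oneTo⁻ (∈-resp-↭ π↭ (just∈⇒∈-catMaybes (Sublist-∈ embeds (∈-map⁺ proj₁ i)))))

    -- Every entry playing a letter below b also plays one below a, hence is smaller than v. If
    -- there is none, the base is 0 and positivity of v gives the strict inequality.
    below-base : ∀ {v a b} → (just v , a) ∈ zs → b ≤ a → base zs b < v
    below-base {suc v} {a} {b} i q = s≤s (base-least zs b v (λ j r → s≤s⁻¹ (<ᵇ≡⇒< (trans (agree j i) (<⇒<ᵇ≡ (<-≤-trans r q))))))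
    below-base {zero} i q with () ← v>0 i

    value-order : ∀ {z z′} → z ∈ zs → z′ ∈ zs → (value z <ᵇ value z′) ≡ (proj₂ z <ᵇ proj₂ z′)
    value-order {just v , a} {just v′ , a′} i j = trans (<ᵇ-cong {v} {v′} (λ r → code-< r 0<K) (λ r → +-monoˡ-≤ 0 (*-monoˡ-≤ K r))) (agree i j)
    value-order {just v , a} {nothing , a′} i j = <ᵇ-cong {a} {a′}
      (λ r → +-mono-≤-< (*-monoˡ-≤ K (base-upper zs i r)) (≤-<-trans z≤n r))
      (λ r → <⇒≤ (code-< (below-base i r) (mark<K (Sublist-∈ (annotate-⊆ M zs emb) j))))
    value-order {nothing , a} {just v′ , a′} i j = <ᵇ-cong {a} {a′}
      (λ r → code-< (below-base j (<⇒≤ r)) (mark<K (Sublist-∈ (annotate-⊆ M zs emb) i)))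
      (λ r → +-mono-≤ (*-monoˡ-≤ K (base-upper zs j (≤∧≢⇒< r (λ e → case letter-injective i j (sym e) of λ ())))) z≤n)
    value-order {nothing , a} {nothing , a′} i j = <ᵇ-cong {a} {a′}
      (λ r → +-mono-≤-< (*-monoˡ-≤ K (base-mono zs (<⇒≤ r))) r)
      (λ r → +-mono-≤ (*-monoˡ-≤ K (base-mono zs r)) r)

    h : Maybe ℕ × ℕ → ℕ
    h e = suc (rank f (value e))

    h-order : ∀ {e} e′ → e ∈ es → (h e <ᵇ h e′) ≡ (value e <ᵇ value e′)
    h-order e′ i = rank-<ᵇ f (value e′) (∈-map⁺ value i)

    std-f : std f ≡ map h es
    std-f = sym (map-∘ es)

    len-f : length f ≡ n
    len-f = trans (length-map value es) (trans (sym (length-map proj₁ es)) (trans (cong length (annotate-proj₁ M zs emb)) len-xs))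

  occurrence⇒extension : ∃ λ (σ : Vec ℕ n) → σ ∈ allVecs (oneTo n) n × isExtension σ π ≡ true × contains (toList σ) p ≡ true
  occurrence⇒extension with Vec-of n (std f) (trans (length-map _ f) len-f)
  ... | σ , σ≡ = σ ,
      allVecs-complete (oneTo n) n σ (λ i → ∈-resp-↭ σ↭ i) ,
      ∧-intro (isPermOf-complete n (toList σ) σ↭) (subst (λ l → (l ==L catMaybes xs) ≡ true) (sym restrict-std) (==L-refl (catMaybes xs))) ,
      any-complete (λ s → std s ==L p) (subseqs (toList σ)) {map h zs}
        (subseqs-complete (subst (map h zs ⊆_) (sym toList-σ) (Sublist.map⁺ h (annotate-⊆ M zs emb))))
        (subst (λ l → (l ==L p) ≡ true) (sym pattern-std) (==L-refl p))
    where
    σ↭ : toList σ ↭ oneTo n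
    σ↭ = subst₂ (λ l k → l ↭ oneTo k) (sym σ≡) len-f (std-Unique f f-Unique)
    toList-σ : toList σ ≡ map h es
    toList-σ = trans σ≡ std-f
    pattern-std : std (map h zs) ≡ p
    pattern-std = begin
      std (map h zs)      ≡⟨ std-cong h proj₂ zs (λ {z} {z′} i j → trans (h-order z′ (Sublist-∈ (annotate-⊆ M zs emb) i)) (value-order i j)) ⟩
      std (map proj₂ zs)  ≡⟨ cong std pattern-is ⟩
      std p               ≡⟨ std-permutation m p p↭ ⟩
      p                   ∎
      where open ≡-Reasoning
    S = solid (pairs σ π)
    S-order : ∀ {w w′} → w ∈ S → w′ ∈ S → (proj₁ w <ᵇ proj₁ w′) ≡ (proj₂ w <ᵇ proj₂ w′)
    S-order i j with ∈-map⁻ (λ e → h e , proj₁ e) (subst (_ ∈_) (pairs-map σ π h proj₁ es toList-σ (sym (annotate-proj₁ M zs emb))) (∈-solid⁻ _ i))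
                   | ∈-map⁻ (λ e → h e , proj₁ e) (subst (_ ∈_) (pairs-map σ π h proj₁ es toList-σ (sym (annotate-proj₁ M zs emb))) (∈-solid⁻ _ j))
    ... | (just v , a) , k , refl | (just v′ , a′) , l , refl =
      trans (h-order (just v′ , a′) k) (<ᵇ-cong {v} {v′} (λ r → code-< r 0<K) (λ r → +-monoˡ-≤ 0 (*-monoˡ-≤ K r)))
    restrict-std : std (restrict σ π) ≡ catMaybes xs
    restrict-std = begin
      std (restrict σ π)                       ≡⟨ cong std (solid-proj₁ σ π) ⟨
      std (map proj₁ S)                        ≡⟨ std-cong proj₁ proj₂ S S-order ⟩
      std (map proj₂ S)                        ≡⟨ cong std (trans (solid-proj₂ (pairs σ π)) (cong catMaybes (pairs-proj₂ σ π))) ⟩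
      std (catMaybes xs)                       ≡⟨ std-permutation N (catMaybes xs) π↭ ⟩
      catMaybes xs                             ∎
      where open ≡-Reasoning

avoids⇒no-occurrence : ∀ {n m N p} (π : Vec (Maybe ℕ) n) → p ↭ oneTo m → catMaybes (toList π) ↭ oneTo N →
  avoids p π ≡ true → ¬ Occurrence p (toList π)
avoids⇒no-occurrence {n} {p = p} π p↭ π↭ e O with occurrence⇒extension π p↭ π↭ O
... | σ , σ∈ , ext , con with all-sound _ (allVecs (oneTo n) n) e σ∈
...   | q rewrite ext | con with () ← q

no-occurrence⇒avoids : ∀ {n p} (π : Vec (Maybe ℕ) n) → ¬ Occurrence p (toList π) → avoids p π ≡ true
no-occurrence⇒avoids {n} {p} π h = all-complete _ (allVecs (oneTo n) n) λ {σ} _ → go σ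
  where
  go : ∀ σ → not (isExtension σ π) ∨ not (contains (toList σ) p) ≡ true
  go σ with isExtension σ π in e | contains (toList σ) p in c
  ... | false | _ = refl
  ... | true | false = refl
  ... | true | true = ⊥-elim (h (extension⇒occurrence p σ π e c))

-- Splitting an occurrence at a good vertex

column : List (Maybe ℕ) → ℕ → Maybe ℕ
column [] c = nothing
column (x ∷ xs) zero = x
column (x ∷ xs) (suc c) = column xs c

isEntry : ℕ → Maybe ℕ → Bool
isEntry i (just v) = i ≡ᵇ v
isEntry i nothing = false

-- Row r carries the value r + 1. Thus the vertex (c , r) separates values at most r from values
-- above r, in agreement with `Above r`.
matrix : List (Maybe ℕ) → Matrix
matrix xs c r = isEntry (suc r) (column xs c)

isEntry-sound : ∀ {i x} → isEntry i x ≡ true → x ≡ just i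
isEntry-sound {i} {just v} e = cong just (sym (≡ᵇ≡⇒≡ e))

isEntry-refl : ∀ i → isEntry i (just i) ≡ true
isEntry-refl = ≡ᵇ-refl

holes : List (Maybe ℕ) → ℕ
holes [] = 0
holes (nothing ∷ xs) = suc (holes xs)
holes (just _ ∷ xs) = holes xs

length-holes : ∀ xs → length xs ≡ length (catMaybes xs) + holes xs
length-holes [] = refl
length-holes (nothing ∷ xs) = trans (cong suc (length-holes xs)) (sym (+-suc _ _))
length-holes (just _ ∷ xs) = cong suc (length-holes xs)

holes-⊆ : ∀ {xs ys} → xs ⊆ ys → holes xs ≤ holes ys
holes-⊆ [] = z≤n
holes-⊆ (nothing ∷ʳ p) = m≤n⇒m≤1+n (holes-⊆ p)
holes-⊆ (just _ ∷ʳ p) = holes-⊆ p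
holes-⊆ {nothing ∷ _} (refl ∷ p) = s≤s (holes-⊆ p)
holes-⊆ {just _ ∷ _} (refl ∷ p) = holes-⊆ p

catMaybes-⊆ : ∀ {xs ys : List (Maybe ℕ)} → xs ⊆ ys → catMaybes xs ⊆ catMaybes ys
catMaybes-⊆ [] = []
catMaybes-⊆ (nothing ∷ʳ p) = catMaybes-⊆ p
catMaybes-⊆ (just v ∷ʳ p) = v ∷ʳ catMaybes-⊆ p
catMaybes-⊆ {nothing ∷ _} (refl ∷ p) = catMaybes-⊆ p
catMaybes-⊆ {just _ ∷ _} (refl ∷ p) = refl ∷ catMaybes-⊆ p

-- Every hole is kept, so a chain of d entries grows into a word of length d plus the number of
-- holes.
fill-holes : ∀ (xs : List (Maybe ℕ)) {ys} → ys ⊆ catMaybes xs → ∃ λ τ → τ ⊆ xs × catMaybes τ ≡ ys × holes τ ≡ holes xs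
fill-holes [] [] = [] , [] , refl , refl
fill-holes (nothing ∷ xs) p = let τ , q , e , f = fill-holes xs p in nothing ∷ τ , refl ∷ q , e , cong suc f
fill-holes (just v ∷ xs) (_ ∷ʳ p) = let τ , q , e , f = fill-holes xs p in τ , just v ∷ʳ q , e , f
fill-holes (just v ∷ xs) (refl ∷ p) = let τ , q , e , f = fill-holes xs p in just v ∷ τ , refl ∷ q , cong (v ∷_) e , f

entry : Maybe ℕ → List ℕ
entry nothing = []
entry (just v) = v ∷ []

entries-suc : ∀ c xs → catMaybes (take (suc c) xs) ≡ catMaybes (take c xs) ++ entry (column xs c)
entries-suc zero [] = refl
entries-suc zero (nothing ∷ xs) = refl
entries-suc zero (just v ∷ xs) = refl
entries-suc (suc c) [] = refl
entries-suc (suc c) (nothing ∷ xs) = entries-suc c xs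
entries-suc (suc c) (just v ∷ xs) = cong (v ∷_) (entries-suc c xs)

∷ʳ-⊆-∷ʳ : ∀ ys {y : A} bs {v} → ys ++ y ∷ [] ⊆ bs ++ v ∷ [] → (y ≡ v × ys ⊆ bs) ⊎ (ys ++ y ∷ [] ⊆ bs)
∷ʳ-⊆-∷ʳ [] [] (refl ∷ []) = inj₁ (refl , [])
∷ʳ-⊆-∷ʳ [] [] (_ ∷ʳ ())
∷ʳ-⊆-∷ʳ (z ∷ []) [] (refl ∷ ())
∷ʳ-⊆-∷ʳ (z ∷ z′ ∷ ys) [] (refl ∷ ())
∷ʳ-⊆-∷ʳ (z ∷ ys) [] (_ ∷ʳ ())
∷ʳ-⊆-∷ʳ ys (b ∷ bs) (_ ∷ʳ p) with ∷ʳ-⊆-∷ʳ ys bs p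
... | inj₁ (e , q) = inj₁ (e , b ∷ʳ q)
... | inj₂ q = inj₂ (b ∷ʳ q)
∷ʳ-⊆-∷ʳ [] (b ∷ bs) (refl ∷ p) = inj₂ (refl ∷ minimum bs)
∷ʳ-⊆-∷ʳ (z ∷ ys) (b ∷ bs) (refl ∷ p) with ∷ʳ-⊆-∷ʳ ys bs p
... | inj₁ (e , q) = inj₁ (e , refl ∷ q)
... | inj₂ q = inj₂ (refl ∷ q)

last-entry : ∀ xs c ys {y} → ys ++ y ∷ [] ⊆ catMaybes (take c xs) →
  ∃ λ c′ → c′ < c × column xs c′ ≡ just y × ys ⊆ catMaybes (take c′ xs)
last-entry xs zero [] ()
last-entry xs zero (_ ∷ _) ()
last-entry xs (suc c) ys {y} p with column xs c in eq | subst (ys ++ y ∷ [] ⊆_) (entries-suc c xs) p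
... | nothing | q with last-entry xs c ys (subst (ys ++ y ∷ [] ⊆_) (++-identityʳ _) q)
...   | c′ , l , e , s = c′ , m≤n⇒m≤1+n l , e , s
last-entry xs (suc c) ys {y} p | just v | q with ∷ʳ-⊆-∷ʳ ys (catMaybes (take c xs)) q
...   | inj₁ (refl , s) = c , n<1+n c , eq , s
...   | inj₂ s with last-entry xs c ys s
...     | c′ , l , e , t = c′ , m≤n⇒m≤1+n l , e , t

Follows : Direction → ℕ → ℕ → Set
Follows up a b = a < b
Follows down a b = b < a

monotone : Direction → ℕ → List ℕ
monotone up ℓ = oneTo ℓ
monotone down ℓ = reverse (oneTo ℓ)

reverse-oneTo : ∀ ℓ → reverse (oneTo ℓ) ≡ map suc (downFrom ℓ)
reverse-oneTo ℓ = trans (sym (reverse-map suc (upTo ℓ))) (cong (map suc) (reverse-upTo ℓ))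

monotone-follows : ∀ o ℓ → AllPairs (Follows o) (monotone o ℓ)
monotone-follows up ℓ = AllPairs.map⁺ (AllPairs.applyUpTo⁺₁ _ ℓ (λ i<j _ → s≤s i<j))
monotone-follows down ℓ rewrite reverse-oneTo ℓ = AllPairs.map⁺ (AllPairs.applyDownFrom⁺₁ _ ℓ (λ i<j _ → s≤s i<j))

monotone-length : ∀ o ℓ → length (monotone o ℓ) ≡ ℓ
monotone-length up ℓ = length-oneTo ℓ
monotone-length down ℓ = trans (length-reverse (oneTo ℓ)) (length-oneTo ℓ)

monotone-↭ : ∀ o ℓ → monotone o ℓ ↭ oneTo ℓ
monotone-↭ up ℓ = ↭-refl
monotone-↭ down ℓ = ↭-reverse (oneTo ℓ)

Values : Direction → List (Maybe ℕ) → ℕ → ℕ → ℕ → ℕ → Set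
Values o xs c lo hi d = ∃ λ ys → ys ⊆ catMaybes (take c xs) × AllPairs (Follows o) ys ×
  (∀ {v} → v ∈ ys → lo < v × v ≤ hi) × length ys ≡ d

∈-∷ʳ⁻ : ∀ (ys : List A) {y v} → v ∈ ys ++ y ∷ [] → v ∈ ys ⊎ v ≡ y
∈-∷ʳ⁻ ys i with ∈-++⁻ ys i
... | inj₁ j = inj₁ j
... | inj₂ (here e) = inj₂ e

extend-values : ∀ xs {ys c c′ y} → ys ⊆ catMaybes (take c′ xs) → c′ < c → column xs c′ ≡ just y → ys ++ y ∷ [] ⊆ catMaybes (take c xs)
extend-values xs {ys} {c} {c′} {y} p l e = ⊆-trans
  (subst (ys ++ y ∷ [] ⊆_) (sym (trans (entries-suc c′ xs) (cong (λ x → catMaybes (take c′ xs) ++ entry x) e))) (Sublist.++⁺ p ⊆-refl))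
  (catMaybes-⊆ (Sublist.take⁺ l))

snoc-follows : ∀ o {ys y} → AllPairs (Follows o) ys → (∀ {v} → v ∈ ys → Follows o v y) → AllPairs (Follows o) (ys ++ y ∷ [])
snoc-follows o a h = AllPairs.++⁺ a ([] ∷ []) (All.tabulate (λ i → h i ∷ []))

chain⇒values : ∀ o xs d {c lo hi} → Chain o (matrix xs) c lo hi d → Values o xs c lo hi d
chain⇒values o xs zero w = [] , minimum _ , [] , (λ ()) , refl
chain⇒values up xs (suc d) (c′ , r′ , i , j , k , e , w) with chain⇒values up xs d w
... | ys , p , a , b , refl = ys ++ suc r′ ∷ [] , extend-values xs p i (isEntry-sound e) , snoc-follows up a (λ i → s≤s (proj₂ (b i))) ,
  (λ m → case ∈-∷ʳ⁻ ys m of λ { (inj₁ n) → proj₁ (b n) , ≤-trans (proj₂ (b n)) (<⇒≤ k) ; (inj₂ refl) → s≤s j , k }) ,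
  trans (length-++ ys) (+-comm _ 1)
chain⇒values down xs (suc d) (c′ , r′ , i , j , k , e , w) with chain⇒values down xs d w
... | ys , p , a , b , refl = ys ++ suc r′ ∷ [] , extend-values xs p i (isEntry-sound e) , snoc-follows down a (λ i → proj₁ (b i)) ,
  (λ m → case ∈-∷ʳ⁻ ys m of λ { (inj₁ n) → <-trans (s≤s j) (proj₁ (b n)) , proj₂ (b n) ; (inj₂ refl) → s≤s j , k }) ,
  trans (length-++ ys) (+-comm _ 1)

AllPairs-∷ʳ⁻ : ∀ {R : A → A → Set} ys {y} → AllPairs R (ys ++ y ∷ []) → AllPairs R ys × (∀ {v} → v ∈ ys → R v y)
AllPairs-∷ʳ⁻ [] _ = [] , λ ()
AllPairs-∷ʳ⁻ (z ∷ ys) (a ∷ as) with AllPairs-∷ʳ⁻ ys as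
... | b , h = All.++⁻ˡ ys a ∷ b , λ { (here refl) → All.lookup a (∈-++⁺ʳ ys (here refl)) ; (there i) → h i }

values⇒chain : ∀ o xs d {c lo hi} → Values o xs c lo hi d → Chain o (matrix xs) c lo hi d
values⇒chain o xs zero _ = tt
values⇒chain o xs (suc d) {c} (ys , p , a , b , e) with initLast ys
values⇒chain o xs (suc d) (_ , p , a , b , ()) | []
... | ys ∷ʳ′ zero with () ← proj₁ (b {0} (∈-++⁺ʳ ys (here refl)))
... | ys ∷ʳ′ suc y with last-entry xs c ys p | AllPairs-∷ʳ⁻ ys a | b (∈-++⁺ʳ ys (here refl)) | suc-injective (trans (+-comm 1 (length ys)) (trans (sym (length-++ ys)) e))
values⇒chain up xs (suc d) {c} (_ , p , a , b , e) | ys ∷ʳ′ suc y | c′ , l , f , q | a′ , h | s≤s lo≤y , y<hi | g =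
  c′ , y , l , lo≤y , y<hi , trans (cong (isEntry (suc y)) f) (isEntry-refl (suc y)) ,
  values⇒chain up xs d (ys , q , a′ , (λ i → proj₁ (b (∈-++⁺ˡ i)) , s≤s⁻¹ (h i)) , g)
values⇒chain down xs (suc d) {c} (_ , p , a , b , e) | ys ∷ʳ′ suc y | c′ , l , f , q | a′ , h | s≤s lo≤y , y<hi | g =
  c′ , y , l , lo≤y , y<hi , trans (cong (isEntry (suc y)) f) (isEntry-refl (suc y)) ,
  values⇒chain down xs d (ys , q , a′ , (λ i → h i , proj₂ (b (∈-++⁺ˡ i))) , g)

-- Good vertices and their region

Above : ℕ → Maybe ℕ × ℕ → Set
Above r (just v , _) = r < v
Above r (nothing , _) = ⊤

record Good (X : List ℕ) (xs : List (Maybe ℕ)) (c r : ℕ) : Set where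
  constructor good
  field
    cells   : List (Maybe ℕ × ℕ)
    embeds  : map proj₁ cells ⊆ drop c xs
    pattern-is : map proj₂ cells ≡ X
    agree   : AllAgree cells
    above   : ∀ {z} → z ∈ cells → Above r z

_≡ᴮ_ : Bool → Bool → Bool
a ≡ᴮ b = if a then b else not b

≡ᴮ-sound : ∀ a b → (a ≡ᴮ b) ≡ true → a ≡ b
≡ᴮ-sound true true e = refl
≡ᴮ-sound false false e = refl

≡ᴮ-refl : ∀ a → (a ≡ᴮ a) ≡ true
≡ᴮ-refl true = refl
≡ᴮ-refl false = refl

agreeᵇ : Maybe ℕ × ℕ → Maybe ℕ × ℕ → Bool
agreeᵇ (just u , a) (just v , b) = (u <ᵇ v) ≡ᴮ (a <ᵇ b)
agreeᵇ (just u , a) (nothing , b) = true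
agreeᵇ (nothing , a) _ = true

agreeᵇ-sound : ∀ z z′ → agreeᵇ z z′ ≡ true → Agree z z′
agreeᵇ-sound (just u , a) (just v , b) e = ≡ᴮ-sound _ _ e
agreeᵇ-sound (just u , a) (nothing , b) e = tt
agreeᵇ-sound (nothing , a) _ e = tt

agreeᵇ-complete : ∀ z z′ → Agree z z′ → agreeᵇ z z′ ≡ true
agreeᵇ-complete (just u , a) (just v , b) e = subst (λ t → ((u <ᵇ v) ≡ᴮ t) ≡ true) e (≡ᴮ-refl (u <ᵇ v))
agreeᵇ-complete (just u , a) (nothing , b) e = refl
agreeᵇ-complete (nothing , a) _ e = refl

aboveᵇ : ℕ → Maybe ℕ × ℕ → Bool
aboveᵇ r (just v , _) = r <ᵇ v
aboveᵇ r (nothing , _) = true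

aboveᵇ-sound : ∀ r z → aboveᵇ r z ≡ true → Above r z
aboveᵇ-sound r (just v , _) e = <ᵇ≡⇒< e
aboveᵇ-sound r (nothing , _) e = tt

aboveᵇ-complete : ∀ r z → Above r z → aboveᵇ r z ≡ true
aboveᵇ-complete r (just v , _) e = <⇒<ᵇ≡ e
aboveᵇ-complete r (nothing , _) e = refl

zip-proj₁ : ∀ (τ : List A) (X : List B) → length τ ≡ length X → map proj₁ (zip τ X) ≡ τ
zip-proj₁ [] [] e = refl
zip-proj₁ (t ∷ τ) (x ∷ X) e = cong (t ∷_) (zip-proj₁ τ X (suc-injective e))

zip-proj₂ : ∀ (τ : List A) (X : List B) → length τ ≡ length X → map proj₂ (zip τ X) ≡ X
zip-proj₂ [] [] e = refl
zip-proj₂ (t ∷ τ) (x ∷ X) e = cong (x ∷_) (zip-proj₂ τ X (suc-injective e))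

zip-proj : ∀ (zs : List (A × B)) → zip (map proj₁ zs) (map proj₂ zs) ≡ zs
zip-proj [] = refl
zip-proj (z ∷ zs) = cong (z ∷_) (zip-proj zs)

goodCells : ℕ → List (Maybe ℕ × ℕ) → Bool
goodCells r zs = all (λ z → all (agreeᵇ z) zs) zs ∧ all (aboveᵇ r) zs

goodᵇ : List ℕ → List (Maybe ℕ) → ℕ → ℕ → Bool
goodᵇ X xs c r = any (λ τ → (length τ ≡ᵇ length X) ∧ goodCells r (zip τ X)) (subseqs (drop c xs))

goodᵇ-sound : ∀ X xs c r → goodᵇ X xs c r ≡ true → Good X xs c r
goodᵇ-sound X xs c r e with any-sound _ (subseqs (drop c xs)) e
... | τ , τ∈ , f with ∧-true {length τ ≡ᵇ length X} f
...   | l , g with ∧-true {all (λ z → all (agreeᵇ z) (zip τ X)) (zip τ X)} g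
...     | g₁ , g₂ = good (zip τ X) (subst (_⊆ drop c xs) (sym (zip-proj₁ τ X (≡ᵇ≡⇒≡ l))) (subseqs-sound τ∈))
          (zip-proj₂ τ X (≡ᵇ≡⇒≡ l))
          (λ {z} {z′} i j → agreeᵇ-sound z z′ (all-sound (agreeᵇ z) (zip τ X) (all-sound _ (zip τ X) g₁ i) j))
          (λ {z} i → aboveᵇ-sound r z (all-sound (aboveᵇ r) (zip τ X) g₂ i))

goodᵇ-complete : ∀ X xs c r → Good X xs c r → goodᵇ X xs c r ≡ true
goodᵇ-complete X xs c r (good zs p refl a b) = any-complete _ (subseqs (drop c xs)) {map proj₁ zs} (subseqs-complete p)
  (∧-intro (subst (λ l → (l ≡ᵇ length (map proj₂ zs)) ≡ true) (trans (length-map proj₂ zs) (sym (length-map proj₁ zs))) (≡ᵇ-refl (length (map proj₂ zs))))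
    (subst (λ ws → goodCells r ws ≡ true) (sym (zip-proj zs))
      (∧-intro (all-complete _ zs λ {z} i → all-complete (agreeᵇ z) zs λ {z′} j → agreeᵇ-complete z z′ (a i j))
               (all-complete (aboveᵇ r) zs λ {z} i → aboveᵇ-complete r z (b i)))))

-- The bounds keep the region finite: if X is empty or fits into holes alone, goodness sets no limit
-- on r.
region : ℕ → ℕ → List ℕ → List (Maybe ℕ) → ℕ → ℕ → Bool
region n N X xs c r = (c <ᵇ suc n) ∧ ((r <ᵇ suc N) ∧ goodᵇ X xs c r)

module _ {n N : ℕ} {X : List ℕ} {xs : List (Maybe ℕ)} {c r : ℕ} where

  region-sound : region n N X xs c r ≡ true → c ≤ n × r ≤ N × Good X xs c r
  region-sound e with ∧-true {c <ᵇ suc n} e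
  ... | p , f with ∧-true {r <ᵇ suc N} f
  ...   | q , g = s≤s⁻¹ (<ᵇ≡⇒< p) , s≤s⁻¹ (<ᵇ≡⇒< q) , goodᵇ-sound X xs c r g

  region-complete : c ≤ n → r ≤ N → Good X xs c r → region n N X xs c r ≡ true
  region-complete p q g = ∧-intro (<⇒<ᵇ≡ (s≤s p)) (∧-intro (<⇒<ᵇ≡ (s≤s q)) (goodᵇ-complete X xs c r g))

region-Region : ∀ n N X xs → Region n N (region n N X xs)
region-Region n N X xs = record
  { bound-c = λ c r e → proj₁ (region-sound {n} {N} {X} {xs} {c} {r} e)
  ; bound-r = λ c r e → proj₁ (proj₂ (region-sound {n} {N} {X} {xs} {c} {r} e))
  ; left = λ c r e → let p , q , good zs i j k l = region-sound {n} {N} {X} {xs} {suc c} {r} e in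
      region-complete {n} {N} {X} {xs} {c} {r} (<⇒≤ p) q (good zs (⊆-trans i (Sublist.drop⁺-≥ (n≤1+n c))) j k l)
  ; below = λ c r e → let p , q , good zs i j k l = region-sound {n} {N} {X} {xs} {c} {suc r} e in
      region-complete {n} {N} {X} {xs} {c} {r} p (<⇒≤ q) (good zs i j k (λ {z} m → lower {r} z (l m))) }
  where
  lower : ∀ {r} z → Above (suc r) z → Above r z
  lower (just v , _) p = <⇒≤ p
  lower (nothing , _) p = tt

-- Occurrences and chains at good vertices

map-split : ∀ (f : A → B) zs as {bs} → map f zs ≡ as ++ bs → ∃₂ λ zs₁ zs₂ → zs ≡ zs₁ ++ zs₂ × map f zs₁ ≡ as × map f zs₂ ≡ bs
map-split f zs [] e = [] , zs , refl , refl , e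
map-split f (z ∷ zs) (a ∷ as) e with ∷-injective e
... | refl , e′ with map-split f zs as e′
...   | zs₁ , zs₂ , refl , refl , g = z ∷ zs₁ , zs₂ , refl , refl , g

⊆-split : ∀ (as : List A) {bs xs} → as ++ bs ⊆ xs → ∃ λ c → c ≤ length xs × as ⊆ take c xs × bs ⊆ drop c xs
⊆-split [] p = 0 , z≤n , [] , p
⊆-split (a ∷ as) (x ∷ʳ p) with ⊆-split (a ∷ as) p
... | c , l , q , s = suc c , s≤s l , x ∷ʳ q , s
⊆-split (a ∷ as) (refl ∷ p) with ⊆-split as p
... | c , l , q , s = suc c , s≤s l , refl ∷ q , s

maximum : List ℕ → ℕ
maximum [] = 0
maximum (x ∷ xs) = x ⊔ maximum xs

maximum-upper : ∀ xs {x} → x ∈ xs → x ≤ maximum xs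
maximum-upper (x ∷ xs) (here refl) = m≤m⊔n x _
maximum-upper (x ∷ xs) (there i) = ≤-trans (maximum-upper xs i) (m≤n⊔m x _)

maximum-least : ∀ xs u → (∀ {x} → x ∈ xs → x ≤ u) → maximum xs ≤ u
maximum-least [] u h = z≤n
maximum-least (x ∷ xs) u h = ⊔-lub (h (here refl)) (maximum-least xs u (h ∘ there))

∈-catMaybes⁺ : ∀ {zs : List (Maybe ℕ × ℕ)} {u a} → (just u , a) ∈ zs → u ∈ catMaybes (map proj₁ zs)
∈-catMaybes⁺ i = just∈⇒∈-catMaybes (∈-map⁺ proj₁ i)

∈-catMaybes⁻ : ∀ {zs : List (Maybe ℕ × ℕ)} {u} → u ∈ catMaybes (map proj₁ zs) → ∃ λ a → (just u , a) ∈ zs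
∈-catMaybes⁻ {(just u , a) ∷ zs} (here refl) = a , here refl
∈-catMaybes⁻ {(just u , a) ∷ zs} (there i) = let b , j = ∈-catMaybes⁻ {zs} i in b , there j
∈-catMaybes⁻ {(nothing , a) ∷ zs} i = let b , j = ∈-catMaybes⁻ {zs} i in b , there j

agree⇒follows : ∀ o {u v a b} → (u <ᵇ v) ≡ (a <ᵇ b) → (v <ᵇ u) ≡ (b <ᵇ a) → Follows o a b → Follows o u v
agree⇒follows up e f p = <ᵇ≡⇒< (trans e (<⇒<ᵇ≡ p))
agree⇒follows down e f p = <ᵇ≡⇒< (trans f (<⇒<ᵇ≡ p))

values-follow : ∀ o zs → AllAgree zs → AllPairs (Follows o on proj₂) zs → AllPairs (Follows o) (catMaybes (map proj₁ zs))
values-follow o [] g _ = []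
values-follow o ((nothing , a) ∷ zs) g (_ ∷ as) = values-follow o zs (λ i j → g (there i) (there j)) as
values-follow o ((just u , a) ∷ zs) g (h ∷ as) =
  All.tabulate (λ i → let b , j = ∈-catMaybes⁻ {zs} i in
    agree⇒follows o (g (here refl) (there j)) (g (there j) (here refl)) (All.lookup h j)) ∷
  values-follow o zs (λ i j → g (there i) (there j)) as

FollowsMaybe : Direction → Maybe ℕ → Maybe ℕ → Set
FollowsMaybe o (just u) (just v) = Follows o u v
FollowsMaybe o _ _ = ⊤

follows-lift : ∀ o τ → AllPairs (Follows o) (catMaybes τ) → AllPairs (FollowsMaybe o) τ
follows-lift o [] _ = []
follows-lift o (nothing ∷ τ) as = All.tabulate (λ _ → tt) ∷ follows-lift o τ as
follows-lift o (just u ∷ τ) (h ∷ as) = lift τ h ∷ follows-lift o τ as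
  where
  lift : ∀ τ → All (Follows o u) (catMaybes τ) → All (FollowsMaybe o (just u)) τ
  lift [] _ = []
  lift (nothing ∷ τ) h = tt ∷ lift τ h
  lift (just v ∷ τ) (p ∷ h) = p ∷ lift τ h

follows⇒agree : ∀ o z z′ → FollowsMaybe o (proj₁ z) (proj₁ z′) → Follows o (proj₂ z) (proj₂ z′) → Agree z z′ × Agree z′ z
follows⇒agree o (nothing , a) (nothing , b) p q = tt , tt
follows⇒agree o (nothing , a) (just v , b) p q = tt , tt
follows⇒agree o (just u , a) (nothing , b) p q = tt , tt
follows⇒agree up (just u , a) (just v , b) p q =
  trans (<⇒<ᵇ≡ p) (sym (<⇒<ᵇ≡ q)) , trans (≮⇒<ᵇ≡ (<⇒≯ p)) (sym (≮⇒<ᵇ≡ (<⇒≯ q)))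
follows⇒agree down (just u , a) (just v , b) p q =
  trans (≮⇒<ᵇ≡ (<⇒≯ p)) (sym (≮⇒<ᵇ≡ (<⇒≯ q))) , trans (<⇒<ᵇ≡ p) (sym (<⇒<ᵇ≡ q))

Agree-refl : ∀ z → Agree z z
Agree-refl (just u , a) = trans (n<ᵇn u) (sym (n<ᵇn a))
Agree-refl (nothing , a) = tt

module _ {n N ℓ : ℕ} {X : List ℕ} (X> : ∀ {b} → b ∈ X → ℓ < b) (o : Direction) (xs : List (Maybe ℕ))
  (len : length xs ≡ n) (xs↭ : catMaybes xs ↭ oneTo N) where

  private
    D = monotone o ℓ
    D≤ : ∀ {a} → a ∈ D → a ≤ ℓ
    D≤ i = proj₂ (∈-oneTo⁻ (∈-resp-↭ (monotone-↭ o ℓ) i))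

  occurrence⇒chain : Occurrence (D ++ X) xs →
    ∃₂ λ c r → region n N X xs c r ≡ true × Chain o (matrix xs) c 0 r (ℓ ∸ holes (take c xs))
  occurrence⇒chain (occurrence zs p e g) with map-split proj₂ zs D e
  ... | zs₁ , zs₂ , refl , e₁ , e₂ with ⊆-split (map proj₁ zs₁) (subst (_⊆ xs) (map-++ proj₁ zs₁ zs₂) p)
  -- The height is the largest entry playing a letter of the monotone part, or 0 if only holes play
  -- there. Letters of X are larger, so their entries lie above it.
  ...   | c , c≤ , p₁ , p₂ = c , maximum ys ,
          region-complete {n} {N} {X} {xs} {c} {maximum ys} (subst (c ≤_) len c≤) ys≤N
            (good zs₂ p₂ e₂ (λ i j → g (∈-++⁺ʳ zs₁ i) (∈-++⁺ʳ zs₁ j)) (λ {z} → above z)) ,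
          Chain-shorten o short (values⇒chain o xs (length ys)
            (ys , catMaybes-⊆ p₁ , values-follow o zs₁ (λ i j → g (∈-++⁺ˡ i) (∈-++⁺ˡ j)) (AllPairs.map⁻ (subst (AllPairs (Follows o)) (sym e₁) (monotone-follows o ℓ))) ,
             (λ i → proj₁ (range (Sublist-∈ ys⊆ i)) , maximum-upper ys i) , refl))
    where
    ys = catMaybes (map proj₁ zs₁)
    ys⊆ : ys ⊆ catMaybes xs
    ys⊆ = catMaybes-⊆ (⊆-trans p₁ (Sublist.take-⊆ c xs))
    range : ∀ {v} → v ∈ catMaybes xs → 1 ≤ v × v ≤ N
    range i = ∈-oneTo⁻ (∈-resp-↭ xs↭ i)
    ys≤N : maximum ys ≤ N
    ys≤N = maximum-least ys N (λ i → proj₂ (range (Sublist-∈ ys⊆ i)))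
    above : ∀ z → z ∈ zs₂ → Above (maximum ys) z
    above (nothing , b) i = tt
    above (just zero , b) i with () ← proj₁ (range (Sublist-∈ (catMaybes-⊆ (⊆-trans p₂ (Sublist.drop-⊆ c xs))) (∈-catMaybes⁺ i)))
    above (just (suc v) , b) i = s≤s (maximum-least ys v λ {u} j → let a , k = ∈-catMaybes⁻ {zs₁} j in
      s≤s⁻¹ (<ᵇ≡⇒< {u} {suc v} (trans (g (∈-++⁺ˡ k) (∈-++⁺ʳ zs₁ i))
        (<⇒<ᵇ≡ (≤-<-trans (D≤ (subst (a ∈_) e₁ (∈-map⁺ proj₂ k))) (X> (subst (b ∈_) e₂ (∈-map⁺ proj₂ i))))))))
    short : ℓ ∸ holes (take c xs) ≤ length ys
    short = m≤n+o⇒m∸n≤o ℓ (holes (take c xs)) (begin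
      ℓ                                        ≡⟨ monotone-length o ℓ ⟨
      length D                                 ≡⟨ cong length e₁ ⟨
      length (map proj₂ zs₁)                   ≡⟨ trans (length-map proj₂ zs₁) (sym (length-map proj₁ zs₁)) ⟩
      length (map proj₁ zs₁)                   ≡⟨ length-holes (map proj₁ zs₁) ⟩
      length ys + holes (map proj₁ zs₁)        ≤⟨ +-monoʳ-≤ (length ys) (holes-⊆ p₁) ⟩
      length ys + holes (take c xs)            ≡⟨ +-comm (length ys) _ ⟩
      holes (take c xs) + length ys            ∎)
      where open ≤-Reasoning

  chain⇒occurrence : ∀ c r → region n N X xs c r ≡ true → Chain o (matrix xs) c 0 r (ℓ ∸ holes (take c xs)) →
    Occurrence (D ++ X) xs
  chain⇒occurrence c r R w with region-sound {n} {N} {X} {xs} {c} {r} R | chain⇒values o xs _ w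
  ... | _ , _ , good zs₂ p₂ refl g₂ above | ys , q , a , b , l with fill-holes (take c xs) q
  ...   | τ , τ⊆ , refl , h = occurrence (zs₁ ++ zs₂)
          (subst₂ _⊆_ (trans (cong (_++ map proj₁ zs₂) (sym proj₁-zs₁)) (sym (map-++ proj₁ zs₁ zs₂))) (take++drop≡id c xs)
            (Sublist.++⁺ (⊆-trans (Sublist.take-⊆ ℓ τ) τ⊆) p₂))
          (trans (map-++ proj₂ zs₁ zs₂) (cong (_++ map proj₂ zs₂) proj₂-zs₁))
          λ {z} {z′} i j → agree z z′ (∈-++⁻ zs₁ i) (∈-++⁻ zs₁ j)
    where
    -- The holes alone may outnumber ℓ, so chain and holes together can be longer than the monotone
    -- part; any ℓ of them serve.
    τ₁ = take ℓ τ
    zs₁ = zip τ₁ D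
    long : ℓ ≤ length τ
    long = begin
      ℓ                                    ≤⟨ m≤n+m∸n ℓ (holes (take c xs)) ⟩
      holes (take c xs) + (ℓ ∸ holes (take c xs)) ≡⟨ cong₂ _+_ h l ⟨
      holes τ + length (catMaybes τ)       ≡⟨ +-comm (holes τ) _ ⟩
      length (catMaybes τ) + holes τ       ≡⟨ length-holes τ ⟨
      length τ                             ∎
      where open ≤-Reasoning
    lengths : length τ₁ ≡ length D
    lengths = trans (trans (length-take ℓ τ) (m≤n⇒m⊓n≡m long)) (sym (monotone-length o ℓ))
    proj₁-zs₁ : map proj₁ zs₁ ≡ τ₁
    proj₁-zs₁ = zip-proj₁ τ₁ D lengths
    proj₂-zs₁ : map proj₂ zs₁ ≡ D
    proj₂-zs₁ = zip-proj₂ τ₁ D lengths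
    τ₁⊆ : catMaybes τ₁ ⊆ catMaybes τ
    τ₁⊆ = catMaybes-⊆ (Sublist.take-⊆ ℓ τ)
    ordered : AllPairs (λ z z′ → Agree z z′ × Agree z′ z) zs₁
    ordered = AllPairs.zipWith (λ {z} {z′} (s , t) → follows⇒agree o z z′ s t)
      (AllPairs.map⁻ (subst (AllPairs (FollowsMaybe o)) (sym proj₁-zs₁) (follows-lift o τ₁ (AllPairs-⊆ τ₁⊆ a))) ,
       AllPairs.map⁻ (subst (AllPairs (Follows o)) (sym proj₂-zs₁) (monotone-follows o ℓ)))
    cross : ∀ z z′ → z ∈ zs₁ → z′ ∈ zs₂ → Agree z z′ × Agree z′ z
    -- For either direction o the monotone part lies below X in letters and in values, so this
    -- comparison is always of type `up`.
    cross z z′ i j with precede z z′ i j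
      where
      precede : ∀ z z′ → z ∈ zs₁ → z′ ∈ zs₂ → FollowsMaybe up (proj₁ z) (proj₁ z′) × proj₂ z < proj₂ z′
      precede z z′ i j = values z z′ i j , ≤-<-trans (D≤ (subst (_ ∈_) proj₂-zs₁ (∈-map⁺ proj₂ i))) (X> (∈-map⁺ proj₂ j))
        where
        values : ∀ z z′ → z ∈ zs₁ → z′ ∈ zs₂ → FollowsMaybe up (proj₁ z) (proj₁ z′)
        values (nothing , _) _ i j = tt
        values (just u , _) (nothing , _) i j = tt
        values (just u , _) (just v , _) i j =
          ≤-<-trans (proj₂ (b (Sublist-∈ τ₁⊆ (subst (λ t → u ∈ catMaybes t) proj₁-zs₁ (∈-catMaybes⁺ i))))) (above j)
    ... | s , t = follows⇒agree up z z′ s t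
    agree : ∀ z z′ → z ∈ zs₁ ⊎ z ∈ zs₂ → z′ ∈ zs₁ ⊎ z′ ∈ zs₂ → Agree z z′
    agree z z′ (inj₁ i) (inj₁ j) with ∈-AllPairs₂ ordered i j
    ... | inj₁ refl = Agree-refl z
    ... | inj₂ (inj₁ (s , _)) = s
    ... | inj₂ (inj₂ (_ , s)) = s
    agree z z′ (inj₁ i) (inj₂ j) = proj₁ (cross z z′ i j)
    agree z z′ (inj₂ i) (inj₁ j) = proj₂ (cross z′ z j i)
    agree z z′ (inj₂ i) (inj₂ j) = g₂ i j

-- The involution on partial permutations

build : ∀ n → (ℕ → A) → Vec A n
build zero f = []
build (suc n) f = f 0 ∷ build n (f ∘ suc)

build-cong : ∀ n {f g : ℕ → A} → (∀ c → f c ≡ g c) → build n f ≡ build n g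
build-cong zero h = refl
build-cong (suc n) h = cong₂ _∷_ (h 0) (build-cong n (h ∘ suc))

build-column : ∀ {n} (π : Vec (Maybe ℕ) n) → build n (column (toList π)) ≡ π
build-column [] = refl
build-column (x ∷ π) = cong (x ∷_) (build-column π)

column-build : ∀ n f c → c < n → column (toList (build n f)) c ≡ f c
column-build (suc n) f zero p = refl
column-build (suc n) f (suc c) (s≤s p) = column-build n (f ∘ suc) c p

column-beyond : ∀ xs c → length xs ≤ c → column xs c ≡ nothing
column-beyond [] c p = refl
column-beyond (x ∷ xs) (suc c) (s≤s p) = column-beyond xs c p

column-entry : ∀ xs c {v} → column xs c ≡ just v → v ∈ catMaybes xs
column-entry (x ∷ xs) zero refl = here refl
column-entry (just v ∷ xs) (suc c) e = there (column-entry xs c e)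
column-entry (nothing ∷ xs) (suc c) e = column-entry xs c e

findRow : (ℕ → Bool) → ℕ → Maybe ℕ
findRow P zero = nothing
findRow P (suc r) = if P r then just (suc r) else findRow P r

findRow-cong : ∀ {P Q} → (∀ r → P r ≡ Q r) → ∀ N → findRow P N ≡ findRow Q N
findRow-cong h zero = refl
findRow-cong h (suc N) rewrite h N | findRow-cong h N = refl

isHole : Maybe ℕ → Bool
isHole nothing = true
isHole (just _) = false

colsum-positive : ∀ X c r {r′} → r′ < r → X c r′ ≡ true → 0 < colsum X c r
colsum-positive X c (suc r) {r′} p e with m≤n⇒m<n∨m≡n (s≤s⁻¹ p)
... | inj₂ refl rewrite e = s≤s z≤n
... | inj₁ q = <-≤-trans (colsum-positive X c r q e) (m≤n+m _ ⟦ X c r ⟧)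

findRow-bound : ∀ P r {v} → findRow P r ≡ just v → v ≤ r
findRow-bound P (suc r) e with P r
findRow-bound P (suc r) refl | true = ≤-refl
... | false = m≤n⇒m≤1+n (findRow-bound P r e)

findRow-entry : ∀ X c N r → colsum X c N ≤ 1 → r < N → isEntry (suc r) (findRow (X c) N) ≡ X c r
findRow-entry X c (suc N) r p q with X c N in eq | m≤n⇒m<n∨m≡n (s≤s⁻¹ q)
... | true | inj₂ refl = trans (≡ᵇ-refl r) (sym eq)
... | true | inj₁ r<N = trans (≢⇒≡ᵇ≡ {r} {N} (<⇒≢ r<N)) (sym empty)
  where
  empty : X c r ≡ false
  empty with X c r in e
  ... | false = refl
  ... | true = ⊥-elim (<⇒≱ (colsum-positive X c N r<N e) (s≤s⁻¹ p))
... | false | inj₁ r<N = findRow-entry X c N r p r<N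
... | false | inj₂ refl = trans (none (findRow (X c) r) refl) (sym eq)
  where
  none : ∀ x → findRow (X c) r ≡ x → isEntry (suc r) x ≡ false
  none nothing _ = refl
  none (just v) e = ≢⇒≡ᵇ≡ {suc r} {v} (λ { refl → <-irrefl refl (findRow-bound (X c) r e) })

findRow-hole : ∀ X c N → isHole (findRow (X c) N) ≡ (colsum X c N ≡ᵇ 0)
findRow-hole X c zero = refl
findRow-hole X c (suc N) with X c N
... | true = refl
... | false = findRow-hole X c N

InRange : ℕ → Maybe ℕ → Set
InRange N x = ∀ {v} → x ≡ just v → 1 ≤ v × v ≤ N

findRow-isEntry : ∀ x N → InRange N x → findRow (λ r → isEntry (suc r) x) N ≡ x
findRow-isEntry nothing N h = none N
  where
  none : ∀ N → findRow (λ r → false) N ≡ nothing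
  none zero = refl
  none (suc N) = none N
findRow-isEntry (just v) N h = go N (proj₂ (h refl))
  where
  go : ∀ N → v ≤ N → findRow (λ r → suc r ≡ᵇ v) N ≡ just v
  go zero z≤n with () ← proj₁ (h refl)
  go (suc N) p with suc N ≡ᵇ v in eq
  ... | true = cong just (≡ᵇ≡⇒≡ eq)
  ... | false with m≤n⇒m<n∨m≡n p
  ...   | inj₁ (s≤s q) = go N q
  ...   | inj₂ refl with () ← trans (sym eq) (≡ᵇ-refl N)

colsum-entry : ∀ xs c r → colsum (matrix xs) c r ≤ 1
colsum-entry xs c = go
  where
  zero-below : ∀ r {v} → column xs c ≡ just v → r < v → colsum (matrix xs) c r ≡ 0
  zero-below zero e p = refl
  zero-below (suc r) {v} e p rewrite e | ≢⇒≡ᵇ≡ {suc r} {v} (<⇒≢ p) = zero-below r e (<⇒≤ p)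
  go : ∀ r → colsum (matrix xs) c r ≤ 1
  go zero = z≤n
  go (suc r) with isEntry (suc r) (column xs c) in eq
  ... | false = go r
  ... | true = ≤-reflexive (cong suc (zero-below r (isEntry-sound eq) ≤-refl))

rowsum-occ : ∀ xs c r → rowsum (matrix xs) c r ≡ occ (suc r) (catMaybes (take c xs))
rowsum-occ xs zero r = refl
rowsum-occ xs (suc c) r = sym (begin
    occ (suc r) (catMaybes (take (suc c) xs))
  ≡⟨ cong (occ (suc r)) (entries-suc c xs) ⟩
    occ (suc r) (catMaybes (take c xs) ++ entry (column xs c))
  ≡⟨ occ-++ (catMaybes (take c xs)) (column xs c) ⟩
    ⟦ isEntry (suc r) (column xs c) ⟧ + occ (suc r) (catMaybes (take c xs))
  ≡⟨ cong (⟦ isEntry (suc r) (column xs c) ⟧ +_) (rowsum-occ xs c r) ⟨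
    rowsum (matrix xs) (suc c) r ∎)
  where
  open ≡-Reasoning
  occ-++ : ∀ ys x → occ (suc r) (ys ++ entry x) ≡ ⟦ isEntry (suc r) x ⟧ + occ (suc r) ys
  occ-++ [] nothing = refl
  occ-++ [] (just v) = filterᵇ-∷ (suc r ≡ᵇ_) v []
  occ-++ (y ∷ ys) x = begin
      occ (suc r) (y ∷ ys ++ entry x)
    ≡⟨ filterᵇ-∷ (suc r ≡ᵇ_) y (ys ++ entry x) ⟩
      ⟦ suc r ≡ᵇ y ⟧ + occ (suc r) (ys ++ entry x)
    ≡⟨ cong (⟦ suc r ≡ᵇ y ⟧ +_) (occ-++ ys x) ⟩
      ⟦ suc r ≡ᵇ y ⟧ + (⟦ isEntry (suc r) x ⟧ + occ (suc r) ys)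
    ≡⟨ +-assoc ⟦ suc r ≡ᵇ y ⟧ _ _ ⟨
      (⟦ suc r ≡ᵇ y ⟧ + ⟦ isEntry (suc r) x ⟧) + occ (suc r) ys
    ≡⟨ cong (_+ occ (suc r) ys) (+-comm ⟦ suc r ≡ᵇ y ⟧ _) ⟩
      (⟦ isEntry (suc r) x ⟧ + ⟦ suc r ≡ᵇ y ⟧) + occ (suc r) ys
    ≡⟨ +-assoc ⟦ isEntry (suc r) x ⟧ _ _ ⟩
      ⟦ isEntry (suc r) x ⟧ + (⟦ suc r ≡ᵇ y ⟧ + occ (suc r) ys)
    ≡⟨ cong (⟦ isEntry (suc r) x ⟧ +_) (filterᵇ-∷ (suc r ≡ᵇ_) y ys) ⟨
      ⟦ isEntry (suc r) x ⟧ + occ (suc r) (y ∷ ys) ∎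

SameHoles : List (Maybe ℕ) → List (Maybe ℕ) → Set
SameHoles xs ys = ∀ c → isHole (column xs c) ≡ isHole (column ys c)

holesAt-cong : ∀ {n} (H : Subset n) (π ρ : Vec (Maybe ℕ) n) → SameHoles (toList π) (toList ρ) → holesAt H π ≡ holesAt H ρ
holesAt-cong [] [] [] h = refl
holesAt-cong (b ∷ H) (x ∷ π) (y ∷ ρ) h with h 0 | holesAt-cong H π ρ (h ∘ suc)
holesAt-cong (true ∷ H) (nothing ∷ π) (nothing ∷ ρ) h | e | q = q
holesAt-cong (true ∷ H) (just _ ∷ π) (just _ ∷ ρ) h | e | q = refl
holesAt-cong (false ∷ H) (nothing ∷ π) (nothing ∷ ρ) h | e | q = refl
holesAt-cong (false ∷ H) (just _ ∷ π) (just _ ∷ ρ) h | e | q = q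

holes-cong : ∀ xs ys → length xs ≡ length ys → SameHoles xs ys → ∀ c → holes (take c xs) ≡ holes (take c ys)
holes-cong xs ys e h zero = refl
holes-cong [] [] e h (suc c) = refl
holes-cong (x ∷ xs) (y ∷ ys) e h (suc c) with h 0 | holes-cong xs ys (suc-injective e) (h ∘ suc) c
holes-cong (nothing ∷ xs) (nothing ∷ ys) e h (suc c) | f | q = cong suc q
holes-cong (just _ ∷ xs) (just _ ∷ ys) e h (suc c) | f | q = q

Preserves : ℕ → Maybe ℕ → Maybe ℕ → Set
Preserves r x y = (x ≡ nothing → y ≡ nothing) × (∀ {v} → r < v → x ≡ just v → y ≡ just v)

drop-Pointwise : ∀ {R : Maybe ℕ → Maybe ℕ → Set} c xs ys → length xs ≡ length ys →
  (∀ c′ → c ≤ c′ → R (column xs c′) (column ys c′)) → Pointwise R (drop c xs) (drop c ys)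
drop-Pointwise zero [] [] e h = []
drop-Pointwise zero (x ∷ xs) (y ∷ ys) e h = h 0 z≤n ∷ drop-Pointwise zero xs ys (suc-injective e) (λ c′ _ → h (suc c′) z≤n)
drop-Pointwise (suc c) [] [] e h = []
drop-Pointwise (suc c) (x ∷ xs) (y ∷ ys) e h = drop-Pointwise c xs ys (suc-injective e) (λ c′ p → h (suc c′) (s≤s p))

transfer : ∀ {r} zs {xs ys} → map proj₁ zs ⊆ xs → Pointwise (Preserves r) xs ys → (∀ {z} → z ∈ zs → Above r z) → map proj₁ zs ⊆ ys
transfer [] p q h = minimum _
transfer (z ∷ zs) (x ∷ʳ p) (_ ∷ q) h = _ ∷ʳ transfer (z ∷ zs) p q h
transfer ((nothing , a) ∷ zs) (refl ∷ p) ((k , _) ∷ q) h = sym (k refl) ∷ transfer zs p q (h ∘ there)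
transfer ((just v , a) ∷ zs) (refl ∷ p) ((_ , k) ∷ q) h = sym (k (h (here refl)) refl) ∷ transfer zs p q (h ∘ there)

Good-transfer : ∀ {X c r} xs ys → length xs ≡ length ys → SameHoles xs ys →
  (∀ c′ r′ → c ≤ c′ → r ≤ r′ → matrix xs c′ r′ ≡ matrix ys c′ r′) → Good X xs c r → Good X ys c r
Good-transfer {X} {c} {r} xs ys e h m (good zs p x a b) = good zs (transfer zs p (drop-Pointwise c xs ys e preserves) b) x a b
  where
  preserves : ∀ c′ → c ≤ c′ → Preserves r (column xs c′) (column ys c′)
  preserves c′ q = keeps (column xs c′) (column ys c′) (h c′) , λ { {suc v} (s≤s l) f → isEntry-sound {suc v}
    (trans (sym (m c′ v q l)) (trans (cong (isEntry (suc v)) f) (isEntry-refl (suc v)))) }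
    where
    keeps : ∀ x y → isHole x ≡ isHole y → x ≡ nothing → y ≡ nothing
    keeps nothing nothing _ _ = refl

flip-flip : ∀ o → flip-direction (flip-direction o) ≡ o
flip-flip up = refl
flip-flip down = refl

module _ (n N : ℕ) (X : List ℕ) where

  switch : Vec (Maybe ℕ) n → Vec (Maybe ℕ) n
  switch π = build n (λ c → findRow (transpose n N (region n N X (toList π)) (matrix (toList π)) c) N)

  module Switch (π : Vec (Maybe ℕ) n) (π↭ : catMaybes (toList π) ↭ oneTo N) where

    private
      xs = toList π
      ys = toList (switch π)
      G = region n N X xs
      R = region-Region n N X xs
      len-xs : length xs ≡ n
      len-xs = length-toList π
      len-ys : length ys ≡ n
      len-ys = length-toList (switch π)
      same-length : length xs ≡ length ys
      same-length = trans len-xs (sym len-ys)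
    open Region R

    entries-Unique : Unique (catMaybes xs)
    entries-Unique = Unique-resp-↭ (↭-sym π↭) (oneTo-Unique N)

    in-range : ∀ c → InRange N (column xs c)
    in-range c e = ∈-oneTo⁻ (∈-resp-↭ π↭ (column-entry xs c e))

    matrix-PartialPerm : PartialPerm (matrix xs)
    matrix-PartialPerm = partialPerm (colsum-entry xs) (λ c r → subst (_≤ 1) (sym (rowsum-occ xs c r))
      (occ-Unique≤1 (suc r) _ (AllPairs-⊆ (catMaybes-⊆ (Sublist.take-⊆ c xs)) entries-Unique)))

    matrix-bound : ∀ xs → length xs ≡ n → ∀ c r → matrix xs c r ≡ true → c < n
    matrix-bound xs len c r e with c <? n
    ... | yes p = p
    ... | no p with () ← trans (sym (isEntry-sound {suc r} e)) (column-beyond xs c (≤-trans (≤-reflexive len) (≮⇒≥ p)))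

    private
      Y = transpose n N G (matrix xs)
      module TY = Transpose R matrix-PartialPerm {Y} (λ c r → refl)

    Y-support : ∀ c r → Y c r ≡ true → c < n × r < N
    Y-support c r e with G (suc c) (suc r) in eq
    ... | true = bound-c (suc c) (suc r) eq , bound-r (suc c) (suc r) eq
    ... | false = matrix-bound xs len-xs c r e , proj₂ (in-range c (isEntry-sound {suc r} e))

    Y-empty : ∀ c r → ¬ (c < n × r < N) → Y c r ≡ false
    Y-empty c r h with Y c r in eq
    ... | false = refl
    ... | true = ⊥-elim (h (Y-support c r eq))

    column-switch : ∀ c → c < n → column ys c ≡ findRow (Y c) N
    column-switch c p = column-build n (λ c → findRow (Y c) N) c p

    matrix-switch : ∀ c r → matrix ys c r ≡ Y c r
    matrix-switch c r with c <? n
    ... | no p = trans (cong (isEntry (suc r)) (column-beyond ys c (≤-trans (≤-reflexive len-ys) (≮⇒≥ p))))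
                       (sym (Y-empty c r (p ∘ proj₁)))
    ... | yes p with r <? N
    ...   | yes q = trans (cong (isEntry (suc r)) (column-switch c p)) (findRow-entry Y c N r (col≤1 TY.Y-PartialPerm c N) q)
    ...   | no q = trans (cong (isEntry (suc r)) (column-switch c p)) (trans (beyond (findRow (Y c) N) refl) (sym (Y-empty c r (q ∘ proj₂))))
      where
      beyond : ∀ x → findRow (Y c) N ≡ x → isEntry (suc r) x ≡ false
      beyond nothing _ = refl
      beyond (just v) e = ≢⇒≡ᵇ≡ {suc r} {v} (λ { refl → q (findRow-bound (Y c) N e) })

    open Transpose R matrix-PartialPerm {matrix ys} matrix-switch

    -- Holes are the empty columns, and the column sums are preserved.
    same-holes : SameHoles xs ys
    same-holes c with c <? n
    ... | no p = cong isHole (trans (column-beyond xs c (≤-trans (≤-reflexive len-xs) (≮⇒≥ p)))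
                             (sym (column-beyond ys c (≤-trans (≤-reflexive len-ys) (≮⇒≥ p)))))
    ... | yes p = begin
        isHole (column xs c)                   ≡⟨ cong isHole (findRow-isEntry (column xs c) N (in-range c)) ⟨
        isHole (findRow (matrix xs c) N)       ≡⟨ findRow-hole (matrix xs) c N ⟩
        (colsum (matrix xs) c N ≡ᵇ 0)          ≡⟨ cong (_≡ᵇ 0) (TY.colsum-Y c N ≤-refl) ⟨
        (colsum Y c N ≡ᵇ 0)                    ≡⟨ findRow-hole Y c N ⟨
        isHole (findRow (Y c) N)               ≡⟨ cong isHole (column-switch c p) ⟨
        isHole (column ys c)                   ∎
      where open ≡-Reasoning

    switch-holes : ∀ c → holes (take c xs) ≡ holes (take c ys)
    switch-holes = holes-cong xs ys same-length same-holes

    -- Preserved row sums make every value occur, and the equal number of holes leaves no place for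
    -- a repetition.
    switch-entries : catMaybes ys ↭ oneTo N
    switch-entries = Unique-↭ (oneTo-Unique N) mem (trans lengths (↭-length π↭))
      where
      mem : ∀ {v} → v ∈ oneTo N → v ∈ catMaybes ys
      mem {v} i with ∈-oneTo⁻ {N} i
      mem {suc r} i | _ = occ⇒∈ (suc r) (catMaybes ys) (begin
          occ (suc r) (catMaybes ys)           ≡⟨ cong (λ zs → occ (suc r) (catMaybes zs)) (take-all n ys (≤-reflexive len-ys)) ⟨
          occ (suc r) (catMaybes (take n ys))  ≡⟨ rowsum-occ ys n r ⟨
          rowsum (matrix ys) n r               ≡⟨ rowsum-Y r n ≤-refl ⟩
          rowsum (matrix xs) n r               ≡⟨ rowsum-occ xs n r ⟩
          occ (suc r) (catMaybes (take n xs))  ≡⟨ cong (λ zs → occ (suc r) (catMaybes zs)) (take-all n xs (≤-reflexive len-xs)) ⟩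
          occ (suc r) (catMaybes xs)           ≡⟨ occ-∈ (suc r) (catMaybes xs) entries-Unique (∈-resp-↭ (↭-sym π↭) i) ⟩
          1                                    ∎)
        where open ≡-Reasoning
      lengths : length (catMaybes ys) ≡ length (catMaybes xs)
      lengths = +-cancelʳ-≡ (holes xs) _ _ (begin
          length (catMaybes ys) + holes xs  ≡⟨ cong (length (catMaybes ys) +_) (subst₂ (λ as bs → holes as ≡ holes bs) (take-all n xs (≤-reflexive len-xs)) (take-all n ys (≤-reflexive len-ys)) (switch-holes n)) ⟩
          length (catMaybes ys) + holes ys  ≡⟨ length-holes ys ⟨
          length ys                         ≡⟨ same-length ⟨
          length xs                         ≡⟨ length-holes xs ⟩
          length (catMaybes xs) + holes xs  ∎)
        where open ≡-Reasoning

    private G′ = region n N X ys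

    -- A cell outside G is unchanged, and beyond a maximal vertex of G no cell lies inside G.
    region-switch : ∀ c r → G′ c r ≡ G c r
    region-switch c r with G c r in g | G′ c r in g′
    ... | true | true = refl
    ... | false | false = refl
    ... | true | false = ⊥-elim (case trans (sym g′) (forward (suc (n + N)) c r (m≤n+m _ (c + r)) g) of λ ())
      where
      forward : ∀ k c r → n + N < (c + r) + k → G c r ≡ true → G′ c r ≡ true
      forward zero c r p g = ⊥-elim (<⇒≱ p (≤-trans (≤-reflexive (+-identityʳ (c + r))) (+-mono-≤ (bound-c c r g) (bound-r c r g))))
      forward (suc k) c r p g with G (suc c) r in e₁ | G c (suc r) in e₂
      ... | true | _ = Region.left (region-Region n N X ys) c r (forward k (suc c) r (subst (n + N <_) (+-suc (c + r) k) p) e₁)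
      ... | false | true = Region.below (region-Region n N X ys) c r
            (forward k c (suc r) (subst (n + N <_) (trans (+-suc (c + r) k) (cong (_+ k) (sym (+-suc c r)))) p) e₂)
      ... | false | false = let p , q , w = region-sound {n} {N} {X} {xs} {c} {r} g in
            region-complete {n} {N} {X} {ys} {c} {r} p q (Good-transfer xs ys same-length same-holes
              (λ c′ r′ s t → sym (Y-outside c′ r′ (not-right* (s≤s s) (not-above* {suc c} (≤-trans t (n≤1+n r′)) e₁)))) w)
    -- No cell beyond a vertex outside G belongs to G, so goodness for the new word would transfer
    -- back at this very vertex.
    ... | false | true = ⊥-elim (case trans (sym g) (region-complete {n} {N} {X} {xs} {c} {r} (proj₁ found) (proj₁ (proj₂ found))
            (Good-transfer ys xs (sym same-length) (λ c → sym (same-holes c))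
              (λ c′ r′ s t → Y-outside c′ r′ (not-right* (≤-trans s (n≤1+n c′)) (not-above* {c} (≤-trans t (n≤1+n r′)) g))) (proj₂ (proj₂ found)))) of λ ())
      where found = region-sound {n} {N} {X} {ys} {c} {r} g′

    switch-involutive : switch (switch π) ≡ π
    switch-involutive = trans (build-cong n (λ c → trans (findRow-cong (transpose-involutive region-switch c) N)
      (findRow-isEntry (column xs c) N (in-range c)))) (build-column π)

    outermost : ∀ k c r → n < c + k → G c r ≡ true →
      ∃₂ λ c′ r′ → c ≤ c′ × r ≤ r′ × G c′ r′ ≡ true × G (suc c′) (suc r′) ≡ false
    outermost zero c r p g = ⊥-elim (<⇒≱ p (≤-trans (≤-reflexive (+-identityʳ c)) (bound-c c r g)))
    outermost (suc k) c r p g with G (suc c) (suc r) in e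
    ... | false = c , r , ≤-refl , ≤-refl , g , e
    ... | true = let c′ , r′ , i , j , w = outermost k (suc c) (suc r) (subst (n <_) (+-suc c k) p) e in
      c′ , r′ , <⇒≤ i , <⇒≤ j , w

    -- The chains are exchanged only at boundary vertices, so the vertex is first moved diagonally
    -- to the boundary. There the rectangle is larger and the holes to the left are at least as
    -- many, so the old chain is still long enough.
    switch-occurrence : ∀ {ℓ} → (∀ {b} → b ∈ X → ℓ < b) → ∀ o →
      Occurrence (monotone o ℓ ++ X) ys → Occurrence (monotone (flip-direction o) ℓ ++ X) xs
    switch-occurrence {ℓ} X> o O with occurrence⇒chain {n} {N} X> o ys len-ys switch-entries O
    ... | c , r , g′ , w with outermost (suc n) c r (m≤n+m (suc n) c) (trans (sym (region-switch c r)) g′)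
    ...   | c′ , r′ , i , j , g , e = chain⇒occurrence {n} {N} X> (flip-direction o) xs len-xs π↭ c′ r′ g
            (transpose-chain o _ c′ r′ g e (Chain-weaken o _ i z≤n j (Chain-shorten o fewer w)))
      where
      fewer : ℓ ∸ holes (take c′ xs) ≤ ℓ ∸ holes (take c ys)
      fewer = ∸-monoʳ-≤ ℓ (≤-trans (≤-reflexive (sym (switch-holes c))) (holes-⊆ (Sublist.take⁺ i)))

-- Counting the avoiders

module _ (n : ℕ) (H : Subset n) {ℓ m : ℕ} (X : List ℕ) (X> : ∀ {b} → b ∈ X → ℓ < b)
  (pattern-↭ : ∀ o → monotone o ℓ ++ X ↭ oneTo m) where

  private
    N = n ∸ ∣ H ∣
    switched = switch n N X

  Avoider : Direction → Vec (Maybe ℕ) n → Bool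
  Avoider o π = inS H π ∧ avoids (monotone o ℓ ++ X) π

  inS-entries : ∀ π → inS H π ≡ true → catMaybes (toList π) ↭ oneTo N
  inS-entries π e = isPermOf-sound N _ (proj₂ (∧-true {holesAt H π} e))

  switch-inS : ∀ π → inS H π ≡ true → inS H (switched π) ≡ true
  switch-inS π e = ∧-intro
    (trans (sym (holesAt-cong H π (switched π) same-holes)) (proj₁ (∧-true {holesAt H π} e)))
    (isPermOf-complete N _ switch-entries)
    where open Switch n N X π (inS-entries π e)

  switch-Avoider : ∀ o π → Avoider o π ≡ true → Avoider (flip-direction o) (switched π) ≡ true
  switch-Avoider o π e with ∧-true {inS H π} e
  ... | i , a = ∧-intro (switch-inS π i) (no-occurrence⇒avoids (switched π) λ O →
      avoids⇒no-occurrence {m = m} {N = N} π (pattern-↭ o) (inS-entries π i) a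
        (subst (λ o → Occurrence (monotone o ℓ ++ X) (toList π)) (flip-flip o)
          (Switch.switch-occurrence n N X π (inS-entries π i) X> (flip-direction o) O)))

  inS-candidate : ∀ π → inS H π ≡ true → π ∈ candidates n
  inS-candidate π e = allVecs-complete _ n π (λ {x} i → candidate x i)
    where
    candidate : ∀ x → x ∈ toList π → x ∈ nothing ∷ map just (oneTo n)
    candidate nothing i = here refl
    candidate (just v) i with ∈-oneTo⁻ {N} (∈-resp-↭ (inS-entries π e) (just∈⇒∈-catMaybes i))
    ... | p , q = there (∈-map⁺ just (∈-oneTo⁺ p (≤-trans q (m∸n≤m n ∣ H ∣))))

  private
    avoiders : Direction → List (Vec (Maybe ℕ) n)
    avoiders o = filterᵇ (Avoider o) (candidates n)

    candidates-Unique : Unique (candidates n)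
    candidates-Unique = allVecs-Unique _ n
      (All.map⁺ (All.tabulate λ _ ()) ∷ Unique.map⁺ (λ { refl → refl }) (oneTo-Unique n))

    ∈-avoiders : ∀ o {π} → π ∈ avoiders o → Avoider o π ≡ true
    ∈-avoiders o i = T⇒≡ (proj₂ (∈-filter⁻ (T? ∘ Avoider o) {xs = candidates n} i))
      where
      T⇒≡ : ∀ {b} → T b → b ≡ true
      T⇒≡ {true} _ = refl

    avoider-inS : ∀ o {π} → Avoider o π ≡ true → inS H π ≡ true
    avoider-inS o {π} e = proj₁ (∧-true {inS H π} e)

  avoiders-≤ : ∀ o → length (avoiders o) ≤ length (avoiders (flip-direction o))
  avoiders-≤ o = subst (_≤ length (avoiders (flip-direction o))) (length-map switched (avoiders o))
    (Unique-length (Unique-map-local switched (avoiders o) injective (Unique.filter⁺ (T? ∘ Avoider o) candidates-Unique)) maps)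
    where
    involutive : ∀ {π} → π ∈ avoiders o → switched (switched π) ≡ π
    involutive {π} i = Switch.switch-involutive n N X π (inS-entries π (avoider-inS o (∈-avoiders o i)))
    injective : ∀ {π ρ} → π ∈ avoiders o → ρ ∈ avoiders o → switched π ≡ switched ρ → π ≡ ρ
    injective i j e = trans (sym (involutive i)) (trans (cong switched e) (involutive j))
    maps : ∀ {ρ} → ρ ∈ map switched (avoiders o) → ρ ∈ avoiders (flip-direction o)
    maps i with ∈-map⁻ switched i
    ... | π , j , refl = let a = switch-Avoider o π (∈-avoiders o j) in
      ∈-filter⁺ (T? ∘ Avoider (flip-direction o)) (inS-candidate (switched π) (avoider-inS (flip-direction o) a))
        (subst T (sym a) tt)

  avoiders-≡ : s n H (monotone up ℓ ++ X) ≡ s n H (monotone down ℓ ++ X)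
  avoiders-≡ = ≤-antisym (avoiders-≤ up) (avoiders-≤ down)

∈-interval : ∀ {ℓ m x} → x ∈ interval ℓ m → ℓ < x
∈-interval {ℓ} i with ∈-map⁻ _ i
... | y , _ , refl = s≤s (m≤m+n ℓ y)

monotone-pattern-↭ : ∀ {ℓ m X} → ℓ ≤ m → X ↭ interval ℓ m → ∀ o → monotone o ℓ ++ X ↭ oneTo m
monotone-pattern-↭ {ℓ} {m} {X} ℓ≤m X↭ o = Unique-↭ (oneTo-Unique m) mem (begin
    length (monotone o ℓ ++ X)                 ≡⟨ length-++ (monotone o ℓ) ⟩
    length (monotone o ℓ) + length X           ≡⟨ cong₂ _+_ (monotone-length o ℓ) (trans (↭-length X↭) (trans (length-map _ (upTo (m ∸ ℓ))) (length-upTo (m ∸ ℓ)))) ⟩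
    ℓ + (m ∸ ℓ)                                ≡⟨ m+[n∸m]≡n ℓ≤m ⟩
    m                                          ≡⟨ length-oneTo m ⟨
    length (oneTo m)                           ∎)
  where
  open ≡-Reasoning
  mem : ∀ {x} → x ∈ oneTo m → x ∈ monotone o ℓ ++ X
  mem {x} i with ∈-oneTo⁻ {m} i | x ≤? ℓ
  ... | p , q | yes r = ∈-++⁺ˡ (∈-resp-↭ (↭-sym (monotone-↭ o ℓ)) (∈-oneTo⁺ p r))
  mem {suc x} i | p , q | no r = ∈-++⁺ʳ (monotone o ℓ) (∈-resp-↭ (↭-sym X↭)
    (subst (_∈ interval ℓ m) (cong suc (m+[n∸m]≡n (s≤s⁻¹ (≰⇒> r))))
      (∈-map⁺ (λ i → suc (ℓ + i)) (∈-upTo⁺ (∸-monoˡ-< q (s≤s⁻¹ (≰⇒> r)))))))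

theorem6 : (ℓ m : ℕ) (X : List ℕ) → 1 ≤ ℓ → ℓ ≤ m → X ↭ interval ℓ m →
    StronglyStarWilfEquiv (oneTo ℓ ++ X) (reverse (oneTo ℓ) ++ X)
theorem6 ℓ m X _ ℓ≤m X↭ n H =
  avoiders-≡ n H X (λ i → ∈-interval (∈-resp-↭ X↭ i)) (monotone-pattern-↭ ℓ≤m X↭)
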